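{- Let $\lambda/\mu$ be a skew shape such that no column contains more than two boxes. Then $$\mathrm{E}_{\lambda'/\mu'}(\mathbf{x};q,0)=q^{ -\mathrm{mininv}(\boldsymbol\nu)}\,\mathrm{LLT}_{\boldsymbol\nu}(\mathbf{x};q),$$ where $\boldsymbol\nu=(\boldsymbol\nu^1,\boldsymbol\nu^2,\dots)$ is the tuple indexed by the rows of $\lambda$ in which $\boldsymbol\nu^j$ is the vertical strip $1^{\lambda_j}/1^{\mu_j}$.
   Context: $\lambda'$ denotes the conjugate partition. $1^a/1^b$ (with $a\ge b\ge0$) is a single column of height $a$ with the boxes in rows $1,\dots,b$ removed. Box $(i,j)$ is in row $i$ and column $j$; for the definition of fillings below, diagrams are in English notation (rows numbered from the top). Skew specialized Macdonald fillings of a skew shape $\kappa/\tau$. Let $F$ be a filling of $\kappa/\tau$ with positive integers. A triple consists of boxes $a,b,c$ with $b,c\in\kappa/\tau$, $c$ somewhere below $b$ in the same column, and $a$ the position immediately to the left of $b$; $a$ may lie outside $\kappa/\tau$ (in $\tau$), in which case it is given value $\infty$. If $a\in\kappa/\tau$, the triple is an inversion-triple if $F(b)\le F(a)<F(c)$, or $F(a)<F(c)<F(b)$, or $F(c)<F(b)\le F(a)$; if $a\notin\kappa/\tau$ it is an inversion-triple if $F(b)>F(c)$. $\mathrm{COF}(\kappa/\tau)$ is the set of fillings $F$ of $\kappa/\tau$ such that each column has distinct entries, the first column is strictly decreasing from top to bottom, and every triple is an inversion-triple. A descent of $F$ is a box $(i,j)$ such that $(i,j-1),(i,j)\in\kappa/\tau$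 and $F(i,j-1)<F(i,j)$; $\mathrm{leg}(i,j)=\kappa_i-j$; $\mathrm{maj}(F)=\sum_{b\text{ descent}}(\mathrm{leg}(b)+1)$. Then $$\mathrm{E}_{\kappa/\tau}(\mathbf{x};q,0)=\sum_{F\in\mathrm{COF}(\kappa/\tau)}q^{\mathrm{maj}(F)}\prod_{(i,j)\in\kappa/\tau}x_{F(i,j)}.$$ LLT polynomials. For a $k$-tuple $\boldsymbol\nu=(\boldsymbol\nu^1,\dots,\boldsymbol\nu^k)$ of skew shapes let $\mathrm{SSYT}(\boldsymbol\nu)=\mathrm{SSYT}(\boldsymbol\nu^1)\times\cdots\times\mathrm{SSYT}(\boldsymbol\nu^k)$, where $\mathrm{SSYT}(\cdot)$ is the set of skew semistandard Young tableaux (rows weakly increasing, columns strictly increasing in the direction of increasing row index). For $T=(T^1,\dots,T^k)\in\mathrm{SSYT}(\boldsymbol\nu)$ let $\mathbf{x}^T$ be the product of $x_e$ over all entries $e$ of all the $T^i$. The content of a cell $u=(r,c)$ (row $r$, column $c$) is $c(u)=c-r$. Entries $T^i(u)>T^j(v)$ form an inversion if and only if ($i<j$ and $c(u)=c(v)$) or ($i>j$ and $c(u)=c(v)-1$). Let $\mathrm{inv}(T)$ be the total number of inversions of $T$, and $$\mathrm{LLT}_{\boldsymbol\nu}(\mathbf{x};q)=\sum_{T\in\mathrm{SSYT}(\boldsymbol\nu)}q^{\mathrm{inv}(T)}\mathbf{x}^T,\qquad \mathrm{mininv}(\boldsymbol\nu)=\min_{T\in\mathrm{SSYT}(\boldsymbol\nu)}\mathrm{inv}(T).$$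 -}

module Defs where

open import Data.Nat using (ℕ; zero; suc; _+_; _∸_; _≤_; _<_; _≥_; _>_; _≟_; _≤?_; _<?_)
open import Data.Nat.ListAction using (sum)
open import Data.Integer as ℤ using (ℤ; +_)
open import Data.Fin as Fin using (Fin; toℕ)
open import Data.Fin.Properties as Fin using (all?; any?)
open import Data.List as List
  using (List; []; _∷_; length; map; filter; concatMap; cartesianProduct; cartesianProductWith;
         applyUpTo; replicate; allFin)
open import Data.List.Relation.Unary.All using (All)
open import Data.List.Relation.Unary.Linked using (Linked)
open import Data.Vec as Vec using (Vec; []; _∷_; lookup)
open import Data.Vec.Properties using (≡-dec)
open import Data.Product using (∃-syntax; _×_; _,_; proj₁; proj₂)
open import Data.Sum using (_⊎_)
open import Level using (Level)
open import Relation.Binary.PropositionalEquality using (_≡_; _≢_)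
open import Relation.Nullary using (Dec; ¬_; ¬?)
open import Relation.Nullary.Decidable using (_×-dec_; _⊎-dec_; _→-dec_)
open import Relation.Unary using (Pred; Decidable)

private variable
  ℓ : Level
  A : Set
  n : ℕ

[1⋯_] : ℕ → List ℕ
[1⋯ n ] = applyUpTo suc n

-- Parts are numbered from 1; index 0 is junk.
part : List ℕ → ℕ → ℕ
part []       _             = 0
part (_ ∷ _)  0             = 0
part (p ∷ _)  1             = p
part (_ ∷ ps) (suc (suc i)) = part ps (suc i)

IsPartition : List ℕ → Set
IsPartition p = Linked _≥_ p × All (0 <_) p

infix 6 _/_
record SkewShape : Set where
  constructor _/_
  field
    outer inner : List ℕ

open SkewShape public

IsSkewShape : SkewShape → Set
IsSkewShape (κ / τ) = IsPartition κ × IsPartition τ × (∀ i → part τ i ≤ part κ i)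

conjugatePartition : List ℕ → List ℕ
conjugatePartition p = map (λ j → length (filter (j ≤?_) p)) [1⋯ part p 1 ]

conjugate : SkewShape → SkewShape
conjugate (κ / τ) = conjugatePartition κ / conjugatePartition τ

-- (row , column), both numbered from 1.
Cell : Set
Cell = ℕ × ℕ

row col : Cell → ℕ
row = proj₁
col = proj₂

content : Cell → ℤ
content u = + col u ℤ.- + row u

cells : SkewShape → List Cell
cells (κ / τ) =
  concatMap (λ i → applyUpTo (λ k → i , part τ i + suc k) (part κ i ∸ part τ i)) [1⋯ length κ ]

columnLength : SkewShape → ℕ → ℕ
columnLength s j = length (filter (λ u → col u ≟ j) (cells s))

-- The single column 1^a / 1^b.
verticalStrip : ℕ → ℕ → SkewShape
verticalStrip a b = replicate a 1 / replicate b 1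

rowStrips : SkewShape → List SkewShape
rowStrips (κ / τ) = map (λ j → verticalStrip (part κ j) (part τ j)) [1⋯ length κ ]

-- Formal power series in x₁, x₂, … over Laurent polynomials in q: f N α d is
-- the coefficient of q^d x₁^α₁ ⋯ x_N^α_N in f.  Coefficients in ℕ suffice here.
Series : Set
Series = (N : ℕ) → Vec ℕ N → ℤ → ℕ

infix 4 _≈_
_≈_ : Series → Series → Set
f ≈ g = ∀ N α d → f N α d ≡ g N α d

infixr 7 q^_·_
q^_·_ : ℤ → Series → Series
(q^ e · f) N α d = f N α (d ℤ.- e)

-- A filling of a list of cells assigns the k-th entry to the k-th cell.
Filling : List A → Set
Filling cs = Vec ℕ (length cs)

Positive : Vec ℕ n → Set
Positive w = ∀ u → 0 < lookup w u

positive? : (w : Vec ℕ n) → Dec (Positive w)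
positive? w = all? λ u → 0 <? lookup w u

words : ∀ n → List ℕ → List (Vec ℕ n)
words zero    _  = [] ∷ []
words (suc n) as = cartesianProductWith _∷_ as (words n as)

-- The exponents of x₁, …, x_N in ∏ᵤ x_{w(u)}.
weight : ∀ N → Vec ℕ n → Vec ℕ N
weight N w = Vec.tabulate λ k → Vec.count (_≟ suc (toℕ k)) w

-- Σ_w q^{stat w} ∏ᵤ x_{w(u)} over all words w satisfying P, which must force
-- the entries to be positive.  A word contributing to a monomial in
-- x₁, …, x_N has all its entries in {1, …, N}, so each coefficient is a count
-- over finitely many words.
generatingSeries : {P : Pred (Vec ℕ n) ℓ} → Decidable P → (Vec ℕ n → ℕ) → Series
generatingSeries {n = n} P? stat N α d =
  length (filter (λ w → P? w ×-dec ≡-dec _≟_ (weight N w) α ×-dec (+ stat w ℤ.≟ d))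
                 (words n [1⋯ N ]))

module Macdonald (s : SkewShape) where

  Box : Set
  Box = Fin (length (cells s))

  box : Box → Cell
  box = List.lookup (cells s)

  -- Rows are numbered from the top.
  Above : Box → Box → Set
  Above b c = col (box b) ≡ col (box c) × row (box b) < row (box c)

  above? : ∀ b c → Dec (Above b c)
  above? b c = (col (box b) ≟ col (box c)) ×-dec (row (box b) <? row (box c))

  -- a is the immediate left neighbour of b.
  LeftOf : Box → Box → Set
  LeftOf a b = row (box a) ≡ row (box b) × suc (col (box a)) ≡ col (box b)

  leftOf? : ∀ a b → Dec (LeftOf a b)
  leftOf? a b = (row (box a) ≟ row (box b)) ×-dec (suc (col (box a)) ≟ col (box b))

  InversionTriple : ℕ → ℕ → ℕ → Set
  InversionTriple Fa Fb Fc =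
    (Fb ≤ Fa × Fa < Fc) ⊎ (Fa < Fc × Fc < Fb) ⊎ (Fc < Fb × Fb ≤ Fa)

  inversionTriple? : ∀ x y z → Dec (InversionTriple x y z)
  inversionTriple? x y z =
    ((y ≤? x) ×-dec (x <? z)) ⊎-dec ((x <? z) ×-dec (z <? y)) ⊎-dec ((z <? y) ×-dec (y ≤? x))

  module _ (w : Filling (cells s)) where

    private
      F : Box → ℕ
      F = lookup w

    DistinctInColumns FirstColumnDecreasing InnerTriples OuterTriples COF : Set
    DistinctInColumns     = ∀ b c → Above b c → F b ≢ F c
    FirstColumnDecreasing = ∀ b c → Above b c → col (box b) ≡ 1 → F b > F c
    InnerTriples = ∀ a b c → LeftOf a b → Above b c → InversionTriple (F a) (F b) (F c)
    -- The position left of b carries ∞.  When b is in the first column this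
    -- only repeats FirstColumnDecreasing.
    OuterTriples = ∀ b c → ¬ (∃[ a ] LeftOf a b) → Above b c → F b > F c
    COF = Positive w × DistinctInColumns × FirstColumnDecreasing × InnerTriples × OuterTriples

    cof? : Dec COF
    cof? =
      positive? w
      ×-dec (all? λ b → all? λ c → above? b c →-dec ¬? (F b ≟ F c))
      ×-dec (all? λ b → all? λ c → above? b c →-dec (col (box b) ≟ 1) →-dec (F c <? F b))
      ×-dec (all? λ a → all? λ b → all? λ c →
               leftOf? a b →-dec above? b c →-dec inversionTriple? (F a) (F b) (F c))
      ×-dec (all? λ b → all? λ c →
               ¬? (any? λ a → leftOf? a b) →-dec above? b c →-dec (F c <? F b))

    Descent : Box → Set
    Descent b = ∃[ a ] (LeftOf a b × F a < F b)

    descent? : ∀ b → Dec (Descent b)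
    descent? b = any? λ a → leftOf? a b ×-dec (F a <? F b)

    leg : Box → ℕ
    leg b = part (outer s) (row (box b)) ∸ col (box b)

    maj : ℕ
    maj = sum (map (λ b → leg b + 1) (filter descent? (allFin _)))

  -- E_{κ/τ}(x; q, 0)
  E : Series
  E = generatingSeries cof? maj

open Macdonald public using (E)

module LLTPolynomial (ν : List SkewShape) where

  -- A tuple of fillings of ν¹, …, νᵏ is encoded as one filling of the disjoint
  -- union of their diagrams, each cell being tagged with its component.
  tupleCells : List (Fin (length ν) × Cell)
  tupleCells = concatMap (λ i → map (i ,_) (cells (List.lookup ν i))) (allFin (length ν))

  Box : Set
  Box = Fin (length tupleCells)

  component : Box → Fin (length ν)
  component u = proj₁ (List.lookup tupleCells u)

  box : Box → Cell
  box u = proj₂ (List.lookup tupleCells u)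

  SameRow SameColumn : Box → Box → Set
  SameRow    u v = component u ≡ component v × row (box u) ≡ row (box v)
  SameColumn u v = component u ≡ component v × col (box u) ≡ col (box v)

  sameRow? : ∀ u v → Dec (SameRow u v)
  sameRow? u v = (component u Fin.≟ component v) ×-dec (row (box u) ≟ row (box v))

  sameColumn? : ∀ u v → Dec (SameColumn u v)
  sameColumn? u v = (component u Fin.≟ component v) ×-dec (col (box u) ≟ col (box v))

  module _ (w : Filling tupleCells) where

    private
      T : Box → ℕ
      T = lookup w

    RowsWeaklyIncreasing ColumnsStrictlyIncreasing SSYT : Set
    RowsWeaklyIncreasing =
      ∀ u v → SameRow u v → col (box u) < col (box v) → T u ≤ T v
    ColumnsStrictlyIncreasing =
      ∀ u v → SameColumn u v → row (box u) < row (box v) → T u < T v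
    SSYT = Positive w × RowsWeaklyIncreasing × ColumnsStrictlyIncreasing

    ssyt? : Dec SSYT
    ssyt? =
      positive? w
      ×-dec (all? λ u → all? λ v →
               sameRow? u v →-dec (col (box u) <? col (box v)) →-dec (T u ≤? T v))
      ×-dec (all? λ u → all? λ v →
               sameColumn? u v →-dec (row (box u) <? row (box v)) →-dec (T u <? T v))

    Inversion : Box × Box → Set
    Inversion (u , v) =
      T u > T v ×
      ( (component u Fin.< component v × content (box u) ≡ content (box v))
      ⊎ (component u Fin.> component v × content (box u) ≡ content (box v) ℤ.- + 1))

    inversion? : ∀ p → Dec (Inversion p)
    inversion? (u , v) =
      (T v <? T u) ×-dec
      ( ((component u Fin.<? component v) ×-dec (content (box u) ℤ.≟ content (box v)))
      ⊎-dec
        ((component v Fin.<? component u) ×-dec (content (box u) ℤ.≟ content (box v) ℤ.- + 1)))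

    inv : ℕ
    inv = length (filter inversion? (cartesianProduct (allFin _) (allFin _)))

  LLT : Series
  LLT = generatingSeries ssyt? inv

  -- k = min { inv T ∣ T ∈ SSYT(ν) }
  IsMininv : ℕ → Set
  IsMininv k = (∃[ w ] (SSYT w × inv w ≡ k)) × (∀ w → SSYT w → k ≤ inv w)

open LLTPolynomial public using (LLT; IsMininv)

{-# OPTIONS --safe #-}

-- Column j of a filling, read with a fixed order of the letters, grows from row μⱼ to row λⱼ, so a
-- tuple of column sets is a walk d from μ to λ whose steps are 0/1-vectors; in both models the
-- column sets determine the filling.  No row of λ'/μ' has three boxes, i.e. λ_{j+2} ≤ μⱼ, so only
-- adjacent columns interact, and never two adjacent pairs at the same time.
--
-- Scanning the letters from the largest, the descents between columns j and j + 1 number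
-- maxₜ (d_{j+1} − dⱼ)⁺.  Scanning from the smallest, the inversions between them number a constant
-- plus the passages of d_{j+1} − dⱼ from 1 to 0.  By the reflection principle these two statistics
-- are equidistributed for a given order of the letters, one pair of columns at a time.  The series
-- of the second statistic is symmetric, since two consecutive letters can be exchanged by an
-- involution, so the order of the letters is irrelevant.

module Submission where

open import Defs
open import Data.Bool using (Bool; true; false; if_then_else_)
open import Data.Fin as Fin using (Fin; zero; suc; toℕ)
import Data.Fin.Properties as Finₚ
open import Data.Integer using (ℤ; +_; -_)
import Data.Integer as ℤ
import Data.Integer.Properties as ℤₚ
open import Algebra.Properties.AbelianGroup ℤₚ.+-0-abelianGroup using (∙-cancelˡ)
open import Data.List as List using (List; []; _∷_; _++_; length; filter; map; cartesianProduct; cartesianProductWith; allFin; applyUpTo; upTo; concatMap; replicate)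
open import Data.List.Membership.Propositional using (_∈_; find; lose)
open import Data.List.Membership.Propositional.Properties
import Data.List.Properties as Listₚ
open import Data.List.Relation.Binary.Permutation.Propositional as Perm using (_↭_)
open import Data.List.Relation.Binary.Permutation.Propositional.Properties using (∈-resp-↭; ↭-length)
import Data.List.Relation.Binary.Permutation.Setoid.Properties as Permₛ
open import Data.List.Relation.Unary.All as All using (All; []; _∷_)
open import Data.List.Relation.Unary.AllPairs using ([]; _∷_)
open import Data.List.Relation.Unary.Any as Any using (Any; here; there)
open import Data.List.Relation.Unary.Linked as Linked using (Linked; []; [-]; _∷_)
import Data.List.Relation.Unary.Any.Properties as Anyₚ
open import Data.List.Relation.Unary.Unique.Propositional using (Unique)
import Data.List.Relation.Unary.Unique.Propositional.Properties as Uniqueₚ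
open import Data.Maybe using (Maybe; just; nothing)
open import Data.Nat using (ℕ; zero; suc; pred; _+_; _*_; _∸_; _⊔_; _≤_; _<_; _>_; _≥_; z≤n; s≤s; _≟_; _≤?_; _<?_)
open import Data.Nat.ListAction using (sum)
open import Data.Nat.Properties
open import Algebra.Properties.CommutativeSemigroup +-commutativeSemigroup using (interchange; x∙yz≈y∙xz)
open import Data.Product using (Σ; ∃-syntax; _×_; _,_; proj₁; proj₂; swap)
import Data.Product.Properties as Productₚ
import Data.Bool.Properties as Boolₚ
open import Data.Sum using (_⊎_; inj₁; inj₂)
open import Data.Unit using (⊤; tt)
open import Data.Vec as Vec using (Vec; []; _∷_; lookup; tabulate; zipWith)
import Data.Vec.Properties as Vecₚ
open import Function using (_∘_; id; case_of_)
open import Relation.Binary.PropositionalEquality using (_≡_; _≢_; refl; sym; trans; cong; cong₂; subst; subst₂; setoid; module ≡-Reasoning)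
open import Relation.Nullary using (Dec; yes; no; ¬_; does; contradiction)
open import Relation.Nullary.Decidable using (_×-dec_; _⊎-dec_; _→-dec_; dec-true)
open import Relation.Binary.Definitions using (tri<; tri≈; tri>)

-- A pair of adjacent columns cannot be treated in isolation: the neighbouring pairs share a column
-- with it, and the monomial sees all columns. Reflection exchanges the steps of the two columns up
-- to a certain moment. This preserves how many columns hold each letter, hence the monomial; what
-- remains is that the statistics of the neighbouring pairs survive it. They do, because they are
-- frozen on the region `R` in which the reflection acts. `Edge` therefore admits an arbitrary
-- weight with just this invariance on `R`. Reflection counts paths by thresholds, `k ≤ e` and
-- `k ≤ ℓ`; exact values are recovered as differences of consecutive thresholds. Symmetry is proved
-- for the passages rather than for the maximal excess because passages add up over the letters: the
-- sum over tuples of columns becomes a walk, letter by letter, in which two consecutive letters can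
-- be isolated.

private variable
  A B : Set
  P Q : Set
  n : ℕ

-- Finite sums

infix 5 ∑
∑ : List A → (A → ℕ) → ℕ
∑ []       f = 0
∑ (x ∷ xs) f = f x + ∑ xs f

syntax ∑ xs (λ x → t) = ∑[ x ∈ xs ] t

infix 10 ⟦_⟧
⟦_⟧ : Dec P → ℕ
⟦ p ⟧ = if does p then 1 else 0

⟦⟧-yes : (p : Dec P) → P → ⟦ p ⟧ ≡ 1
⟦⟧-yes (yes _) _ = refl
⟦⟧-yes (no ¬p) p = contradiction p ¬p

⟦⟧-no : (p : Dec P) → ¬ P → ⟦ p ⟧ ≡ 0
⟦⟧-no (yes p) ¬p = contradiction p ¬p
⟦⟧-no (no _)  _  = refl

⟦⟧-dec : (p : Dec P) → (P × ⟦ p ⟧ ≡ 1) ⊎ (¬ P × ⟦ p ⟧ ≡ 0)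
⟦⟧-dec (yes p) = inj₁ (p , refl)
⟦⟧-dec (no ¬p) = inj₂ (¬p , refl)

⟦⟧≤1 : (p : Dec P) → ⟦ p ⟧ ≤ 1
⟦⟧≤1 (yes _) = ≤-refl
⟦⟧≤1 (no _)  = z≤n

⟦⟧-⇔ : (p : Dec P) (q : Dec Q) → (P → Q) → (Q → P) → ⟦ p ⟧ ≡ ⟦ q ⟧
⟦⟧-⇔ (yes p) q f g = sym (⟦⟧-yes q (f p))
⟦⟧-⇔ (no ¬p) q f g = sym (⟦⟧-no q (¬p ∘ g))

⟦⟧-× : (p : Dec P) (q : Dec Q) → ⟦ p ×-dec q ⟧ ≡ ⟦ p ⟧ * ⟦ q ⟧
⟦⟧-× (yes _) (yes _) = refl
⟦⟧-× (yes _) (no _)  = refl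
⟦⟧-× (no _)  _       = refl

⟦⟧-≢0 : (p : Dec P) → ⟦ p ⟧ ≢ 0 → P
⟦⟧-≢0 (yes p) _ = p
⟦⟧-≢0 (no _)  z = contradiction refl z

*-≢0ˡ : ∀ a {b} → a * b ≢ 0 → a ≢ 0
*-≢0ˡ a h refl = h refl

*-≢0ʳ : ∀ a {b} → a * b ≢ 0 → b ≢ 0
*-≢0ʳ a h refl = h (*-zeroʳ a)

∑-cong∈ : (xs : List A) {f g : A → ℕ} → (∀ {x} → x ∈ xs → f x ≡ g x) → ∑ xs f ≡ ∑ xs g
∑-cong∈ []       h = refl
∑-cong∈ (x ∷ xs) h = cong₂ _+_ (h (here refl)) (∑-cong∈ xs (h ∘ there))

∑-cong : (xs : List A) {f g : A → ℕ} → (∀ x → f x ≡ g x) → ∑ xs f ≡ ∑ xs g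
∑-cong xs h = ∑-cong∈ xs (λ {x} _ → h x)

∑-mono : (xs : List A) {f g : A → ℕ} → (∀ {x} → x ∈ xs → f x ≤ g x) → ∑ xs f ≤ ∑ xs g
∑-mono []       h = z≤n
∑-mono (x ∷ xs) h = +-mono-≤ (h (here refl)) (∑-mono xs (h ∘ there))

∑-zero : (xs : List A) {f : A → ℕ} → (∀ {x} → x ∈ xs → f x ≡ 0) → ∑ xs f ≡ 0
∑-zero []       h = refl
∑-zero (x ∷ xs) h = cong₂ _+_ (h (here refl)) (∑-zero xs (h ∘ there))

∑-+ : (xs : List A) (f g : A → ℕ) → ∑[ x ∈ xs ] (f x + g x) ≡ ∑ xs f + ∑ xs g
∑-+ []       f g = refl
∑-+ (x ∷ xs) f g = trans (cong (λ t → (f x + g x) + t) (∑-+ xs f g)) (interchange (f x) (g x) _ _)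

∑-*ˡ : (xs : List A) (c : ℕ) (f : A → ℕ) → ∑[ x ∈ xs ] (c * f x) ≡ c * ∑ xs f
∑-*ˡ []       c f = sym (*-zeroʳ c)
∑-*ˡ (x ∷ xs) c f = trans (cong (λ t → c * f x + t) (∑-*ˡ xs c f)) (sym (*-distribˡ-+ c (f x) _))

∑-swap : (xs : List A) (ys : List B) (f : A → B → ℕ) →
         ∑[ x ∈ xs ] ∑ ys (f x) ≡ ∑[ y ∈ ys ] ∑[ x ∈ xs ] f x y
∑-swap []       ys f = sym (∑-zero ys (λ _ → refl))
∑-swap (x ∷ xs) ys f =
  trans (cong (λ t → ∑ ys (f x) + t) (∑-swap xs ys f)) (sym (∑-+ ys (f x) (λ y → ∑[ x′ ∈ xs ] f x′ y)))

∑-++ : (xs ys : List A) (f : A → ℕ) → ∑ (xs ++ ys) f ≡ ∑ xs f + ∑ ys f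
∑-++ []       ys f = refl
∑-++ (x ∷ xs) ys f = trans (cong (λ t → f x + t) (∑-++ xs ys f)) (sym (+-assoc (f x) _ _))

∑-map : (g : A → B) (xs : List A) (f : B → ℕ) → ∑ (map g xs) f ≡ ∑ xs (f ∘ g)
∑-map g []       f = refl
∑-map g (x ∷ xs) f = cong (λ t → f (g x) + t) (∑-map g xs f)

∑-cartesianProductWith : {C : Set} (h : A → B → C) (xs : List A) (ys : List B) (f : C → ℕ) →
  ∑ (cartesianProductWith h xs ys) f ≡ ∑[ x ∈ xs ] ∑[ y ∈ ys ] f (h x y)
∑-cartesianProductWith h []       ys f = refl
∑-cartesianProductWith h (x ∷ xs) ys f =
  trans (∑-++ (map (h x) ys) _ f)
        (cong₂ _+_ (∑-map (h x) ys f) (∑-cartesianProductWith h xs ys f))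

∑-δ : {xs : List A} {x : A} (f : A → ℕ) → Unique xs → x ∈ xs →
      (∀ {y} → y ∈ xs → y ≢ x → f y ≡ 0) → ∑ xs f ≡ f x
∑-δ {xs = x ∷ xs} f (x∉ ∷ _) (here refl) h =
  trans (cong (λ t → f x + t) (∑-zero xs (λ y∈ → h (there y∈) (λ { refl → All.lookup x∉ y∈ refl }))))
        (+-identityʳ (f x))
∑-δ {xs = z ∷ xs} f (z∉ ∷ u) (there x∈) h =
  cong₂ _+_ (h (here refl) (All.lookup z∉ x∈)) (∑-δ f u x∈ (h ∘ there))

length-filter-∑ : {P : A → Set} (P? : ∀ x → Dec (P x)) (xs : List A) →
                  length (filter P? xs) ≡ ∑[ x ∈ xs ] ⟦ P? x ⟧
length-filter-∑ P? []       = refl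
length-filter-∑ P? (x ∷ xs) with P? x
... | yes _ = cong suc (length-filter-∑ P? xs)
... | no _  = length-filter-∑ P? xs

-- Terms with `F x ≡ 0` put no condition on `φ`, so `φ` may be a map that behaves well only on the
-- terms that count. The induction removes `φ x` from `ys` after each use.
∑-injection : {xs : List A} {ys : List B} (F : A → ℕ) (G : B → ℕ) (φ : A → B) → Unique xs →
  (∀ {x} → x ∈ xs → F x ≢ 0 → φ x ∈ ys × F x ≤ G (φ x)) →
  (∀ {x x′} → x ∈ xs → F x ≢ 0 → x′ ∈ xs → F x′ ≢ 0 → φ x ≡ φ x′ → x ≡ x′) →
  ∑ xs F ≤ ∑ ys G
∑-injection {xs = []} F G φ _ _ _ = z≤n
∑-injection {xs = x ∷ xs} {ys} F G φ (x∉ ∷ u) h inj with F x ≟ 0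
... | yes Fx≡0 = subst (λ t → t + ∑ xs F ≤ ∑ ys G) (sym Fx≡0)
    (∑-injection F G φ u (h ∘ there) (λ p q r s → inj (there p) q (there r) s))
... | no Fx≢0 with ∈-∃++ (proj₁ (h (here refl) Fx≢0))
... | ys₁ , ys₂ , refl = begin
  F x + ∑ xs F               ≤⟨ +-mono-≤ (proj₂ (h (here refl) Fx≢0)) rest ⟩
  G (φ x) + ∑ (ys₁ ++ ys₂) G ≡⟨ cong (λ t → G (φ x) + t) (∑-++ ys₁ ys₂ G) ⟩
  G (φ x) + (∑ ys₁ G + ∑ ys₂ G) ≡⟨ sym (+-assoc (G (φ x)) _ _) ⟩
  (G (φ x) + ∑ ys₁ G) + ∑ ys₂ G ≡⟨ cong (λ t → t + ∑ ys₂ G) (+-comm (G (φ x)) _) ⟩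
  (∑ ys₁ G + G (φ x)) + ∑ ys₂ G ≡⟨ +-assoc (∑ ys₁ G) _ _ ⟩
  ∑ ys₁ G + (G (φ x) + ∑ ys₂ G) ≡⟨ sym (∑-++ ys₁ (φ x ∷ ys₂) G) ⟩
  ∑ (ys₁ ++ φ x ∷ ys₂) G ∎
  where
  open ≤-Reasoning
  avoid : ∀ {x′} → x′ ∈ xs → F x′ ≢ 0 → φ x′ ∈ ys₁ ++ φ x ∷ ys₂ → φ x′ ∈ ys₁ ++ ys₂
  avoid {x′} x′∈ ne p with ∈-++⁻ ys₁ p
  ... | inj₁ q = ∈-++⁺ˡ q
  ... | inj₂ (there q) = ∈-++⁺ʳ ys₁ q
  ... | inj₂ (here q) =
    contradiction (inj (here refl) Fx≢0 (there x′∈) ne (sym q)) (All.lookup x∉ x′∈)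
  rest : ∑ xs F ≤ ∑ (ys₁ ++ ys₂) G
  rest = ∑-injection F G φ u
    (λ x′∈ ne → avoid x′∈ ne (proj₁ (h (there x′∈) ne)) , proj₂ (h (there x′∈) ne))
    (λ p q r s → inj (there p) q (there r) s)

∑-bijection : {xs : List A} {ys : List B} (F : A → ℕ) (G : B → ℕ) (φ : A → B) (ψ : B → A) →
  Unique xs → Unique ys →
  (∀ {x} → x ∈ xs → F x ≢ 0 → φ x ∈ ys × F x ≤ G (φ x) × ψ (φ x) ≡ x) →
  (∀ {y} → y ∈ ys → G y ≢ 0 → ψ y ∈ xs × G y ≤ F (ψ y) × φ (ψ y) ≡ y) →
  ∑ xs F ≡ ∑ ys G
∑-bijection F G φ ψ uxs uys h k = ≤-antisym
  (∑-injection F G φ uxs (λ p q → proj₁ (h p q) , proj₁ (proj₂ (h p q)))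
    (λ p q r s e → trans (sym (proj₂ (proj₂ (h p q)))) (trans (cong ψ e) (proj₂ (proj₂ (h r s))))))
  (∑-injection G F ψ uys (λ p q → proj₁ (k p q) , proj₁ (proj₂ (k p q)))
    (λ p q r s e → trans (sym (proj₂ (proj₂ (k p q)))) (trans (cong φ e) (proj₂ (proj₂ (k r s))))))

-- Words over a finite alphabet

vecs : List A → (n : ℕ) → List (Vec A n)
vecs as zero    = [] ∷ []
vecs as (suc n) = cartesianProductWith _∷_ as (vecs as n)

∑-vecs-suc : (as : List A) (n : ℕ) (f : Vec A (suc n) → ℕ) →
  ∑ (vecs as (suc n)) f ≡ ∑[ a ∈ as ] ∑[ w ∈ vecs as n ] f (a ∷ w)
∑-vecs-suc as n f = ∑-cartesianProductWith _∷_ as (vecs as n) f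

∈-vecs⁺ : {as : List A} (w : Vec A n) → (∀ i → lookup w i ∈ as) → w ∈ vecs as n
∈-vecs⁺ []      h = here refl
∈-vecs⁺ (x ∷ w) h = ∈-cartesianProductWith⁺ _∷_ (h zero) (∈-vecs⁺ w (h ∘ suc))

∈-vecs⁻ : {as : List A} {w : Vec A n} → w ∈ vecs as n → ∀ i → lookup w i ∈ as
∈-vecs⁻ {n = suc n} {as} p i with ∈-cartesianProductWith⁻ _∷_ as (vecs as n) p
∈-vecs⁻ {n = suc n} {as} p zero    | _ , _ , a∈ , w∈ , refl = a∈
∈-vecs⁻ {n = suc n} {as} p (suc i) | _ , _ , a∈ , w∈ , refl = ∈-vecs⁻ w∈ i

vecs-unique : {as : List A} (n : ℕ) → Unique as → Unique (vecs as n)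
vecs-unique zero    u = [] ∷ []
vecs-unique (suc n) u =
  Uniqueₚ.cartesianProductWith⁺ _∷_ (λ { refl → refl , refl }) u (vecs-unique n u)

words≡vecs : ∀ n (as : List ℕ) → words n as ≡ vecs as n
words≡vecs zero    as = refl
words≡vecs (suc n) as = cong (cartesianProductWith _∷_ as) (words≡vecs n as)

𝔹 : List Bool
𝔹 = false ∷ true ∷ []

bools : (N : ℕ) → List (Vec Bool N)
bools = vecs 𝔹

𝔹-unique : Unique 𝔹
𝔹-unique = ((λ ()) ∷ []) ∷ ([] ∷ [])

∈𝔹 : ∀ b → b ∈ 𝔹
∈𝔹 false = here refl
∈𝔹 true  = there (here refl)

-- Transposition of a 0/1-matrix, one row at a time: `X` tells which columns hold the first letter.
-- This connects the enumeration by columns with the walk by letters.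
∑-peel-row : ∀ n N (G : Vec (Vec Bool (suc N)) n → ℕ) →
  ∑ (vecs (bools (suc N)) n) G ≡ ∑[ X ∈ bools n ] ∑[ cs ∈ vecs (bools N) n ] G (zipWith _∷_ X cs)
∑-peel-row zero    N G = sym (+-identityʳ _)
∑-peel-row (suc n) N G = begin
  ∑ (vecs (bools (suc N)) (suc n)) G
    ≡⟨ ∑-vecs-suc (bools (suc N)) n G ⟩
  ∑[ c ∈ bools (suc N) ] ∑[ cs ∈ vecs (bools (suc N)) n ] G (c ∷ cs)
    ≡⟨ ∑-vecs-suc 𝔹 N (λ c → ∑[ cs ∈ vecs (bools (suc N)) n ] G (c ∷ cs)) ⟩
  ∑[ b ∈ 𝔹 ] ∑[ c ∈ bools N ] ∑[ cs ∈ vecs (bools (suc N)) n ] G ((b ∷ c) ∷ cs)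
    ≡⟨ ∑-cong 𝔹 (λ b → ∑-cong (bools N) (λ c → ∑-peel-row n N (λ cs → G ((b ∷ c) ∷ cs)))) ⟩
  ∑[ b ∈ 𝔹 ] ∑[ c ∈ bools N ] ∑[ X ∈ bools n ] ∑[ cs ∈ vecs (bools N) n ] G ((b ∷ c) ∷ zipWith _∷_ X cs)
    ≡⟨ ∑-cong 𝔹 (λ b → ∑-swap (bools N) (bools n) (λ c X → ∑[ cs ∈ vecs (bools N) n ] G ((b ∷ c) ∷ zipWith _∷_ X cs))) ⟩
  ∑[ b ∈ 𝔹 ] ∑[ X ∈ bools n ] ∑[ c ∈ bools N ] ∑[ cs ∈ vecs (bools N) n ] G ((b ∷ c) ∷ zipWith _∷_ X cs)
    ≡⟨ ∑-cong 𝔹 (λ b → ∑-cong (bools n) (λ X → sym (∑-vecs-suc (bools N) n (λ cs → G (zipWith _∷_ (b ∷ X) cs))))) ⟩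
  ∑[ b ∈ 𝔹 ] ∑[ X ∈ bools n ] ∑[ cs ∈ vecs (bools N) (suc n) ] G (zipWith _∷_ (b ∷ X) cs)
    ≡⟨ sym (∑-vecs-suc 𝔹 n (λ X → ∑[ cs ∈ vecs (bools N) (suc n) ] G (zipWith _∷_ X cs))) ⟩
  ∑[ X ∈ bools (suc n) ] ∑[ cs ∈ vecs (bools N) (suc n) ] G (zipWith _∷_ X cs) ∎
  where open ≡-Reasoning

-- The reflection principle for a pair of columns

bit : Bool → ℕ
bit false = 0
bit true  = 1

♯ : ∀ {N} → Vec Bool N → ℕ
♯ []      = 0
♯ (b ∷ v) = bit b + ♯ v

-- A and B are the indicator words of two adjacent columns in the order in which the letters are
-- scanned; x and y are the rows these columns have reached.  e is the largest excess y ∸ x on the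
-- way, ℓ the number of passages of y − x from 1 to 0.
e : ∀ {N} → ℕ → ℕ → Vec Bool N → Vec Bool N → ℕ
e x y []      []      = y ∸ x
e x y (a ∷ A) (b ∷ B) = (y ∸ x) ⊔ e (bit a + x) (bit b + y) A B

tr : ℕ → ℕ → Bool → Bool → ℕ
tr x y true  false = ⟦ y ≟ suc x ⟧
tr x y true  true  = 0
tr x y false _     = 0

ℓ : ∀ {N} → ℕ → ℕ → Vec Bool N → Vec Bool N → ℕ
ℓ x y []      []      = 0
ℓ x y (a ∷ A) (b ∷ B) = tr x y a b + ℓ (bit a + x) (bit b + y) A B

bit≤1 : ∀ b → bit b ≤ 1
bit≤1 false = z≤n
bit≤1 true  = ≤-refl

tr-zero : ∀ x y a b → y ≢ suc x → tr x y a b ≡ 0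
tr-zero x y true  false h = ⟦⟧-no (y ≟ suc x) h
tr-zero x y true  true  h = refl
tr-zero x y false b     h = refl

tr≤1 : ∀ x y a b → tr x y a b ≤ 1
tr≤1 x y true  false = ⟦⟧≤1 (y ≟ suc x)
tr≤1 x y true  true  = z≤n
tr≤1 x y false b     = z≤n

e-start : ∀ {N} x y (A B : Vec Bool N) → y ∸ x ≤ e x y A B
e-start x y []      []      = ≤-refl
e-start x y (a ∷ A) (b ∷ B) = m≤m⊔n (y ∸ x) _

-- On the way, `y` is at most its final height and `x` at least its initial one.
e-≤-end : ∀ {N} x y (A B : Vec Bool N) → e x y A B ≤ (♯ B + y) ∸ x
e-≤-end x y []      []      = ≤-refl
e-≤-end x y (a ∷ A) (b ∷ B) = ⊔-lub
  (∸-monoˡ-≤ x (m≤n+m y (♯ (b ∷ B))))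
  (begin
    e (bit a + x) (bit b + y) A B     ≤⟨ e-≤-end (bit a + x) (bit b + y) A B ⟩
    (♯ B + (bit b + y)) ∸ (bit a + x) ≤⟨ ∸-monoʳ-≤ (♯ B + (bit b + y)) (m≤n+m x (bit a)) ⟩
    (♯ B + (bit b + y)) ∸ x           ≡⟨ cong (λ t → t ∸ x) (sym (+-assoc (♯ B) (bit b) y)) ⟩
    ((♯ B + bit b) + y) ∸ x           ≡⟨ cong (λ t → (t + y) ∸ x) (+-comm (♯ B) (bit b)) ⟩
    ((bit b + ♯ B) + y) ∸ x ∎)
  where open ≤-Reasoning

e-≤-length : ∀ {N} x y (A B : Vec Bool N) → y ≤ x → e x y A B ≤ N
e-≤-length {N} x y A B y≤x = begin
  e x y A B     ≤⟨ e-≤-end x y A B ⟩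
  (♯ B + y) ∸ x ≤⟨ ∸-monoˡ-≤ x (+-monoʳ-≤ (♯ B) y≤x) ⟩
  (♯ B + x) ∸ x ≡⟨ m+n∸n≡m (♯ B) x ⟩
  ♯ B           ≤⟨ ♯≤ B ⟩
  N ∎
  where
  open ≤-Reasoning
  ♯≤ : ∀ {N} (B : Vec Bool N) → ♯ B ≤ N
  ♯≤ []      = z≤n
  ♯≤ (b ∷ B) = +-mono-≤ (bit≤1 b) (♯≤ B)

ℓ-≤-length : ∀ {N} x y (A B : Vec Bool N) → ℓ x y A B ≤ N
ℓ-≤-length x y []      []      = z≤n
ℓ-≤-length x y (a ∷ A) (b ∷ B) = +-mono-≤ (tr≤1 x y a b) (ℓ-≤-length _ _ A B)

♯-step : ∀ {N} b (B : Vec Bool N) y → ♯ (b ∷ B) + y ≡ ♯ B + (bit b + y)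
♯-step b B y = trans (cong (_+ y) (+-comm (bit b) (♯ B))) (+-assoc (♯ B) (bit b) y)

-- The second column ends no higher than `x`, so the excess never becomes positive.
ℓ-zero : ∀ {N} x y (A B : Vec Bool N) → ♯ B + y ≤ x → ℓ x y A B ≡ 0
ℓ-zero x y []      []      h = refl
ℓ-zero x y (a ∷ A) (b ∷ B) h = cong₂ _+_
  (tr-zero x y a b (λ { refl → <-irrefl refl (≤-trans (m≤n+m (suc x) (♯ (b ∷ B))) h) }))
  (ℓ-zero (bit a + x) (bit b + y) A B
    (≤-trans (≤-reflexive (sym (♯-step b B y))) (≤-trans h (m≤n+m x (bit a)))))

fin : ∀ {N} → ℕ → ℕ → Vec Bool N → ℕ
fin x X A = ⟦ ♯ A + x ≟ X ⟧

fin-step : ∀ {N} x X a (A : Vec Bool N) → fin x X (a ∷ A) ≡ fin (bit a + x) X A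
fin-step x X a A = cong (λ t → ⟦ t ≟ X ⟧) (♯-step a A x)

∑² : ∀ N → (Vec Bool N → Vec Bool N → ℕ) → ℕ
∑² N f = ∑[ A ∈ bools N ] ∑[ B ∈ bools N ] f A B

∑bits : (Bool → Bool → ℕ) → ℕ
∑bits f = ∑[ a ∈ 𝔹 ] ∑[ b ∈ 𝔹 ] f a b

∑²-cong : ∀ {N} {f g : Vec Bool N → Vec Bool N → ℕ} → (∀ A B → f A B ≡ g A B) → ∑² N f ≡ ∑² N g
∑²-cong {N} h = ∑-cong (bools N) (λ A → ∑-cong (bools N) (h A))

∑²-zero : ∀ {N} {f : Vec Bool N → Vec Bool N → ℕ} → (∀ A B → f A B ≡ 0) → ∑² N f ≡ 0
∑²-zero {N} h = ∑-zero (bools N) (λ {A} _ → ∑-zero (bools N) (λ {B} _ → h A B))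

∑bits-cong : {f g : Bool → Bool → ℕ} → (∀ a b → f a b ≡ g a b) → ∑bits f ≡ ∑bits g
∑bits-cong h = ∑-cong 𝔹 (λ a → ∑-cong 𝔹 (h a))

∑²-suc : ∀ N (f : Vec Bool (suc N) → Vec Bool (suc N) → ℕ) →
  ∑² (suc N) f ≡ ∑bits (λ a b → ∑² N (λ A B → f (a ∷ A) (b ∷ B)))
∑²-suc N f = begin
  ∑[ A ∈ bools (suc N) ] ∑[ B ∈ bools (suc N) ] f A B
    ≡⟨ ∑-vecs-suc 𝔹 N (λ A → ∑[ B ∈ bools (suc N) ] f A B) ⟩
  ∑[ a ∈ 𝔹 ] ∑[ A ∈ bools N ] ∑[ B ∈ bools (suc N) ] f (a ∷ A) B
    ≡⟨ ∑-cong 𝔹 (λ a → ∑-cong (bools N) (λ A → ∑-vecs-suc 𝔹 N (λ B → f (a ∷ A) B))) ⟩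
  ∑[ a ∈ 𝔹 ] ∑[ A ∈ bools N ] ∑[ b ∈ 𝔹 ] ∑[ B ∈ bools N ] f (a ∷ A) (b ∷ B)
    ≡⟨ ∑-cong 𝔹 (λ a → ∑-swap (bools N) 𝔹 (λ A b → ∑[ B ∈ bools N ] f (a ∷ A) (b ∷ B))) ⟩
  ∑bits (λ a b → ∑² N (λ A B → f (a ∷ A) (b ∷ B))) ∎
  where open ≡-Reasoning

≤?-⊔ : ∀ k {m} n → m < k → ⟦ k ≤? m ⊔ n ⟧ ≡ ⟦ k ≤? n ⟧
≤?-⊔ k {m} n m<k = ⟦⟧-⇔ (k ≤? m ⊔ n) (k ≤? n) to (λ h → ≤-trans h (m≤n⊔m m n))
  where
  to : k ≤ m ⊔ n → k ≤ n
  to h with ⊔-sel m n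
  ... | inj₁ eq = contradiction (subst (k ≤_) eq h) (<⇒≱ m<k)
  ... | inj₂ eq = subst (k ≤_) eq h

Family : ℕ → Set
Family N = ℕ → ℕ → Vec Bool N → Vec Bool N → ℕ

-- Reflection principle: the number of paths reaching excess y − x ≥ k, and the number of
-- paths passing k times from excess 1 to excess 0, both equal the number of all paths from a
-- shifted starting point.  The weight K of a path may depend on its position outside the region R.
module Edge (X Y x₀ : ℕ) (Y≤X : Y ≤ X) where

  R : ℕ → ℕ → Set
  R x y = x ≤ Y × x₀ ≤ y

  -- Hereditary in the number of letters. Anywhere, the weight of the remaining path may remember
  -- the step and the position. Inside `R` it remembers of the step only `bit a + bit b`, and
  -- nothing of the position, so it is unchanged when the columns exchange their steps and when the
  -- start is moved within `R`: the two operations used below.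
  Local : ∀ N → Family N → Set
  Local zero    K = ⊤
  Local (suc N) K =
    (∀ x y a b → Σ (Family N) λ K′ → Local N K′ ×
       (∀ A B → K x y (a ∷ A) (b ∷ B) ≡ K′ (bit a + x) (bit b + y) A B))
    × (Σ (ℕ → Family N) λ K′ → (∀ z → Local N (K′ z)) ×
       (∀ x y → R x y → ∀ a b A B →
          K x y (a ∷ A) (b ∷ B) ≡ K′ (bit a + bit b) (bit a + x) (bit b + y) A B))

  ends : ∀ {N} → ℕ → ℕ → Vec Bool N → Vec Bool N → ℕ
  ends x y A B = fin x X A * fin y Y B

  T U : ∀ {N} → ℕ → Family N → ℕ → ℕ → ℕ
  T {N} k K x y = ∑² N (λ A B → K x y A B * (ends x y A B * ⟦ k ≤? e x y A B ⟧))
  U {N} k K x y = ∑² N (λ A B → K x y A B * (ends x y A B * ⟦ k ≤? ℓ x y A B ⟧))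

  Paths : ∀ {N} → Family N → ℕ → ℕ → ℕ
  Paths {N} K x y = ∑² N (λ A B → K x y A B * ends x y A B)

  ends-step : ∀ {N} x y a b (A B : Vec Bool N) →
    ends x y (a ∷ A) (b ∷ B) ≡ ends (bit a + x) (bit b + y) A B
  ends-step x y a b A B = cong₂ _*_ (fin-step x X a A) (fin-step y Y b B)

  Step : ∀ {N} → Family (suc N) → (Bool → Bool → Family N) → ℕ → ℕ → Set
  Step K K′ x y = ∀ a b A B → K x y (a ∷ A) (b ∷ B) ≡ K′ a b (bit a + x) (bit b + y) A B

  module _ {N} (K : Family (suc N)) (K′ : Bool → Bool → Family N) (x y : ℕ) (s : Step K K′ x y) where

    T-step : ∀ k → y ∸ x < k →
      T k K x y ≡ ∑bits (λ a b → T k (K′ a b) (bit a + x) (bit b + y))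
    T-step k lt = trans (∑²-suc N (λ A B → K x y A B * (ends x y A B * ⟦ k ≤? e x y A B ⟧)))
      (∑bits-cong (λ a b → ∑²-cong (λ A B →
        cong₂ _*_ (s a b A B) (cong₂ _*_ (ends-step x y a b A B) (≤?-⊔ k (e (bit a + x) (bit b + y) A B) lt)))))

    -- `j a b` is the threshold left for the tail; it drops by one when the step is a passage.
    U-step : ∀ k → (j : Bool → Bool → ℕ) →
      (∀ a b n → ⟦ k ≤? tr x y a b + n ⟧ ≡ ⟦ j a b ≤? n ⟧) →
      U k K x y ≡ ∑bits (λ a b → U (j a b) (K′ a b) (bit a + x) (bit b + y))
    U-step k j h = trans (∑²-suc N (λ A B → K x y A B * (ends x y A B * ⟦ k ≤? ℓ x y A B ⟧)))
      (∑bits-cong (λ a b → ∑²-cong (λ A B →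
        cong₂ _*_ (s a b A B) (cong₂ _*_ (ends-step x y a b A B) (h a b (ℓ (bit a + x) (bit b + y) A B))))))

    Paths-step : Paths K x y ≡ ∑bits (λ a b → Paths (K′ a b) (bit a + x) (bit b + y))
    Paths-step = trans (∑²-suc N (λ A B → K x y A B * ends x y A B))
      (∑bits-cong (λ a b → ∑²-cong (λ A B →
        cong₂ _*_ (s a b A B) (ends-step x y a b A B))))

  fin-zero : ∀ {N} y (B : Vec Bool N) → Y < y → fin y Y B ≡ 0
  fin-zero y B Y<y = ⟦⟧-no (♯ B + y ≟ Y) (λ eq → <⇒≱ Y<y (subst (y ≤_) eq (m≤n+m y (♯ B))))

  Paths-zero : ∀ {N} (K : Family N) x y → Y < y → Paths K x y ≡ 0
  Paths-zero K x y Y<y = ∑²-zero (λ A B →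
    trans (cong (λ t → K x y A B * (fin x X A * t)) (fin-zero y B Y<y))
          (trans (cong (K x y A B *_) (*-zeroʳ (fin x X A))) (*-zeroʳ (K x y A B))))

  -- Once x > Y, no path ending at Y reaches positive excess any more.
  late-zero : ∀ {N} (w : ℕ) x y (A B : Vec Bool N) k n → 1 ≤ k → (♯ B + y ≡ Y → n ≡ 0) →
    w * (ends x y A B * ⟦ k ≤? n ⟧) ≡ 0
  late-zero w x y A B k n 1≤k h = trans (cong (w *_) vanishes) (*-zeroʳ w)
    where
    vanishes : ends x y A B * ⟦ k ≤? n ⟧ ≡ 0
    vanishes with ⟦⟧-dec (♯ B + y ≟ Y)
    ... | inj₁ (eq , _) = trans (cong (ends x y A B *_)
        (⟦⟧-no (k ≤? n) (λ k≤n → <⇒≱ 1≤k (subst (k ≤_) (h eq) k≤n)))) (*-zeroʳ (ends x y A B))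
    ... | inj₂ (_ , eq) = cong (_* ⟦ k ≤? n ⟧)
        (trans (cong (fin x X A *_) eq) (*-zeroʳ (fin x X A)))

  T-zero : ∀ {N} (K : Family N) {k} x y → 1 ≤ k → Y < x → T k K x y ≡ 0
  T-zero {N} K {k} x y 1≤k Y<x = ∑²-zero {N} (λ A B → late-zero (K x y A B) x y A B k (e x y A B) 1≤k (λ eq →
    n≤0⇒n≡0 (≤-trans (e-≤-end x y A B)
      (≤-reflexive (trans (cong (λ t → t ∸ x) eq) (m≤n⇒m∸n≡0 (<⇒≤ Y<x)))))))

  U-zero : ∀ {N} (K : Family N) {k} x y → 1 ≤ k → Y ≤ x → U k K x y ≡ 0
  U-zero {N} K {k} x y 1≤k Y≤x = ∑²-zero {N} (λ A B → late-zero (K x y A B) x y A B k (ℓ x y A B) 1≤k (λ eq →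
    ℓ-zero x y A B (subst (_≤ x) (sym eq) Y≤x)))

  T-full : ∀ {N} (K : Family N) {k} x y → k ≤ y ∸ x → T k K x y ≡ Paths K x y
  T-full K {k} x y h = ∑²-cong (λ A B → cong (K x y A B *_)
    (trans (cong (ends x y A B *_) (⟦⟧-yes (k ≤? e x y A B) (≤-trans h (e-start x y A B))))
           (*-identityʳ _)))

  U-full : ∀ {N} (K : Family N) x y → U 0 K x y ≡ Paths K x y
  U-full K x y = ∑²-cong (λ A B → cong (K x y A B *_) (*-identityʳ _))

  module _ {N} (K : Family (suc N)) (L : Local (suc N) K) where

    K↓ : ℕ → Family N
    K↓ = proj₁ (proj₂ L)

    K↓-local : ∀ z → Local N (K↓ z)
    K↓-local = proj₁ (proj₂ (proj₂ L))

    K↓-step : ∀ {x y} → R x y → Step K (λ a b → K↓ (bit a + bit b)) x y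
    K↓-step r = proj₂ (proj₂ (proj₂ L)) _ _ r

  next : ∀ {N} (K : Family (suc N)) → Local (suc N) K → Bool → Bool → Family N
  next K L a b = K↓ K L (bit a + bit b)

  +-shift : ∀ b x k → bit b + (x + k) ≡ (bit b + x) + k
  +-shift b x k = sym (+-assoc (bit b) x k)

  excess-below : ∀ {x x′ k} → 1 ≤ k → x′ < x → (x′ + k) ∸ x < k
  excess-below {x} {x′} {suc k} _ x′<x = ≤-<-trans (∸-monoʳ-≤ (x′ + suc k) x′<x)
    (subst (λ t → t ∸ suc x′ < suc k) (sym (+-suc x′ k)) (subst (_< suc k) (sym (m+n∸m≡n x′ k)) ≤-refl))

  -- Exchange the steps of the two columns until the excess first equals `k`. This moves the start
  -- to its mirror image (y - k , x + k) in the line y - x = k. The excess changes by at most one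
  -- per letter, is at least `k` at the mirrored start and at most 0 at (X , Y); hence every path
  -- from the mirrored start meets the line, and undoing the exchange is possible.
  reflection : ∀ N (K : Family N) → Local N K → ∀ k x y x′ y′ → 1 ≤ k → R x y → x₀ ≤ x →
    y ≡ x′ + k → y′ ≡ x + k → x′ ≤ x → T k K x y ≡ Paths K x′ y′
  reflection N K L k x y x′ y′ 1≤k r x₀≤x refl refl x′≤x with m≤n⇒m<n∨m≡n x′≤x
  ... | inj₂ refl = T-full K x y (≤-reflexive (sym (m+n∸m≡n x′ k)))
  reflection zero K L k x y x′ y′ 1≤k r x₀≤x refl refl x′≤x | inj₁ x′<x =
    trans (trans (+-identityʳ _) (+-identityʳ _)) (trans lhs (sym (trans (trans (+-identityʳ _) (+-identityʳ _)) rhs)))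
    where
    lhs : K x y [] [] * (ends x y [] [] * ⟦ k ≤? (x′ + k) ∸ x ⟧) ≡ 0
    lhs = trans (cong (λ t → K x y [] [] * (ends x y [] [] * t)) (⟦⟧-no (k ≤? _) (<⇒≱ (excess-below 1≤k x′<x))))
                (trans (cong (λ t → K x y [] [] * t) (*-zeroʳ (ends x y [] []))) (*-zeroʳ (K x y [] [])))
    rhs : K x′ y′ [] [] * ends x′ y′ [] [] ≡ 0
    rhs with ⟦⟧-dec (x′ ≟ X)
    ... | inj₂ (_ , eq) = trans (cong (λ t → K x′ y′ [] [] * (t * fin y′ Y [])) eq) (*-zeroʳ (K x′ y′ [] []))
    ... | inj₁ (refl , _) = trans (cong (λ t → K x′ y′ [] [] * (fin x′ X [] * t))
        (⟦⟧-no (y′ ≟ Y) (λ { refl → <⇒≱ x′<x (≤-trans (m≤m+n x k) Y≤X) })))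
        (trans (cong (λ t → K x′ y′ [] [] * t) (*-zeroʳ (fin x′ X []))) (*-zeroʳ (K x′ y′ [] [])))
  reflection (suc N) K L k x y x′ y′ 1≤k (x≤Y , x₀≤y) x₀≤x refl refl x′≤x | inj₁ x′<x = begin
    T k K x y
      ≡⟨ T-step K (next K L) x y (K↓-step K L (x≤Y , x₀≤y)) k (excess-below 1≤k x′<x) ⟩
    ∑bits (λ a b → T k (next K L a b) (bit a + x) (bit b + y))
      ≡⟨ ∑bits-cong termwise ⟩
    ∑bits (λ a b → Paths (K↓ K L (bit b + bit a)) (bit b + x′) (bit a + y′))
      ≡⟨ ∑-swap 𝔹 𝔹 (λ a b → Paths (K↓ K L (bit b + bit a)) (bit b + x′) (bit a + y′)) ⟩
    ∑bits (λ b a → Paths (K↓ K L (bit b + bit a)) (bit b + x′) (bit a + y′))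
      ≡⟨ sym (Paths-step K (next K L) x′ y′ (K↓-step K L (≤-trans x′≤x x≤Y , ≤-trans x₀≤x (m≤m+n x k)))) ⟩
    Paths K x′ y′ ∎
    where
    open ≡-Reasoning
    termwise : ∀ a b → T k (next K L a b) (bit a + x) (bit b + y)
                     ≡ Paths (K↓ K L (bit b + bit a)) (bit b + x′) (bit a + y′)
    termwise a b rewrite +-comm (bit b) (bit a) with bit a + x ≤? Y
    ... | yes ax≤Y = reflection N _ (K↓-local K L _) k _ _ _ _ 1≤k
        (ax≤Y , ≤-trans x₀≤y (m≤n+m y (bit b))) (≤-trans x₀≤x (m≤n+m x (bit a)))
        (+-shift b x′ k) (+-shift a x k)
        (≤-trans (+-monoˡ-≤ x′ (bit≤1 b)) (≤-trans x′<x (m≤n+m x (bit a))))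
    -- The path leaves `R` here: beyond `Y` no positive excess can be reached, and the mirror image
    -- has second coordinate above `Y` too.
    ... | no ax≰Y = trans (T-zero (next K L a b) (bit a + x) (bit b + y) 1≤k (≰⇒> ax≰Y))
        (sym (Paths-zero (next K L a b) (bit b + x′) (bit a + y′) (subst (Y <_) (sym (+-shift a x k)) (<-≤-trans (≰⇒> ax≰Y) (m≤m+n _ k)))))

  -- Up to the first passage a path is copied, translated by (-κ , κ). After it both columns stand
  -- at one height h and κ passages remain to be made; by `low` and `reflection` such continuations
  -- are equinumerous with the paths from (h - κ , h + κ), which is the translate of (h , h). A path
  -- from the translated start does come to such a point, since its final excess is not positive.
  passages : ∀ N (K : Family N) → Local N K → ∀ κ x y x″ y′ → suc κ ≤ x₀ → R x y → x₀ ≤ x →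
    x ≡ x″ + κ → y′ ≡ y + κ → x < y → U (suc κ) K x y ≡ Paths K x″ y′

  -- Neither statistic moves before the excess becomes 1, say at (x , x + 1). With k = κ + 1,
  -- translating this point as in `passages` and mirroring it as in `reflection` give the same start
  -- (x - κ , x + 1 + κ). The recursion with `passages` descends in the number of letters.
  low : ∀ N (K : Family N) → Local N K → ∀ k x y → 1 ≤ k → k ≤ x₀ → R x y → x₀ ≤ x → y ≤ x →
    U k K x y ≡ T k K x y

  passages zero K L κ x y x″ y′ κ<x₀ r x₀≤x refl refl x<y =
    trans (trans (+-identityʳ _) (+-identityʳ _)) (trans lhs (sym (trans (trans (+-identityʳ _) (+-identityʳ _)) rhs)))
    where
    lhs : K x y [] [] * (ends x y [] [] * 0) ≡ 0
    lhs = trans (cong (λ t → K x y [] [] * t) (*-zeroʳ (ends x y [] []))) (*-zeroʳ (K x y [] []))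
    rhs : K x″ y′ [] [] * ends x″ y′ [] [] ≡ 0
    rhs with ⟦⟧-dec (x″ ≟ X)
    ... | inj₂ (_ , eq) = trans (cong (λ t → K x″ y′ [] [] * (t * fin y′ Y [])) eq) (*-zeroʳ (K x″ y′ [] []))
    ... | inj₁ (refl , _) = trans (cong (λ t → K x″ y′ [] [] * (fin x″ X [] * t))
        (⟦⟧-no (y′ ≟ Y) (λ { refl → <⇒≱ x<y (≤-trans (≤-trans (m≤m+n y κ) Y≤X) (m≤m+n x″ κ)) })))
        (trans (cong (λ t → K x″ y′ [] [] * t) (*-zeroʳ (fin x″ X []))) (*-zeroʳ (K x″ y′ [] [])))
  passages (suc N) K L κ x y x″ y′ κ<x₀ r@(x≤Y , x₀≤y) x₀≤x refl refl x<y = begin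
    U (suc κ) K x y
      ≡⟨ U-step K (next K L) x y (K↓-step K L r) (suc κ) j j-spec ⟩
    ∑bits (λ a b → U (j a b) (next K L a b) (bit a + x) (bit b + y))
      ≡⟨ ∑bits-cong termwise ⟩
    ∑bits (λ a b → Paths (next K L a b) (bit a + x″) (bit b + y′))
      ≡⟨ sym (Paths-step K (next K L) x″ y′
           (K↓-step K L (≤-trans (m≤m+n x″ κ) x≤Y , ≤-trans x₀≤y (m≤m+n y κ)))) ⟩
    Paths K x″ y′ ∎
    where
    open ≡-Reasoning
    j : Bool → Bool → ℕ
    j a b = suc κ ∸ tr x y a b
    j-spec : ∀ a b n → ⟦ suc κ ≤? tr x y a b + n ⟧ ≡ ⟦ j a b ≤? n ⟧
    j-spec a b n = ⟦⟧-⇔ (suc κ ≤? _) (j a b ≤? n) (m≤n+o⇒m∸n≤o (suc κ) (tr x y a b)) (m∸n≤o⇒m≤n+o (suc κ) (tr x y a b))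
      where
      m∸n≤o⇒m≤n+o : ∀ m n {o} → m ∸ n ≤ o → m ≤ n + o
      m∸n≤o⇒m≤n+o m n h = ≤-trans (m≤n+m∸n m n) (+-monoʳ-≤ n h)
    generic : ∀ a b → bit a + x < bit b + y → U (suc κ) (next K L a b) (bit a + x) (bit b + y)
                     ≡ Paths (next K L a b) (bit a + x″) (bit b + y′)
    generic a b lt with bit a + x ≤? Y
    ... | yes ax≤Y = passages N _ (K↓-local K L _) κ _ _ _ _ κ<x₀
        (ax≤Y , ≤-trans x₀≤y (m≤n+m y (bit b))) (≤-trans x₀≤x (m≤n+m x (bit a)))
        (+-shift a x″ κ) (+-shift b y κ) lt
    ... | no ax≰Y = trans (U-zero (next K L a b) (bit a + x) (bit b + y) (s≤s z≤n) (<⇒≤ (≰⇒> ax≰Y)))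
        (sym (Paths-zero (next K L a b) (bit a + x″) (bit b + y′) (<-≤-trans (<-trans (≰⇒> ax≰Y) lt) (+-monoʳ-≤ (bit b) (m≤m+n y κ)))))
    -- The step was a passage: both columns stand at `suc x`, and the threshold has dropped from
    -- `suc κ` to `κ`.
    close : y ≡ suc x → ∀ κ′ → κ′ ≡ κ → U κ′ (K↓ K L 1) (suc x) y ≡ Paths (K↓ K L 1) (suc x″) y′
    close refl zero refl = trans (U-full (K↓ K L 1) (suc x) (suc x)) (cong₂ (Paths (K↓ K L 1)) (cong suc (+-identityʳ x″)) (sym (+-identityʳ _)))
    close refl (suc κ′) refl with suc x ≤? Y
    ... | yes sx≤Y = trans
        (low N _ (K↓-local K L 1) (suc κ′) (suc x) (suc x) (s≤s z≤n) (<⇒≤ κ<x₀) (sx≤Y , x₀≤y) (m≤n⇒m≤1+n x₀≤x) ≤-refl)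
        (reflection N _ (K↓-local K L 1) (suc κ′) (suc x) (suc x) (suc x″) _ (s≤s z≤n) (sx≤Y , x₀≤y)
          (m≤n⇒m≤1+n x₀≤x) refl refl (s≤s (m≤m+n x″ (suc κ′))))
    ... | no sx≰Y = trans (U-zero (K↓ K L 1) (suc x) (suc x) (s≤s z≤n) (<⇒≤ (≰⇒> sx≰Y)))
        (sym (Paths-zero (K↓ K L 1) (suc x″) _ (<-≤-trans (≰⇒> sx≰Y) (m≤m+n _ (suc κ′)))))
    termwise : ∀ a b → U (j a b) (next K L a b) (bit a + x) (bit b + y)
                     ≡ Paths (next K L a b) (bit a + x″) (bit b + y′)
    termwise true false with ⟦⟧-dec (y ≟ suc x)
    ... | inj₁ (eq , t) rewrite t = close eq κ refl
    ... | inj₂ (ne , t) rewrite t = generic true false (≤∧≢⇒< x<y (ne ∘ sym))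
    termwise true true = generic true true (s≤s x<y)
    termwise false false = generic false false x<y
    termwise false true = generic false true (m≤n⇒m≤1+n x<y)

  low zero K L (suc k) x y 1≤k k≤x₀ r x₀≤x y≤x =
    cong (λ t → (K x y [] [] * (ends x y [] [] * t) + 0) + 0)
      (sym (⟦⟧-no (suc k ≤? y ∸ x) (λ h → <⇒≱ h (≤-trans (≤-reflexive (m≤n⇒m∸n≡0 y≤x)) z≤n))))
  low (suc N) K L k x y 1≤k k≤x₀ r@(x≤Y , x₀≤y) x₀≤x y≤x = begin
    U k K x y
      ≡⟨ U-step K (next K L) x y (K↓-step K L r) k (λ _ _ → k)
           (λ a b n → cong (λ t → ⟦ k ≤? t + n ⟧) (tr-zero x y a b (λ { refl → <-irrefl refl y≤x }))) ⟩
    ∑bits (λ a b → U k (next K L a b) (bit a + x) (bit b + y))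
      ≡⟨ ∑bits-cong termwise ⟩
    ∑bits (λ a b → T k (next K L a b) (bit a + x) (bit b + y))
      ≡⟨ sym (T-step K (next K L) x y (K↓-step K L r) k
           (subst (_< k) (sym (m≤n⇒m∸n≡0 y≤x)) 1≤k)) ⟩
    T k K x y ∎
    where
    open ≡-Reasoning
    termwise : ∀ a b → U k (next K L a b) (bit a + x) (bit b + y)
                     ≡ T k (next K L a b) (bit a + x) (bit b + y)
    termwise a b with bit a + x ≤? Y | bit b + y ≤? bit a + x
    ... | no ax≰Y | _ = trans (U-zero (next K L a b) (bit a + x) (bit b + y) 1≤k (<⇒≤ (≰⇒> ax≰Y))) (sym (T-zero (next K L a b) (bit a + x) (bit b + y) 1≤k (≰⇒> ax≰Y)))
    ... | yes ax≤Y | yes by≤ax = low N _ (K↓-local K L _) k _ _ 1≤k k≤x₀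
        (ax≤Y , ≤-trans x₀≤y (m≤n+m y (bit b))) (≤-trans x₀≤x (m≤n+m x (bit a))) by≤ax
    ... | yes ax≤Y | no by≰ax = high a b ax≤Y (≰⇒> by≰ax) k 1≤k k≤x₀
      where
      excess : ∀ a b → bit a + x < bit b + y → bit b + y ≡ suc (bit a + x)
      excess a b lt = ≤-antisym (≤-trans (+-mono-≤ (bit≤1 b) y≤x) (s≤s (m≤n+m x (bit a)))) lt
      high : ∀ a b → bit a + x ≤ Y → bit a + x < bit b + y → ∀ k → 1 ≤ k → k ≤ x₀ →
        U k (next K L a b) (bit a + x) (bit b + y) ≡ T k (next K L a b) (bit a + x) (bit b + y)
      high a b ax≤Y lt (suc κ) 1≤k k≤x₀ = trans
        (passages N _ (K↓-local K L _) κ _ _ x″ _ k≤x₀ r′ x₀≤ax (sym x″-eq) refl lt)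
        (sym (reflection N _ (K↓-local K L _) (suc κ) _ _ x″ _ (s≤s z≤n) r′ x₀≤ax
          (trans (excess a b lt) (sym (trans (+-suc x″ κ) (cong suc x″-eq))))
          (trans (cong (_+ κ) (excess a b lt)) (sym (+-suc _ κ)))
          (≤-trans (m≤m+n x″ κ) (≤-reflexive x″-eq))))
        where
        r′ : R (bit a + x) (bit b + y)
        r′ = ax≤Y , ≤-trans x₀≤y (m≤n+m y (bit b))
        x₀≤ax : x₀ ≤ bit a + x
        x₀≤ax = ≤-trans x₀≤x (m≤n+m x (bit a))
        -- `k ≤ x₀ ≤ x` makes this subtraction exact; without such room the mirrored start would
        -- have a negative coordinate.
        x″ : ℕ
        x″ = (bit a + x) ∸ κ
        x″-eq : x″ + κ ≡ bit a + x
        x″-eq = m∸n+n≡m (≤-trans (<⇒≤ k≤x₀) x₀≤ax)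

  -- Outside R both statistics ignore the step, so the two counts agree from any partition-like start.
  equidistributed : ∀ N (K : Family N) → Local N K → ∀ k x y → 1 ≤ k → k ≤ x₀ → x₀ ≤ x → y ≤ x →
    U k K x y ≡ T k K x y
  equidistributed N K L k x y 1≤k k≤x₀ x₀≤x y≤x with x ≤? Y | x₀ ≤? y
  ... | no x≰Y | _ = trans (U-zero K x y 1≤k (<⇒≤ (≰⇒> x≰Y))) (sym (T-zero K x y 1≤k (≰⇒> x≰Y)))
  ... | yes x≤Y | yes x₀≤y = low N K L k x y 1≤k k≤x₀ (x≤Y , x₀≤y) x₀≤x y≤x
  equidistributed zero K L (suc k) x y 1≤k k≤x₀ x₀≤x y≤x | yes x≤Y | no x₀≰y =
    cong (λ t → (K x y [] [] * (ends x y [] [] * t) + 0) + 0)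
      (sym (⟦⟧-no (suc k ≤? y ∸ x) (λ h → <⇒≱ h (≤-trans (≤-reflexive (m≤n⇒m∸n≡0 y≤x)) z≤n))))
  equidistributed (suc N) K L k x y 1≤k k≤x₀ x₀≤x y≤x | yes x≤Y | no x₀≰y = begin
    U k K x y
      ≡⟨ U-step K K′ x y (λ a b → proj₂ (proj₂ (proj₁ L x y a b))) k (λ _ _ → k)
           (λ a b n → cong (λ t → ⟦ k ≤? t + n ⟧) (tr-zero x y a b (λ { refl → <-irrefl refl y≤x }))) ⟩
    ∑bits (λ a b → U k (K′ a b) (bit a + x) (bit b + y))
      ≡⟨ ∑bits-cong (λ a b → equidistributed N (K′ a b) (proj₁ (proj₂ (proj₁ L x y a b))) k _ _ 1≤k k≤x₀
           (≤-trans x₀≤x (m≤n+m x (bit a)))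
           -- From `y < x₀` one letter leads at most to `x₀ ≤ x`, so the excess is still not
           -- positive.
           (≤-trans (+-monoˡ-≤ y (bit≤1 b)) (≤-trans (≰⇒> x₀≰y) (≤-trans x₀≤x (m≤n+m x (bit a)))))) ⟩
    ∑bits (λ a b → T k (K′ a b) (bit a + x) (bit b + y))
      ≡⟨ sym (T-step K K′ x y (λ a b → proj₂ (proj₂ (proj₁ L x y a b))) k
           (subst (_< k) (sym (m≤n⇒m∸n≡0 y≤x)) 1≤k)) ⟩
    T k K x y ∎
    where
    open ≡-Reasoning
    K′ : Bool → Bool → Family N
    K′ a b = proj₁ (proj₁ L x y a b)

e-shift : ∀ {N} s x y (A B : Vec Bool N) → e (s + x) (s + y) A B ≡ e x y A B
e-shift s x y []      []      = [m+n]∸[m+o]≡n∸o s y x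
e-shift s x y (a ∷ A) (b ∷ B) = cong₂ _⊔_ ([m+n]∸[m+o]≡n∸o s y x)
  (trans (cong₂ (λ u v → e u v A B) (x∙yz≈y∙xz (bit a) s x) (x∙yz≈y∙xz (bit b) s y))
         (e-shift s (bit a + x) (bit b + y) A B))

tr-shift : ∀ s x y a b → tr (s + x) (s + y) a b ≡ tr x y a b
tr-shift s x y true  false = ⟦⟧-⇔ (s + y ≟ suc (s + x)) (y ≟ suc x)
  (λ eq → +-cancelˡ-≡ s y (suc x) (trans eq (sym (+-suc s x)))) (λ { refl → +-suc s x })
tr-shift s x y true  true  = refl
tr-shift s x y false b     = refl

ℓ-shift : ∀ {N} s x y (A B : Vec Bool N) → ℓ (s + x) (s + y) A B ≡ ℓ x y A B
ℓ-shift s x y []      []      = refl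
ℓ-shift s x y (a ∷ A) (b ∷ B) = cong₂ _+_ (tr-shift s x y a b)
  (trans (cong₂ (λ u v → ℓ u v A B) (x∙yz≈y∙xz (bit a) s x) (x∙yz≈y∙xz (bit b) s y))
         (ℓ-shift s (bit a + x) (bit b + y) A B))

fin-shift : ∀ {N} s x X (A : Vec Bool N) → fin (s + x) (s + X) A ≡ fin x X A
fin-shift s x X A = ⟦⟧-⇔ (♯ A + (s + x) ≟ s + X) (♯ A + x ≟ X)
  (λ eq → +-cancelˡ-≡ s _ X (trans (x∙yz≈y∙xz s (♯ A) x) eq))
  (λ { refl → x∙yz≈y∙xz (♯ A) s x })

infixr 6 _⊞_
_⊞_ : ∀ {N} → Vec Bool N → Vec ℕ N → Vec ℕ N
A ⊞ r = zipWith (λ b m → bit b + m) A r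

-- The two neighbouring edges of a pair of columns, as seen by that pair.
context : ∀ {N} → (Vec ℕ N → ℕ → ℕ → ℕ) → Vec Bool N → ℕ → Vec Bool N → ℕ → Vec ℕ N → ℕ → ℕ → Family N
context Ψ C c D d r u v x y A B = Ψ (A ⊞ B ⊞ r) (u + ℓ c x C A) (v ⊔ e y d B D)

module _ (X Y x₀ : ℕ) (Y≤X : Y ≤ X) where
  open Edge X Y x₀ Y≤X

  -- Inside `R` the first column of the pair is at `x ≤ Y ≤ c`, so it has no positive excess over
  -- its left neighbour and causes no passage there. The second is at `y ≥ x₀`, at least the final
  -- height of its right neighbour, which thus has excess 0 over it. Hence neither `u` nor `v`
  -- changes, and the step enters only through the number of columns holding the letter. Outside `R`
  -- the changes are stored in `u` and `v`.
  context-local : ∀ N Ψ C c D d r u v → Y ≤ c → ♯ D + d ≤ x₀ → Local N (context Ψ C c D d r u v)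
  context-local zero    Ψ C c D d r u v Y≤c h = tt
  context-local (suc N) Ψ (p ∷ C) c (q ∷ D) d (m ∷ r) u v Y≤c h =
    (λ x y a b →
      context (λ rs → Ψ ((bit a + (bit b + m)) ∷ rs)) C (bit p + c) D (bit q + d) r (u + tr c x p a) (v ⊔ (d ∸ y))
      , context-local N (λ rs → Ψ ((bit a + (bit b + m)) ∷ rs)) C (bit p + c) D (bit q + d) r (u + tr c x p a) (v ⊔ (d ∸ y)) Y≤c′ h′
      , λ A B → cong₂ (Ψ ((bit a + (bit b + m)) ∷ (A ⊞ B ⊞ r)))
          (sym (+-assoc u (tr c x p a) _)) (sym (⊔-assoc v (d ∸ y) _)))
    , (λ z → context (λ rs → Ψ ((z + m) ∷ rs)) C (bit p + c) D (bit q + d) r u v)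
    , (λ z → context-local N (λ rs → Ψ ((z + m) ∷ rs)) C (bit p + c) D (bit q + d) r u v Y≤c′ h′)
    , λ { x y (x≤Y , x₀≤y) a b A B → trans
          (cong (λ t → Ψ (t ∷ (A ⊞ B ⊞ r)) (u + ℓ c x (p ∷ C) (a ∷ A)) (v ⊔ e y d (b ∷ B) (q ∷ D))) (sym (+-assoc (bit a) (bit b) m)))
          (cong₂ (Ψ (((bit a + bit b) + m) ∷ (A ⊞ B ⊞ r)))
            (cong (λ t → u + (t + ℓ (bit p + c) (bit a + x) C A))
              (tr-zero c x p a (λ { refl → <⇒≱ x≤Y Y≤c })))
            (cong (λ t → v ⊔ (t ⊔ e (bit b + y) (bit q + d) B D))
              (m≤n⇒m∸n≡0 (≤-trans (m≤n+m d (♯ (q ∷ D))) (≤-trans h x₀≤y))))) }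
    where
    Y≤c′ : Y ≤ bit p + c
    Y≤c′ = ≤-trans Y≤c (m≤n+m c (bit p))
    h′ : ♯ D + (bit q + d) ≤ x₀
    h′ = subst (_≤ x₀) (♯-step q D d) h

module _ {N} (Ψ : Vec ℕ N → ℕ → ℕ → ℕ) (C : Vec Bool N) (c : ℕ) (D : Vec Bool N) (d : ℕ) (r : Vec ℕ N)
         (X Y x y : ℕ) (Y≤X : Y ≤ X) (y≤x : y ≤ x) (Y≤c : Y ≤ c) (D≤x : ♯ D + d ≤ x) where

  -- Translating all four columns by k makes room for the reflected starting point.
  edge-≥ : ∀ k →
    ∑² N (λ A B → context Ψ C c D d r 0 0 x y A B * ((fin x X A * fin y Y B) * ⟦ k ≤? ℓ x y A B ⟧))
    ≡ ∑² N (λ A B → context Ψ C c D d r 0 0 x y A B * ((fin x X A * fin y Y B) * ⟦ k ≤? e x y A B ⟧))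
  edge-≥ zero = refl
  edge-≥ k@(suc _) = trans (sym (∑²-cong (λ A B → cong₂ _*_ (K-shift A B)
      (cong₂ _*_ (ends-shift A B) (cong (λ t → ⟦ k ≤? t ⟧) (ℓ-shift k x y A B))))))
    (trans (Edge.equidistributed (k + X) (k + Y) (k + x) (+-monoʳ-≤ k Y≤X) N
             (context Ψ C (k + c) D (k + d) r 0 0)
             (context-local (k + X) (k + Y) (k + x) (+-monoʳ-≤ k Y≤X) N Ψ C (k + c) D (k + d) r 0 0
               (+-monoʳ-≤ k Y≤c)
               (≤-trans (≤-reflexive (x∙yz≈y∙xz (♯ D) k d)) (+-monoʳ-≤ k D≤x)))
             k (k + x) (k + y) (s≤s z≤n) (m≤m+n k x) ≤-refl (+-monoʳ-≤ k y≤x))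
      (∑²-cong (λ A B → cong₂ _*_ (K-shift A B)
        (cong₂ _*_ (ends-shift A B) (cong (λ t → ⟦ k ≤? t ⟧) (e-shift k x y A B))))))
    where
    K-shift : ∀ A B → context Ψ C (k + c) D (k + d) r 0 0 (k + x) (k + y) A B
                    ≡ context Ψ C c D d r 0 0 x y A B
    K-shift A B = cong₂ (Ψ (A ⊞ B ⊞ r)) (ℓ-shift k c x C A) (e-shift k y d B D)
    ends-shift : ∀ A B → fin (k + x) (k + X) A * fin (k + y) (k + Y) B ≡ fin x X A * fin y Y B
    ends-shift A B = cong₂ _*_ (fin-shift k x X A) (fin-shift k y Y B)

⟦≤⟧-split : ∀ k n → ⟦ k ≤? n ⟧ ≡ ⟦ k ≟ n ⟧ + ⟦ suc k ≤? n ⟧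
⟦≤⟧-split k n with <-cmp k n
... | tri< lt ne _ = trans (⟦⟧-yes (k ≤? n) (<⇒≤ lt)) (sym (cong₂ _+_ (⟦⟧-no (k ≟ n) ne) (⟦⟧-yes (suc k ≤? n) lt)))
... | tri≈ nlt eq _ = trans (⟦⟧-yes (k ≤? n) (≤-reflexive eq)) (sym (cong₂ _+_ (⟦⟧-yes (k ≟ n) eq) (⟦⟧-no (suc k ≤? n) nlt)))
... | tri> nlt ne gt = trans (⟦⟧-no (k ≤? n) (<⇒≱ gt)) (sym (cong₂ _+_ (⟦⟧-no (k ≟ n) ne) (⟦⟧-no (suc k ≤? n) nlt)))

-- The weight depends on the statistic itself, through `l`. With `l` frozen, the threshold
-- identities at `l` and at `suc l` yield by cancellation the total weight of the terms whose
-- statistic is exactly `l`; the levels are then added up.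
∑-by-levels : (xs : List A) (u v : A → ℕ) (M : ℕ) (W : ℕ → A → ℕ) → (∀ x → u x ≤ M) → (∀ x → v x ≤ M) →
  (∀ l k → ∑[ x ∈ xs ] W l x * ⟦ k ≤? u x ⟧ ≡ ∑[ x ∈ xs ] W l x * ⟦ k ≤? v x ⟧) →
  ∑[ x ∈ xs ] W (u x) x ≡ ∑[ x ∈ xs ] W (v x) x
∑-by-levels {A} xs u v M W u≤M v≤M h = begin
  ∑[ x ∈ xs ] W (u x) x          ≡⟨ expand u u≤M ⟩
  ∑[ l ∈ upTo (suc M) ] exactly u l ≡⟨ ∑-cong (upTo (suc M)) same ⟩
  ∑[ l ∈ upTo (suc M) ] exactly v l ≡⟨ sym (expand v v≤M) ⟩
  ∑[ x ∈ xs ] W (v x) x ∎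
  where
  open ≡-Reasoning
  exactly : (A → ℕ) → ℕ → ℕ
  exactly w l = ∑[ x ∈ xs ] W l x * ⟦ l ≟ w x ⟧
  above : (A → ℕ) → ℕ → ℕ
  above w l = ∑[ x ∈ xs ] W l x * ⟦ suc l ≤? w x ⟧
  expand : (w : A → ℕ) → (∀ x → w x ≤ M) → ∑[ x ∈ xs ] W (w x) x ≡ ∑[ l ∈ upTo (suc M) ] exactly w l
  expand w w≤M = trans
    (∑-cong xs (λ x → sym (trans
      (∑-δ {xs = upTo (suc M)} (λ l → W l x * ⟦ l ≟ w x ⟧) (Uniqueₚ.upTo⁺ (suc M)) (∈-upTo⁺ (s≤s (w≤M x)))
        (λ {l} _ ne → trans (cong (W l x *_) (⟦⟧-no (l ≟ w x) ne)) (*-zeroʳ (W l x))))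
      (trans (cong (W (w x) x *_) (⟦⟧-yes (w x ≟ w x) refl)) (*-identityʳ _)))))
    (∑-swap xs (upTo (suc M)) (λ x l → W l x * ⟦ l ≟ w x ⟧))
  split : (w : A → ℕ) → ∀ l → ∑[ x ∈ xs ] W l x * ⟦ l ≤? w x ⟧ ≡ exactly w l + above w l
  split w l = trans
    (∑-cong xs (λ x → trans (cong (W l x *_) (⟦≤⟧-split l (w x))) (*-distribˡ-+ (W l x) _ _)))
    (∑-+ xs (λ x → W l x * ⟦ l ≟ w x ⟧) (λ x → W l x * ⟦ suc l ≤? w x ⟧))
  same : ∀ l → exactly u l ≡ exactly v l
  same l = +-cancelʳ-≡ (above u l) _ _ (begin
    exactly u l + above u l          ≡⟨ sym (split u l) ⟩
    ∑[ x ∈ xs ] W l x * ⟦ l ≤? u x ⟧ ≡⟨ h l l ⟩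
    ∑[ x ∈ xs ] W l x * ⟦ l ≤? v x ⟧ ≡⟨ split v l ⟩
    exactly v l + above v l          ≡⟨ cong (λ t → exactly v l + t) (sym (h l (suc l))) ⟩
    exactly v l + above u l ∎)

-- Sums over all tuples of columns

stat : ∀ {N n} → Family N → Vec ℕ n → Vec (Vec Bool N) n → ℕ
stat f []           cs           = 0
stat f (x ∷ [])     cs           = 0
stat f (x ∷ y ∷ ds) (A ∷ B ∷ cs) = f x y A B + stat f (y ∷ ds) (B ∷ cs)

endpoints : ∀ {N n} → Vec ℕ n → Vec ℕ n → Vec (Vec Bool N) n → ℕ
endpoints []       []       []       = 1
endpoints (x ∷ xs) (X ∷ Xs) (A ∷ cs) = fin x X A * endpoints xs Xs cs

rows : ∀ {N n} → Vec (Vec Bool N) n → Vec ℕ N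
rows []       = Vec.replicate _ 0
rows (A ∷ cs) = A ⊞ rows cs

first second : ∀ {n} → Vec ℕ n → ℕ
first  []      = 0
first  (x ∷ _) = x
second []      = 0
second (_ ∷ v) = first v

Descending : ∀ {n} → Vec ℕ n → Set
Descending []       = ⊤
Descending (x ∷ xs) = first xs ≤ x × Descending xs

-- es (j + 2) ≤ ds j: this is what keeps adjacent edges from interacting.
Gap : ∀ {n} → Vec ℕ n → Vec ℕ n → Set
Gap []       []       = ⊤
Gap (x ∷ xs) (X ∷ Xs) = second Xs ≤ x × Gap xs Xs

-- After the last column stands an empty one at height 0, so that every pair has a right neighbour;
-- it contributes no excess.
firstColumn : ∀ {N n} → Vec (Vec Bool N) n → Vec Bool N
firstColumn []       = Vec.replicate _ false
firstColumn (A ∷ cs) = A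

e-empty : ∀ {N} y (B : Vec Bool N) → e y 0 B (Vec.replicate _ false) ≡ 0
e-empty y []      = 0∸n≡0 y
e-empty y (b ∷ B) = cong₂ _⊔_ (0∸n≡0 y) (e-empty (bit b + y) B)

stat-e-∷ : ∀ {N n} y (ds : Vec ℕ n) (B : Vec Bool N) cs →
  stat e (y ∷ ds) (B ∷ cs) ≡ e y (first ds) B (firstColumn cs) + stat e ds cs
stat-e-∷ y []       B []       = sym (cong (_+ 0) (e-empty y B))
stat-e-∷ y (d ∷ ds) B (D ∷ cs) = refl

endpoints-first : ∀ {N n} (ds es : Vec ℕ n) (cs : Vec (Vec Bool N) n) → endpoints ds es cs ≢ 0 →
  ♯ (firstColumn cs) + first ds ≡ first es
endpoints-first {N} []       []       []       _ = trans (+-identityʳ _) (♯-replicate N)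
  where
  ♯-replicate : ∀ N → ♯ (Vec.replicate N false) ≡ 0
  ♯-replicate zero    = refl
  ♯-replicate (suc N) = ♯-replicate N
endpoints-first (x ∷ ds) (X ∷ es) (A ∷ cs) h = ⟦⟧-≢0 (♯ A + x ≟ X) (*-≢0ˡ (fin x X A) h)

module _ {N n} (Ψ : Vec ℕ N → ℕ → ℕ) (C : Vec Bool N) (c X Y x y : ℕ) (ds es : Vec ℕ n)
         (Y≤X : Y ≤ X) (y≤x : y ≤ x) (Y≤c : Y ≤ c) (gap : first es ≤ x) where

  private
    term : (Vec Bool N → Vec Bool N → ℕ) → Vec (Vec Bool N) n → Vec Bool N → Vec Bool N → ℕ
    term s cs A B = endpoints (x ∷ y ∷ ds) (X ∷ Y ∷ es) (A ∷ B ∷ cs) *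
      Ψ (A ⊞ B ⊞ rows cs) (ℓ c x C A + (s A B + stat e (y ∷ ds) (B ∷ cs)))

  -- The columns `cs` to the right are fixed. If they miss their endpoints, both sides vanish;
  -- otherwise the right neighbour of the pair ends at `first es ≤ x`, as `edge-≥` demands. The
  -- statistic of the pair enters `Ψ` added to the others, which is why the levels have to be
  -- separated.
  edge : ∀ cs → ∑² N (term (e x y) cs) ≡ ∑² N (term (ℓ x y) cs)
  edge cs with endpoints ds es cs ≟ 0
  ... | yes E≡0 = trans (∑²-zero {N} (null (e x y))) (sym (∑²-zero {N} (null (ℓ x y))))
    where
    null : ∀ (s : Vec Bool N → Vec Bool N → ℕ) A B → term s cs A B ≡ 0
    null s A B rewrite E≡0 | *-zeroʳ (fin y Y B) | *-zeroʳ (fin x X A) = refl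
  ... | no E≢0 = trans (unfold (e x y))
    (trans (∑-by-levels pairs (λ { (A , B) → e x y A B }) (λ { (A , B) → ℓ x y A B }) N W
             (λ { (A , B) → e-≤-length x y A B y≤x }) (λ { (A , B) → ℓ-≤-length x y A B }) levels)
           (sym (unfold (ℓ x y))))
    where
    D : Vec Bool N
    D = firstColumn cs
    d : ℕ
    d = first ds
    -- `l` stands for the statistic of the pair itself, `u` and `v` for those of the edges to its
    -- left and right.
    Φ : ℕ → Vec ℕ N → ℕ → ℕ → ℕ
    Φ l rs u v = endpoints ds es cs * Ψ rs (u + (l + (v + stat e ds cs)))
    K : ℕ → Vec Bool N → Vec Bool N → ℕ
    K l = context (Φ l) C c D d (rows cs) 0 0 x y
    pairs : List (Vec Bool N × Vec Bool N)
    pairs = cartesianProduct (bools N) (bools N)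
    W : ℕ → Vec Bool N × Vec Bool N → ℕ
    W l (A , B) = K l A B * (fin x X A * fin y Y B)
    ∑-pairs : (f : Vec Bool N × Vec Bool N → ℕ) → ∑ pairs f ≡ ∑² N (λ A B → f (A , B))
    ∑-pairs f = ∑-cartesianProductWith _,_ (bools N) (bools N) f
    rearrange : ∀ f g E p → (f * (g * E)) * p ≡ (E * p) * (f * g)
    rearrange f g E p = begin
      (f * (g * E)) * p ≡⟨ cong (_* p) (sym (*-assoc f g E)) ⟩
      ((f * g) * E) * p ≡⟨ *-assoc (f * g) E p ⟩
      (f * g) * (E * p) ≡⟨ *-comm (f * g) (E * p) ⟩
      (E * p) * (f * g) ∎
      where open ≡-Reasoning
    unfold : (s : Vec Bool N → Vec Bool N → ℕ) → ∑² N (term s cs) ≡ ∑ pairs (λ p → W (s (proj₁ p) (proj₂ p)) p)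
    unfold s = sym (trans (∑-pairs (λ p → W (s (proj₁ p) (proj₂ p)) p)) (∑²-cong (λ A B → sym (trans
      (cong (λ t → endpoints (x ∷ y ∷ ds) (X ∷ Y ∷ es) (A ∷ B ∷ cs) * Ψ (A ⊞ B ⊞ rows cs) (ℓ c x C A + (s A B + t)))
        (stat-e-∷ y ds B cs))
      (rearrange (fin x X A) (fin y Y B) (endpoints ds es cs) _)))))
    levels : ∀ l k → ∑[ p ∈ pairs ] W l p * ⟦ k ≤? e x y (proj₁ p) (proj₂ p) ⟧
                   ≡ ∑[ p ∈ pairs ] W l p * ⟦ k ≤? ℓ x y (proj₁ p) (proj₂ p) ⟧
    levels l k = trans (∑-pairs (λ p → W l p * ⟦ k ≤? e x y (proj₁ p) (proj₂ p) ⟧)) (trans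
      (trans (∑²-cong (λ A B → *-assoc (K l A B) _ _))
        (trans (sym (edge-≥ (Φ l) C c D d (rows cs) X Y x y Y≤X y≤x Y≤c
                      (subst (_≤ x) (sym (endpoints-first ds es cs E≢0)) gap) k))
               (∑²-cong (λ A B → sym (*-assoc (K l A B) _ _)))))
      (sym (∑-pairs (λ p → W l p * ⟦ k ≤? ℓ x y (proj₁ p) (proj₂ p) ⟧))))

-- The edge joining the list to the column `C` before it. It is already switched to `ℓ`, but still
-- depends on the first column of the list.
leftEdge : ∀ {N n} → Vec Bool N → ℕ → Vec ℕ n → Vec (Vec Bool N) n → ℕ
leftEdge C c []       []       = 0
leftEdge C c (x ∷ ds) (A ∷ cs) = ℓ c x C A

∑-columns₂ : ∀ {N n} (F : Vec (Vec Bool N) (suc (suc n)) → ℕ) →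
  ∑ (vecs (bools N) (suc (suc n))) F ≡ ∑[ cs ∈ vecs (bools N) n ] ∑² N (λ A B → F (A ∷ B ∷ cs))
∑-columns₂ {N} {n} F = begin
  ∑ (vecs (bools N) (suc (suc n))) F
    ≡⟨ ∑-vecs-suc (bools N) (suc n) F ⟩
  ∑[ A ∈ bools N ] ∑[ cs ∈ vecs (bools N) (suc n) ] F (A ∷ cs)
    ≡⟨ ∑-cong (bools N) (λ A → ∑-vecs-suc (bools N) n (λ cs → F (A ∷ cs))) ⟩
  ∑[ A ∈ bools N ] ∑[ B ∈ bools N ] ∑[ cs ∈ vecs (bools N) n ] F (A ∷ B ∷ cs)
    ≡⟨ ∑-cong (bools N) (λ A → ∑-swap (bools N) (vecs (bools N) n) (λ B cs → F (A ∷ B ∷ cs))) ⟩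
  ∑[ A ∈ bools N ] ∑[ cs ∈ vecs (bools N) n ] ∑[ B ∈ bools N ] F (A ∷ B ∷ cs)
    ≡⟨ ∑-swap (bools N) (vecs (bools N) n) (λ A cs → ∑[ B ∈ bools N ] F (A ∷ B ∷ cs)) ⟩
  ∑[ cs ∈ vecs (bools N) n ] ∑² N (λ A B → F (A ∷ B ∷ cs)) ∎
  where open ≡-Reasoning

-- The edges are switched from e to ℓ one at a time, from left to right.
edges : ∀ {N} n (ds es : Vec ℕ n) → Descending ds → Descending es → Gap ds es →
  (C : Vec Bool N) (c : ℕ) → second es ≤ c → (Ψ : Vec ℕ N → ℕ → ℕ) →
  ∑[ cs ∈ vecs (bools N) n ] endpoints ds es cs * Ψ (rows cs) (leftEdge C c ds cs + stat e ds cs)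
  ≡ ∑[ cs ∈ vecs (bools N) n ] endpoints ds es cs * Ψ (rows cs) (leftEdge C c ds cs + stat ℓ ds cs)
edges zero    []       []       _ _ _ C c _ Ψ = refl
edges (suc zero) (x ∷ []) (X ∷ []) _ _ _ C c _ Ψ = refl
edges {N} (suc (suc n)) (x ∷ y ∷ ds) (X ∷ Y ∷ es) (y≤x , desc) (Y≤X , desc′) (g , gap) C c Y≤c Ψ = begin
  ∑[ cs ∈ vecs (bools N) (2 + n) ] F cs
    ≡⟨ ∑-columns₂ F ⟩
  ∑[ cs ∈ vecs (bools N) n ] ∑² N (λ A B → F (A ∷ B ∷ cs))
    ≡⟨ ∑-cong (vecs (bools N) n) (edge Ψ C c X Y x y ds es Y≤X y≤x Y≤c g) ⟩
  ∑[ cs ∈ vecs (bools N) n ] ∑² N (λ A B → G (A ∷ B ∷ cs))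
    ≡⟨ sym (∑-columns₂ G) ⟩
  ∑[ cs ∈ vecs (bools N) (2 + n) ] G cs
    ≡⟨ ∑-vecs-suc (bools N) (suc n) G ⟩
  ∑[ A ∈ bools N ] ∑[ cs ∈ vecs (bools N) (suc n) ] G (A ∷ cs)
    -- `A` becomes the left neighbour at height `x`; its endpoint factor, its letters and the edge
    -- to its left are absorbed into the new `Ψ`.
    ≡⟨ ∑-cong (bools N) (λ A → trans (∑-cong (vecs (bools N) (suc n)) (regroup e A))
         (trans (edges (suc n) (y ∷ ds) (Y ∷ es) desc desc′ gap A x g
                  (λ rs s → fin x X A * Ψ (A ⊞ rs) (ℓ c x C A + s)))
                (sym (∑-cong (vecs (bools N) (suc n)) (λ { (B ∷ cs) → regroup ℓ A (B ∷ cs) }))))) ⟩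
  ∑[ A ∈ bools N ] ∑[ cs ∈ vecs (bools N) (suc n) ] H (A ∷ cs)
    ≡⟨ sym (∑-vecs-suc (bools N) (suc n) H) ⟩
  ∑[ cs ∈ vecs (bools N) (2 + n) ] H cs ∎
  where
  open ≡-Reasoning
  mixed : Family N → Family N → Vec (Vec Bool N) (2 + n) → ℕ
  mixed f g (A ∷ B ∷ cs) = endpoints (x ∷ y ∷ ds) (X ∷ Y ∷ es) (A ∷ B ∷ cs) *
    Ψ (rows (A ∷ B ∷ cs)) (ℓ c x C A + (f x y A B + stat g (y ∷ ds) (B ∷ cs)))
  F G H : Vec (Vec Bool N) (2 + n) → ℕ
  F cs = endpoints (x ∷ y ∷ ds) (X ∷ Y ∷ es) cs *
    Ψ (rows cs) (leftEdge C c (x ∷ y ∷ ds) cs + stat e (x ∷ y ∷ ds) cs)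
  G = mixed ℓ e
  H cs = endpoints (x ∷ y ∷ ds) (X ∷ Y ∷ es) cs *
    Ψ (rows cs) (leftEdge C c (x ∷ y ∷ ds) cs + stat ℓ (x ∷ y ∷ ds) cs)
  regroup : ∀ (f : Family N) A cs → mixed ℓ f (A ∷ cs) ≡
    endpoints (y ∷ ds) (Y ∷ es) cs *
      (fin x X A * Ψ (A ⊞ rows cs) (ℓ c x C A + (leftEdge A x (y ∷ ds) cs + stat f (y ∷ ds) cs)))
  regroup f A (B ∷ cs) = trans
    (cong (λ t → t * Ψ (rows (A ∷ B ∷ cs)) (ℓ c x C A + (ℓ x y A B + stat f (y ∷ ds) (B ∷ cs))))
      (*-comm (fin x X A) (endpoints (y ∷ ds) (Y ∷ es) (B ∷ cs))))
    (*-assoc (endpoints (y ∷ ds) (Y ∷ es) (B ∷ cs)) (fin x X A) _)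

-- Exchanging consecutive letters

trs : Vec ℕ n → Vec Bool n → ℕ
trs []           X           = 0
trs (x ∷ [])     X           = 0
trs (x ∷ y ∷ ds) (a ∷ b ∷ X) = tr x y a b + trs (y ∷ ds) (b ∷ X)

-- The same sum organised by letters: `α` prescribes how many columns hold each letter, `ds` are the
-- current heights, and `φ` has absorbed the passages made so far.
walks : Vec ℕ n → List ℕ → Vec ℕ n → (ℕ → ℕ) → ℕ
walks {n} es []      ds φ = endpoints ds es (Vec.replicate n []) * φ 0
walks {n} es (k ∷ α) ds φ = ∑[ X ∈ bools n ] ⟦ ♯ X ≟ k ⟧ * walks es α (X ⊞ ds) (λ s → φ (trs ds X + s))

walks-cong : ∀ (es : Vec ℕ n) α ds {φ ψ : ℕ → ℕ} → (∀ s → φ s ≡ ψ s) → walks es α ds φ ≡ walks es α ds ψ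
walks-cong {n} es []      ds h = cong (endpoints ds es (Vec.replicate n []) *_) (h 0)
walks-cong {n} es (k ∷ α) ds h =
  ∑-cong (bools n) (λ X → cong (⟦ ♯ X ≟ k ⟧ *_) (walks-cong es α (X ⊞ ds) (λ s → h (trs ds X + s))))

rows-peel : ∀ {N n} (X : Vec Bool n) (cs : Vec (Vec Bool N) n) → rows (zipWith _∷_ X cs) ≡ ♯ X ∷ rows cs
rows-peel []      []       = refl
rows-peel (b ∷ X) (c ∷ cs) = cong (λ t → (b ∷ c) ⊞ t) (rows-peel X cs)

endpoints-peel : ∀ {N n} (ds es : Vec ℕ n) (X : Vec Bool n) (cs : Vec (Vec Bool N) n) →
  endpoints ds es (zipWith _∷_ X cs) ≡ endpoints (X ⊞ ds) es cs
endpoints-peel []       []       []      []       = refl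
endpoints-peel (d ∷ ds) (e ∷ es) (b ∷ X) (c ∷ cs) = cong₂ _*_ (fin-step d e b c) (endpoints-peel ds es X cs)

stat-peel : ∀ {N n} (ds : Vec ℕ n) (X : Vec Bool n) (cs : Vec (Vec Bool N) n) →
  stat ℓ ds (zipWith _∷_ X cs) ≡ trs ds X + stat ℓ (X ⊞ ds) cs
stat-peel []           []          []           = refl
stat-peel (x ∷ [])     (a ∷ [])    (A ∷ [])     = refl
stat-peel (x ∷ y ∷ ds) (a ∷ b ∷ X) (A ∷ B ∷ cs) =
  trans (cong (λ t → (tr x y a b + ℓ (bit a + x) (bit b + y) A B) + t) (stat-peel (y ∷ ds) (b ∷ X) (B ∷ cs)))
        (interchange (tr x y a b) _ (trs (y ∷ ds) (b ∷ X)) _)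

∑-vecs-[] : ∀ n (F : Vec (Vec Bool 0) n → ℕ) → ∑ (vecs (bools 0) n) F ≡ F (Vec.replicate n [])
∑-vecs-[] zero    F = +-identityʳ _
∑-vecs-[] (suc n) F = trans (∑-vecs-suc (bools 0) n F) (trans (+-identityʳ _) (∑-vecs-[] n (λ cs → F ([] ∷ cs))))

stat-[] : (ds : Vec ℕ n) → stat ℓ ds (Vec.replicate n []) ≡ 0
stat-[] []           = refl
stat-[] (x ∷ [])     = refl
stat-[] (x ∷ y ∷ ds) = stat-[] (y ∷ ds)

_≟ᵛ_ : (v w : Vec ℕ n) → Dec (v ≡ w)
_≟ᵛ_ = Vecₚ.≡-dec _≟_

∑-walks : ∀ N (es ds : Vec ℕ n) (α : Vec ℕ N) (φ : ℕ → ℕ) →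
  ∑[ cs ∈ vecs (bools N) n ] endpoints ds es cs * (⟦ rows cs ≟ᵛ α ⟧ * φ (stat ℓ ds cs))
  ≡ walks es (Vec.toList α) ds φ
∑-walks {n} zero es ds [] φ = trans
  (∑-vecs-[] n (λ cs → endpoints ds es cs * (⟦ rows cs ≟ᵛ [] ⟧ * φ (stat ℓ ds cs))))
  (cong (endpoints ds es (Vec.replicate n []) *_)
    (trans (cong₂ _*_ (⟦⟧-yes (rows (Vec.replicate n []) ≟ᵛ []) (only _)) (cong φ (stat-[] ds))) (+-identityʳ _)))
  where
  only : (v : Vec ℕ 0) → v ≡ []
  only [] = refl
∑-walks {n} (suc N) es ds (k ∷ α) φ = begin
  ∑[ cs ∈ vecs (bools (suc N)) n ] F cs
    ≡⟨ ∑-peel-row n N F ⟩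
  ∑[ X ∈ bools n ] ∑[ cs ∈ vecs (bools N) n ] F (zipWith _∷_ X cs)
    ≡⟨ ∑-cong (bools n) (λ X → ∑-cong (vecs (bools N) n) (λ cs → term X cs)) ⟩
  ∑[ X ∈ bools n ] ∑[ cs ∈ vecs (bools N) n ] ⟦ ♯ X ≟ k ⟧ * G X cs
    ≡⟨ ∑-cong (bools n) (λ X → trans (∑-*ˡ (vecs (bools N) n) ⟦ ♯ X ≟ k ⟧ (G X))
         (cong (⟦ ♯ X ≟ k ⟧ *_) (∑-walks N es (X ⊞ ds) α (λ s → φ (trs ds X + s))))) ⟩
  walks es (k ∷ Vec.toList α) ds φ ∎
  where
  open ≡-Reasoning
  F : Vec (Vec Bool (suc N)) n → ℕ
  F cs = endpoints ds es cs * (⟦ rows cs ≟ᵛ (k ∷ α) ⟧ * φ (stat ℓ ds cs))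
  G : Vec Bool n → Vec (Vec Bool N) n → ℕ
  G X cs = endpoints (X ⊞ ds) es cs * (⟦ rows cs ≟ᵛ α ⟧ * φ (trs ds X + stat ℓ (X ⊞ ds) cs))
  rearrange : ∀ a b c d → a * ((b * c) * d) ≡ b * (a * (c * d))
  rearrange a b c d = trans (cong (a *_) (*-assoc b c d))
    (trans (sym (*-assoc a b (c * d))) (trans (cong (_* (c * d)) (*-comm a b)) (*-assoc b a (c * d))))
  term : ∀ X cs → F (zipWith _∷_ X cs) ≡ ⟦ ♯ X ≟ k ⟧ * G X cs
  term X cs rewrite endpoints-peel ds es X cs | rows-peel X cs | stat-peel ds X cs = trans
    (cong (λ t → endpoints (X ⊞ ds) es cs * (t * φ (trs ds X + stat ℓ (X ⊞ ds) cs)))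
      (trans (⟦⟧-⇔ ((♯ X ∷ rows cs) ≟ᵛ (k ∷ α)) ((♯ X ≟ k) ×-dec (rows cs ≟ᵛ α))
               (λ { refl → refl , refl }) (λ { (refl , refl) → refl }))
             (⟦⟧-× (♯ X ≟ k) (rows cs ≟ᵛ α))))
    (rearrange (endpoints (X ⊞ ds) es cs) ⟦ ♯ X ≟ k ⟧ ⟦ rows cs ≟ᵛ α ⟧ _)

-- A column together with its entries in two consecutive letters.
Bits : Set
Bits = Bool × Bool

tot : Bits → ℕ
tot (a , b) = bit b + bit a

Mixed : Bits → Bits → Set
Mixed p q = (p ≡ (true , false) × q ≡ (false , true)) ⊎ (p ≡ (false , true) × q ≡ (true , false))

-- When each column takes one of the two letters, the excess returns to its old value: from 1
-- through 0 or 2, from 0 through -1 or 1. In both cases exactly one of the two orders makes a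
-- passage from 1 to 0. From any other excess neither order does.
Keep : ℕ → ℕ → Bits → Bits → Set
Keep x y p q = (x ≤ y × y ≤ suc x) × Mixed p q

_≟ᵇ_ : (p q : Bits) → Dec (p ≡ q)
_≟ᵇ_ = Productₚ.≡-dec Boolₚ._≟_ Boolₚ._≟_

keep? : ∀ x y p q → Dec (Keep x y p q)
keep? x y p q = ((x ≤? y) ×-dec (y ≤? suc x)) ×-dec
  (((p ≟ᵇ _) ×-dec (q ≟ᵇ _)) ⊎-dec ((p ≟ᵇ _) ×-dec (q ≟ᵇ _)))

decide : Dec P → A → A → A
decide (yes _) a b = a
decide (no _)  a b = b

-- Swaps two consecutive letters in every column, except in adjacent columns that hold one of
-- them each and whose excess is 0 or 1: there the order of the letters decides about a passage.
exchange : Vec ℕ n → Vec Bits n → Vec Bits n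
exchange []           []           = []
exchange (x ∷ [])     (p ∷ [])     = swap p ∷ []
exchange (x ∷ y ∷ ds) (p ∷ q ∷ ps) =
  decide (keep? x y p q) (p ∷ q ∷ exchange ds ps) (swap p ∷ exchange (y ∷ ds) (q ∷ ps))

exchange-yes : ∀ {x y p q} (ds : Vec ℕ n) ps → Keep x y p q →
  exchange (x ∷ y ∷ ds) (p ∷ q ∷ ps) ≡ p ∷ q ∷ exchange ds ps
exchange-yes {x = x} {y} {p} {q} ds ps k with keep? x y p q
... | yes _ = refl
... | no ¬k = contradiction k ¬k

exchange-no : ∀ {x y p} (ds : Vec ℕ n) (v : Vec Bits (suc n)) → ¬ Keep x y p (Vec.head v) →
  exchange (x ∷ y ∷ ds) (p ∷ v) ≡ swap p ∷ exchange (y ∷ ds) v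
exchange-no {x = x} {y} {p} ds (q ∷ ps) ¬k with keep? x y p q
... | yes k = contradiction k ¬k
... | no _  = refl

add : Vec Bits n → Vec ℕ n → Vec ℕ n
add = zipWith (λ p d → tot p + d)

♯₁ ♯₂ : Vec Bits n → ℕ
♯₁ ps = ♯ (Vec.map proj₁ ps)
♯₂ ps = ♯ (Vec.map proj₂ ps)

tot-swap : ∀ p → tot (swap p) ≡ tot p
tot-swap (a , b) = +-comm (bit a) (bit b)

mixed-tot : ∀ {p q} → Mixed p q → tot q ≡ 1
mixed-tot (inj₁ (refl , refl)) = refl
mixed-tot (inj₂ (refl , refl)) = refl

mixed-bits : ∀ {p q} → Mixed p q → ∀ {m m′} → m ≡ m′ →
  (bit (proj₁ p) + (bit (proj₁ q) + m) ≡ bit (proj₂ p) + (bit (proj₂ q) + m′))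
mixed-bits (inj₁ (refl , refl)) = cong suc
mixed-bits (inj₂ (refl , refl)) = cong suc

-- A kept pair holds each of the two letters once, so its contribution is already symmetric.
exchange-♯₁ : (ds : Vec ℕ n) (ps : Vec Bits n) → ♯₁ (exchange ds ps) ≡ ♯₂ ps
exchange-♯₁ []           []           = refl
exchange-♯₁ (x ∷ [])     (p ∷ [])     = refl
exchange-♯₁ (x ∷ y ∷ ds) (p ∷ q ∷ ps) with keep? x y p q | exchange-♯₁ ds ps | exchange-♯₁ (y ∷ ds) (q ∷ ps)
... | yes (_ , m) | ih | _ = mixed-bits m ih
... | no _ | _ | ih = cong (λ t → bit (proj₂ p) + t) ih

exchange-♯₂ : (ds : Vec ℕ n) (ps : Vec Bits n) → ♯₂ (exchange ds ps) ≡ ♯₁ ps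
exchange-♯₂ []           []           = refl
exchange-♯₂ (x ∷ [])     (p ∷ [])     = refl
exchange-♯₂ (x ∷ y ∷ ds) (p ∷ q ∷ ps) with keep? x y p q | exchange-♯₂ ds ps | exchange-♯₂ (y ∷ ds) (q ∷ ps)
... | yes (_ , m) | ih | _ = sym (mixed-bits m (sym ih))
... | no _ | _ | ih = cong (λ t → bit (proj₁ p) + t) ih

exchange-add : (ds : Vec ℕ n) (ps : Vec Bits n) → add (exchange ds ps) ds ≡ add ps ds
exchange-add []           []           = refl
exchange-add (x ∷ [])     (p ∷ [])     = cong (λ t → (t + x) ∷ []) (tot-swap p)
exchange-add (x ∷ y ∷ ds) (p ∷ q ∷ ps) with keep? x y p q | exchange-add ds ps | exchange-add (y ∷ ds) (q ∷ ps)
... | yes _ | ih | _ = cong (λ t → (tot p + x) ∷ (tot q + y) ∷ t) ih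
... | no _ | _ | ih = cong₂ (λ t u → (t + x) ∷ u) (tot-swap p) ih

-- The second column escapes the swap only in a kept pair with the third. Then `y ≤ z`, and the
-- third column takes one of the two letters, so that `z + 1 ≤ x` by the gap. Hence `y < x`: the
-- first and second columns have negative excess, where they neither form a kept pair nor make a
-- passage.
exchange-head : ∀ {x y} (ds : Vec ℕ n) q ps → first (add ps ds) ≤ x →
  Vec.head (exchange (y ∷ ds) (q ∷ ps)) ≡ swap q ⊎ (Vec.head (exchange (y ∷ ds) (q ∷ ps)) ≡ q × y < x)
exchange-head             []       q []       h = inj₁ refl
exchange-head {x = x} {y} (z ∷ ds) q (r ∷ ps) h with keep? y z q r
... | no _ = inj₁ refl
... | yes ((y≤z , _) , m) =
  inj₂ (refl , ≤-trans (s≤s y≤z) (subst (λ t → t + z ≤ x) (mixed-tot m) h))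

exchange-involutive : (ds : Vec ℕ n) (ps : Vec Bits n) → Gap ds (add ps ds) →
  exchange ds (exchange ds ps) ≡ ps
exchange-involutive []           []           _ = refl
exchange-involutive (x ∷ [])     (p ∷ [])     _ = refl
exchange-involutive (x ∷ y ∷ ds) (p ∷ q ∷ ps) (g , gap)
  with keep? x y p q | exchange-involutive ds ps (proj₂ gap) | exchange-involutive (y ∷ ds) (q ∷ ps) gap
... | yes k | ih | _ = trans (exchange-yes ds (exchange ds ps) k) (cong (λ t → p ∷ q ∷ t) ih)
... | no ¬k | _ | ih = trans (exchange-no ds (exchange (y ∷ ds) (q ∷ ps)) ¬k′)
    (cong (λ t → p ∷ t) ih)
  where
  -- The exchange must not create a kept pair at the front: either both of its columns were swapped,
  -- or `y < x`.
  ¬k′ : ¬ Keep x y (swap p) (Vec.head (exchange (y ∷ ds) (q ∷ ps)))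
  ¬k′ k with exchange-head {x = x} {y} ds q ps g
  ... | inj₂ (_ , y<x) = <⇒≱ y<x (proj₁ (proj₁ k))
  ... | inj₁ eq rewrite eq = ¬k (proj₁ k , mixed-swap (proj₂ k))
    where
    mixed-swap : ∀ {p q} → Mixed (swap p) (swap q) → Mixed p q
    mixed-swap (inj₁ (refl , refl)) = inj₂ (refl , refl)
    mixed-swap (inj₂ (refl , refl)) = inj₁ (refl , refl)

tr² : ℕ → ℕ → Bits → Bits → ℕ
tr² x y (a , a′) (b , b′) = tr x y a b + tr (bit a + x) (bit b + y) a′ b′

trs² : Vec ℕ n → Vec Bits n → ℕ
trs² []           ps           = 0
trs² (x ∷ [])     ps           = 0
trs² (x ∷ y ∷ ds) (p ∷ q ∷ ps) = tr² x y p q + trs² (y ∷ ds) (q ∷ ps)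

-- A passage starts from excess 1, but the excess is at most -1 before the first letter and at most
-- 0 before the second.
tr²-zero : ∀ x y p q → y < x → tr² x y p q ≡ 0
tr²-zero x y (a , a′) (b , b′) y<x = cong₂ _+_
  (tr-zero x y a b (λ { refl → <-asym y<x ≤-refl }))
  (tr-zero (bit a + x) (bit b + y) a′ b′
    (λ eq → <⇒≱ (≤-trans (s≤s (m≤n+m x (bit a))) (≤-reflexive (sym eq))) (≤-trans (+-monoˡ-≤ y (bit≤1 b)) y<x)))

tr²-swap : ∀ x y p q → ¬ Keep x y p q → tr² x y (swap p) (swap q) ≡ tr² x y p q
tr²-swap x y (true  , true)  (true  , true)  _ = refl
tr²-swap x y (true  , true)  (false , false) _ = refl
tr²-swap x y (false , false) (_     , _)     _ = refl
tr²-swap x y (true  , true)  (true  , false) _ = trans (+-identityʳ _) (⟦⟧-⇔ (y ≟ suc x) (suc y ≟ suc (suc x)) (cong suc) suc-injective)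
tr²-swap x y (true  , true)  (false , true)  _ = trans (⟦⟧-⇔ (suc y ≟ suc (suc x)) (y ≟ suc x) suc-injective (cong suc)) (sym (+-identityʳ _))
tr²-swap x y (true  , false) (true  , true)  _ = refl
tr²-swap x y (false , true)  (true  , true)  _ = refl
tr²-swap x y (true  , false) (false , false) _ = sym (+-identityʳ _)
tr²-swap x y (false , true)  (false , false) _ = +-identityʳ _
tr²-swap x y (true  , false) (true  , false) _ = refl
tr²-swap x y (false , true)  (false , true)  _ = refl
tr²-swap x y (true  , false) (false , true)  ¬k = trans
  (⟦⟧-no (suc y ≟ suc x) (λ { refl → ¬k ((≤-refl , n≤1+n y) , inj₁ (refl , refl)) }))
  (sym (trans (+-identityʳ _) (⟦⟧-no (y ≟ suc x) (λ { refl → ¬k ((n≤1+n x , ≤-refl) , inj₁ (refl , refl)) }))))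
tr²-swap x y (false , true)  (true  , false) ¬k = trans
  (trans (+-identityʳ _) (⟦⟧-no (y ≟ suc x) (λ { refl → ¬k ((n≤1+n x , ≤-refl) , inj₂ (refl , refl)) })))
  (sym (⟦⟧-no (suc y ≟ suc x) (λ { refl → ¬k ((≤-refl , n≤1+n y) , inj₂ (refl , refl)) })))

trs²-∷ : ∀ x y p (ds : Vec ℕ n) v → trs² (x ∷ y ∷ ds) (p ∷ v) ≡ tr² x y p (Vec.head v) + trs² (y ∷ ds) v
trs²-∷ x y p ds (q ∷ v) = refl

tied : ∀ p → swap p ≡ p ⊎ tot p ≡ 1
tied (false , false) = inj₁ refl
tied (true  , true)  = inj₁ refl
tied (true  , false) = inj₂ refl
tied (false , true)  = inj₂ refl

-- The critical edge joins the second column of a kept pair to a third one that may get swapped. If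
-- the third takes exactly one of the letters, then by the gap it ends at `z + 1 ≤ x ≤ y`, too low
-- for a passage; otherwise its swap changes nothing.
exchange-trs² : (ds : Vec ℕ n) (ps : Vec Bits n) → Gap ds (add ps ds) → trs² ds (exchange ds ps) ≡ trs² ds ps
exchange-trs² []           []           _ = refl
exchange-trs² (x ∷ [])     (p ∷ [])     _ = refl
exchange-trs² (x ∷ y ∷ ds) (p ∷ q ∷ ps) (g , gap)
  with keep? x y p q | exchange-trs² ds ps (proj₂ gap) | exchange-trs² (y ∷ ds) (q ∷ ps) gap
... | yes ((x≤y , _) , _) | ih | _ = cong (λ t → tr² x y p q + t) (kept ds ps g (proj₁ gap) (proj₂ gap) ih)
  where
  kept : ∀ {n} (ds : Vec ℕ n) ps → first (add ps ds) ≤ x → second (add ps ds) ≤ y → Gap ds (add ps ds) →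
    trs² ds (exchange ds ps) ≡ trs² ds ps → trs² (y ∷ ds) (q ∷ exchange ds ps) ≡ trs² (y ∷ ds) (q ∷ ps)
  kept []       []       g g′ gap ih = refl
  kept (z ∷ ds) (r ∷ ps) g g′ gap ih = trans (trs²-∷ y z q ds (exchange (z ∷ ds) (r ∷ ps))) (cong₂ _+_ same ih)
    where
    same : tr² y z q (Vec.head (exchange (z ∷ ds) (r ∷ ps))) ≡ tr² y z q r
    same with tied r
    ... | inj₂ one = trans (tr²-zero y z q _ z<y) (sym (tr²-zero y z q r z<y))
      where
      z<y : z < y
      z<y = ≤-trans (subst (λ t → t + z ≤ x) one g) x≤y
    ... | inj₁ eq with exchange-head {x = y} {z} ds r ps g′
    ... | inj₁ eq′ = cong (tr² y z q) (trans eq′ eq)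
    ... | inj₂ (eq′ , _) = cong (tr² y z q) eq′
... | no ¬k | _ | ih = trans (trs²-∷ x y (swap p) ds (exchange (y ∷ ds) (q ∷ ps)))
    (cong₂ _+_ same ih)
  where
  same : tr² x y (swap p) (Vec.head (exchange (y ∷ ds) (q ∷ ps))) ≡ tr² x y p q
  same with exchange-head {x = x} {y} ds q ps g
  ... | inj₁ eq = trans (cong (tr² x y (swap p)) eq) (tr²-swap x y p q ¬k)
  ... | inj₂ (_ , y<x) = trans (tr²-zero x y (swap p) _ y<x) (sym (tr²-zero x y p q y<x))

_≤ᵛ_ : Vec ℕ n → Vec ℕ n → Set
[]       ≤ᵛ []       = ⊤
(x ∷ xs) ≤ᵛ (y ∷ ys) = x ≤ y × xs ≤ᵛ ys

≤ᵛ-⊞ : (X : Vec Bool n) (ds : Vec ℕ n) {es : Vec ℕ n} → (X ⊞ ds) ≤ᵛ es → ds ≤ᵛ es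
≤ᵛ-⊞ []      []       {[]}     _       = tt
≤ᵛ-⊞ (b ∷ X) (d ∷ ds) {e ∷ es} (h , t) = ≤-trans (m≤n+m d (bit b)) h , ≤ᵛ-⊞ X ds t

endpoints-≤ᵛ : ∀ {N} (ds es : Vec ℕ n) (cs : Vec (Vec Bool N) n) → endpoints ds es cs ≢ 0 → ds ≤ᵛ es
endpoints-≤ᵛ []       []       []       h = tt
endpoints-≤ᵛ (d ∷ ds) (e ∷ es) (A ∷ cs) h =
  subst (d ≤_) (⟦⟧-≢0 (♯ A + d ≟ e) (*-≢0ˡ (fin d e A) h)) (m≤n+m d (♯ A))
  , endpoints-≤ᵛ ds es cs (*-≢0ʳ (fin d e A) h)

∑-≢0 : (xs : List A) (f : A → ℕ) → ∑ xs f ≢ 0 → ∃[ x ] f x ≢ 0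
∑-≢0 []       f h = contradiction refl h
∑-≢0 (x ∷ xs) f h with f x ≟ 0
... | no fx≢0 = x , fx≢0
... | yes eq = ∑-≢0 xs f (λ eq′ → h (cong₂ _+_ eq eq′))

-- Heights never decrease, so a term that counts has not yet exceeded `es`. For the heights after
-- two letters this turns `Gap ds es` into the gap condition that `exchange` needs.
walks-≤ᵛ : (es : Vec ℕ n) (α : List ℕ) (ds : Vec ℕ n) (φ : ℕ → ℕ) → walks es α ds φ ≢ 0 → ds ≤ᵛ es
walks-≤ᵛ {n} es []      ds φ h = endpoints-≤ᵛ ds es (Vec.replicate n []) (*-≢0ˡ _ h)
walks-≤ᵛ {n} es (k ∷ α) ds φ h with ∑-≢0 (bools n) _ h
... | X , hX = ≤ᵛ-⊞ X ds (walks-≤ᵛ es α (X ⊞ ds) _ (*-≢0ʳ ⟦ ♯ X ≟ k ⟧ hX))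

Gap-mono : (ds : Vec ℕ n) {fs es : Vec ℕ n} → fs ≤ᵛ es → Gap ds es → Gap ds fs
Gap-mono []       {[]}     {[]}     _       _       = tt
Gap-mono (x ∷ ds) {y ∷ fs} {z ∷ es} (_ , h) (g , G) = ≤-trans (second-mono fs es h) g , Gap-mono ds h G
  where
  first-mono : ∀ {n} (fs es : Vec ℕ n) → fs ≤ᵛ es → first fs ≤ first es
  first-mono []       []       _       = z≤n
  first-mono (_ ∷ _)  (_ ∷ _)  (h , _) = h
  second-mono : ∀ {n} (fs es : Vec ℕ n) → fs ≤ᵛ es → second fs ≤ second es
  second-mono []       []       _       = z≤n
  second-mono (_ ∷ fs) (_ ∷ es) (_ , h) = first-mono fs es h

Gap-⊞ : (X : Vec Bool n) (ds es : Vec ℕ n) → Gap ds es → Gap (X ⊞ ds) es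
Gap-⊞ []      []       []       _       = tt
Gap-⊞ (b ∷ X) (d ∷ ds) (e ∷ es) (g , G) = ≤-trans g (m≤n+m d (bit b)) , Gap-⊞ X ds es G

𝔹² : List Bits
𝔹² = cartesianProduct 𝔹 𝔹

∑²-zip : ∀ n (f : Vec Bool n → Vec Bool n → ℕ) →
  ∑² n f ≡ ∑[ ps ∈ vecs 𝔹² n ] f (Vec.map proj₁ ps) (Vec.map proj₂ ps)
∑²-zip zero    f = +-identityʳ _
∑²-zip (suc n) f = begin
  ∑² (suc n) f
    ≡⟨ ∑²-suc n f ⟩
  ∑bits (λ a b → ∑² n (λ X Y → f (a ∷ X) (b ∷ Y)))
    ≡⟨ ∑bits-cong (λ a b → ∑²-zip n (λ X Y → f (a ∷ X) (b ∷ Y))) ⟩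
  ∑bits (λ a b → ∑[ ps ∈ vecs 𝔹² n ] g ((a , b) ∷ ps))
    ≡⟨ sym (∑-cartesianProductWith _,_ 𝔹 𝔹 (λ p → ∑[ ps ∈ vecs 𝔹² n ] g (p ∷ ps))) ⟩
  ∑[ p ∈ 𝔹² ] ∑[ ps ∈ vecs 𝔹² n ] g (p ∷ ps)
    ≡⟨ sym (∑-vecs-suc 𝔹² n g) ⟩
  ∑ (vecs 𝔹² (suc n)) g ∎
  where
  open ≡-Reasoning
  g : Vec Bits (suc n) → ℕ
  g ps = f (Vec.map proj₁ ps) (Vec.map proj₂ ps)

⊞-add : (ps : Vec Bits n) (ds : Vec ℕ n) → Vec.map proj₂ ps ⊞ Vec.map proj₁ ps ⊞ ds ≡ add ps ds
⊞-add []             []       = refl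
⊞-add ((a , b) ∷ ps) (d ∷ ds) = cong₂ _∷_ (sym (+-assoc (bit b) (bit a) d)) (⊞-add ps ds)

trs-trs² : (ds : Vec ℕ n) (ps : Vec Bits n) →
  trs ds (Vec.map proj₁ ps) + trs (Vec.map proj₁ ps ⊞ ds) (Vec.map proj₂ ps) ≡ trs² ds ps
trs-trs² []           []           = refl
trs-trs² (x ∷ [])     (p ∷ [])     = refl
trs-trs² (x ∷ y ∷ ds) (p ∷ q ∷ ps) = trans
  (interchange (tr x y (proj₁ p) (proj₁ q)) _ _ _)
  (cong (λ t → tr² x y p q + t) (trs-trs² (y ∷ ds) (q ∷ ps)))

module _ (es : Vec ℕ n) (α : List ℕ) (ds : Vec ℕ n) (gap : Gap ds es) (φ : ℕ → ℕ) where

  private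
    F : ℕ → ℕ → Vec Bits n → ℕ
    F k l ps = ⟦ ♯₁ ps ≟ k ⟧ * (⟦ ♯₂ ps ≟ l ⟧ * walks es α (add ps ds) (λ s → φ (trs² ds ps + s)))

    walks-F : ∀ k l → walks es (k ∷ l ∷ α) ds φ ≡ ∑ (vecs 𝔹² n) (F k l)
    walks-F k l = begin
      walks es (k ∷ l ∷ α) ds φ
        ≡⟨ ∑-cong (bools n) (λ X → sym (∑-*ˡ (bools n) ⟦ ♯ X ≟ k ⟧ _)) ⟩
      ∑² n H
        ≡⟨ ∑²-zip n H ⟩
      ∑[ ps ∈ vecs 𝔹² n ] H (Vec.map proj₁ ps) (Vec.map proj₂ ps)
        ≡⟨ ∑-cong (vecs 𝔹² n) (λ ps → cong (λ t → ⟦ ♯₁ ps ≟ k ⟧ * (⟦ ♯₂ ps ≟ l ⟧ * t)) (trans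
             (cong (λ t → walks es α t (λ s → φ (trs ds (Vec.map proj₁ ps) + (trs (Vec.map proj₁ ps ⊞ ds) (Vec.map proj₂ ps) + s)))) (⊞-add ps ds))
             (walks-cong es α (add ps ds) (λ s → cong φ (trans (sym (+-assoc (trs ds (Vec.map proj₁ ps)) (trs (Vec.map proj₁ ps ⊞ ds) (Vec.map proj₂ ps)) s))
               (cong (_+ s) (trs-trs² ds ps))))))) ⟩
      ∑ (vecs 𝔹² n) (F k l) ∎
      where
      open ≡-Reasoning
      H : Vec Bool n → Vec Bool n → ℕ
      H X Y = ⟦ ♯ X ≟ k ⟧ * (⟦ ♯ Y ≟ l ⟧ * walks es α (Y ⊞ X ⊞ ds) (λ s → φ (trs ds X + (trs (X ⊞ ds) Y + s))))

    F-gap : ∀ k l ps → F k l ps ≢ 0 → Gap ds (add ps ds)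
    F-gap k l ps h = Gap-mono ds
      (walks-≤ᵛ es α (add ps ds) _ (*-≢0ʳ ⟦ ♯₂ ps ≟ l ⟧ (*-≢0ʳ ⟦ ♯₁ ps ≟ k ⟧ h))) gap

    F-exchange : ∀ k l ps → Gap ds (add ps ds) → F k l ps ≡ F l k (exchange ds ps)
    F-exchange k l ps g rewrite exchange-♯₁ ds ps | exchange-♯₂ ds ps | exchange-add ds ps | exchange-trs² ds ps g =
      trans (sym (*-assoc ⟦ ♯₁ ps ≟ k ⟧ ⟦ ♯₂ ps ≟ l ⟧ W))
        (trans (cong (_* W) (*-comm ⟦ ♯₁ ps ≟ k ⟧ ⟦ ♯₂ ps ≟ l ⟧)) (*-assoc ⟦ ♯₂ ps ≟ l ⟧ ⟦ ♯₁ ps ≟ k ⟧ W))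
      where
      W : ℕ
      W = walks es α (add ps ds) (λ s → φ (trs² ds ps + s))

    -- `exchange` is an involution on the terms that count, hence injective on them. The reverse
    -- inequality is the instance with `k` and `l` interchanged.
    walks-≤ : ∀ k l → ∑ (vecs 𝔹² n) (F k l) ≤ ∑ (vecs 𝔹² n) (F l k)
    walks-≤ k l = ∑-injection (F k l) (F l k) (exchange ds)
      (vecs-unique n (Uniqueₚ.cartesianProduct⁺ 𝔹-unique 𝔹-unique))
      (λ {ps} _ h → ∈-vecs⁺ (exchange ds ps) (λ i → ∈-cartesianProduct⁺ (∈𝔹 _) (∈𝔹 _))
                  , ≤-reflexive (F-exchange k l ps (F-gap k l ps h)))
      (λ {ps} {ps′} _ h _ h′ eq → trans (sym (exchange-involutive ds ps (F-gap k l ps h)))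
        (trans (cong (exchange ds) eq) (exchange-involutive ds ps′ (F-gap k l ps′ h′))))

  walks-swap : ∀ k l → walks es (k ∷ l ∷ α) ds φ ≡ walks es (l ∷ k ∷ α) ds φ
  walks-swap k l = trans (walks-F k l) (trans (≤-antisym (walks-≤ k l) (walks-≤ l k)) (sym (walks-F l k)))

walks-↭ : (es : Vec ℕ n) {α β : List ℕ} → α ↭ β → (ds : Vec ℕ n) → Gap ds es → (φ : ℕ → ℕ) →
  walks es α ds φ ≡ walks es β ds φ
walks-↭ es Perm.refl ds gap φ = refl
walks-↭ {n} es (Perm.prep k p) ds gap φ =
  ∑-cong (bools n) (λ X → cong (⟦ ♯ X ≟ k ⟧ *_) (walks-↭ es p (X ⊞ ds) (Gap-⊞ X ds es gap) _))
walks-↭ {n} es {β = β} (Perm.swap {xs = xs} {ys = ys} k l p) ds gap φ = trans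
  (walks-↭-prep₂ k l)
  (walks-swap es ys ds gap φ k l)
  where
  walks-↭-prep₂ : ∀ k l → walks es (k ∷ l ∷ xs) ds φ ≡ walks es (k ∷ l ∷ ys) ds φ
  walks-↭-prep₂ k l = ∑-cong (bools n) (λ X → cong (⟦ ♯ X ≟ k ⟧ *_)
    (∑-cong (bools n) (λ Y → cong (⟦ ♯ Y ≟ l ⟧ *_)
      (walks-↭ es p (Y ⊞ X ⊞ ds) (Gap-⊞ Y (X ⊞ ds) es (Gap-⊞ X ds es gap)) _))))
walks-↭ es (Perm.trans p q) ds gap φ = trans (walks-↭ es p ds gap φ) (walks-↭ es q ds gap φ)

-- Reversing the order of the letters

tabulate-↭ : (g : Fin (suc n) → A) →
  List.tabulate g ↭ g (Fin.fromℕ n) ∷ List.tabulate (g ∘ Fin.inject₁)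
tabulate-↭ {zero}  g = Perm.refl
tabulate-↭ {suc n} g = Perm.trans (Perm.prep (g zero) (tabulate-↭ (g ∘ suc)))
  (Perm.swap (g zero) (g (Fin.fromℕ (suc n))) Perm.refl)

tabulate-opposite-↭ : (g : Fin n → A) → List.tabulate (g ∘ Fin.opposite) ↭ List.tabulate g
tabulate-opposite-↭ {zero}  g = Perm.refl
tabulate-opposite-↭ {suc n} g = Perm.trans
  (Perm.prep (g (Fin.fromℕ n)) (tabulate-opposite-↭ (g ∘ Fin.inject₁)))
  (Perm.↭-sym (tabulate-↭ g))

toList-tabulate : (g : Fin n → A) → Vec.toList (tabulate g) ≡ List.tabulate g
toList-tabulate {zero}  g = refl
toList-tabulate {suc n} g = cong (g zero ∷_) (toList-tabulate (g ∘ suc))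

∑-rows-reverse : ∀ N (ds es : Vec ℕ n) → Gap ds es → (g : Fin N → ℕ) (φ : ℕ → ℕ) →
  ∑[ cs ∈ vecs (bools N) n ] endpoints ds es cs * (⟦ rows cs ≟ᵛ tabulate (g ∘ Fin.opposite) ⟧ * φ (stat ℓ ds cs))
  ≡ ∑[ cs ∈ vecs (bools N) n ] endpoints ds es cs * (⟦ rows cs ≟ᵛ tabulate g ⟧ * φ (stat ℓ ds cs))
∑-rows-reverse N ds es gap g φ = trans (∑-walks N es ds (tabulate (g ∘ Fin.opposite)) φ)
  (trans (walks-↭ es (subst₂ _↭_ (sym (toList-tabulate (g ∘ Fin.opposite))) (sym (toList-tabulate g)) (tabulate-opposite-↭ g)) ds gap φ)
         (sym (∑-walks N es ds (tabulate g) φ)))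

-- The maximal excess belongs to scanning from the largest letter, so its prescribed row sums are
-- reversed. `edges` keeps them reversed, and the symmetry of the passages turns them round. To the
-- left of the first column an empty column is placed, at a height allowed by `edges`; it takes no
-- letters and so makes no passages.
matrices-equinumerous : ∀ N (ds es : Vec ℕ n) → Descending ds → Descending es → Gap ds es →
  (g : Fin N → ℕ) (φ : ℕ → ℕ) →
  ∑[ cs ∈ vecs (bools N) n ] endpoints ds es cs * (⟦ rows cs ≟ᵛ tabulate (g ∘ Fin.opposite) ⟧ * φ (stat e ds cs))
  ≡ ∑[ cs ∈ vecs (bools N) n ] endpoints ds es cs * (⟦ rows cs ≟ᵛ tabulate g ⟧ * φ (stat ℓ ds cs))
matrices-equinumerous {n} N ds es desc desc′ gap g φ = trans (trans (∑-cong (vecs (bools N) n) (λ cs → drop-left e cs))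
    (trans (edges n ds es desc desc′ gap (Vec.replicate N false) (second es) ≤-refl
             (λ rs s → ⟦ rs ≟ᵛ tabulate (g ∘ Fin.opposite) ⟧ * φ s))
           (sym (∑-cong (vecs (bools N) n) (λ cs → drop-left ℓ cs)))))
  (∑-rows-reverse N ds es gap g φ)
  where
  ℓ-false : ∀ {N} c x (A : Vec Bool N) → ℓ c x (Vec.replicate N false) A ≡ 0
  ℓ-false c x []      = refl
  ℓ-false c x (a ∷ A) = ℓ-false c (bit a + x) A
  leftEdge-false : ∀ {n} (ds : Vec ℕ n) (cs : Vec (Vec Bool N) n) → leftEdge (Vec.replicate N false) (second es) ds cs ≡ 0
  leftEdge-false []       []       = refl
  leftEdge-false (x ∷ ds) (A ∷ cs) = ℓ-false (second es) x A
  drop-left : ∀ (f : Family N) cs →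
    endpoints ds es cs * (⟦ rows cs ≟ᵛ tabulate (g ∘ Fin.opposite) ⟧ * φ (stat f ds cs))
    ≡ endpoints ds es cs * (⟦ rows cs ≟ᵛ tabulate (g ∘ Fin.opposite) ⟧ *
        φ (leftEdge (Vec.replicate N false) (second es) ds cs + stat f ds cs))
  drop-left f cs = cong (λ t → endpoints ds es cs * (⟦ rows cs ≟ᵛ tabulate (g ∘ Fin.opposite) ⟧ * φ (t + stat f ds cs)))
    (sym (leftEdge-false ds cs))

-- Arranging a set of entries in a column

-- The order attached to the left neighbour of a box decides which of the remaining entries of the
-- column goes into that box.
record Orders : Set₁ where
  field
    O     : Maybe ℕ → ℕ → ℕ → Set
    O?    : ∀ a x y → Dec (O a x y)
    asym  : ∀ a {x y} → O a x y → ¬ O a y x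
    conn  : ∀ a {x y} → x ≢ y → O a x y ⊎ O a y x
    O-trans : ∀ a {x y z} → O a x y → O a y z → O a x z

module Arrangement (Ord : Orders) where
  open Orders Ord

  irrefl : ∀ a {x} → ¬ O a x x
  irrefl a o = asym a o o

  -- One pass of selection sort: `x` is the least entry met so far in the order of `a`.
  select : Maybe ℕ → ℕ → List ℕ → ℕ × List ℕ
  select a x []      = x , []
  select a x (y ∷ S) with O? a x y
  ... | yes _ = proj₁ (select a x S) , y ∷ proj₂ (select a x S)
  ... | no _  = proj₁ (select a y S) , x ∷ proj₂ (select a y S)

  select-↭ : ∀ a x S → x ∷ S ↭ proj₁ (select a x S) ∷ proj₂ (select a x S)
  select-↭ a x []      = Perm.refl
  select-↭ a x (y ∷ S) with O? a x y
  ... | yes _ = Perm.trans (Perm.swap x y Perm.refl) (Perm.trans (Perm.prep y (select-↭ a x S)) (Perm.swap y _ Perm.refl))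
  ... | no _  = Perm.trans (Perm.prep x (select-↭ a y S)) (Perm.swap x _ Perm.refl)

  select-first : ∀ a x S → Unique (x ∷ S) → All (O a (proj₁ (select a x S))) (proj₂ (select a x S))
  select-first a x []      _ = []
  select-first a x (y ∷ S) ((x≢y ∷ x∉) ∷ (y∉ ∷ u)) with O? a x y
  ... | yes xy = before (∈-resp-↭ (select-↭ a x S) (here refl)) ∷ ih
    where
    ih : All (O a (proj₁ (select a x S))) (proj₂ (select a x S))
    ih = select-first a x S (x∉ ∷ u)
    before : x ∈ proj₁ (select a x S) ∷ proj₂ (select a x S) → O a (proj₁ (select a x S)) y
    before (here eq) = subst (λ t → O a t y) eq xy
    before (there p) = O-trans a (All.lookup ih p) xy
  ... | no ¬xy = before (∈-resp-↭ (select-↭ a y S) (here refl)) ∷ ih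
    where
    yx : O a y x
    yx with conn a x≢y
    ... | inj₁ o = contradiction o ¬xy
    ... | inj₂ o = o
    ih : All (O a (proj₁ (select a y S))) (proj₂ (select a y S))
    ih = select-first a y S (y∉ ∷ u)
    before : y ∈ proj₁ (select a y S) ∷ proj₂ (select a y S) → O a (proj₁ (select a y S)) x
    before (here eq) = subst (λ t → O a t x) eq yx
    before (there p) = O-trans a (All.lookup ih p) yx

  -- Rows other than r + 1, …, r + k get the junk value 0.
  arrange : (ℕ → Maybe ℕ) → ℕ → ℕ → List ℕ → ℕ → ℕ
  arrange l r zero    S       s = 0
  arrange l r (suc k) []      s = 0
  arrange l r (suc k) (x ∷ S) s =
    decide (s ≟ suc r) (proj₁ (select (l (suc r)) x S)) (arrange l (suc r) k (proj₂ (select (l (suc r)) x S)) s)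

  module _ (l : ℕ → Maybe ℕ) (r k : ℕ) (x : ℕ) (S : List ℕ) where
    private
      m : ℕ
      m = proj₁ (select (l (suc r)) x S)
      R : List ℕ
      R = proj₂ (select (l (suc r)) x S)

    arrange-here : arrange l r (suc k) (x ∷ S) (suc r) ≡ m
    arrange-here with suc r ≟ suc r
    ... | yes _ = refl
    ... | no ne = contradiction refl ne

    arrange-there : ∀ {s} → suc r < s → arrange l r (suc k) (x ∷ S) s ≡ arrange l (suc r) k R s
    arrange-there {s} lt with s ≟ suc r
    ... | yes refl = contradiction lt (<-irrefl refl)
    ... | no _     = refl

  record Arranged (l : ℕ → Maybe ℕ) (r k : ℕ) (S : List ℕ) (g : ℕ → ℕ) : Set where
    field
      member : ∀ s → r < s → s ≤ r + k → g s ∈ S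
      sorted : ∀ s s′ → r < s → s < s′ → s′ ≤ r + k → O (l s) (g s) (g s′)
      onto   : ∀ {v} → v ∈ S → ∃[ s ] (r < s × s ≤ r + k × g s ≡ v)

  arrange-arranged : ∀ l r k S → Unique S → length S ≡ k → Arranged l r k S (arrange l r k S)
  arrange-arranged l r zero [] _ _ = record
    { member = λ s lt le → contradiction (≤-trans lt le) (<⇒≱ (s≤s (≤-reflexive (+-identityʳ r))))
    ; sorted = λ s s′ lt lt′ le → contradiction (≤-trans (<-trans lt lt′) le) (<⇒≱ (s≤s (≤-reflexive (+-identityʳ r))))
    ; onto = λ () }
  arrange-arranged l r (suc k) (x ∷ S) u eq = record
    { member = member′ ; sorted = sorted′ ; onto = onto′ }
    where
    m : ℕ
    m = proj₁ (select (l (suc r)) x S)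
    R : List ℕ
    R = proj₂ (select (l (suc r)) x S)
    perm : x ∷ S ↭ m ∷ R
    perm = select-↭ (l (suc r)) x S
    uR : Unique (m ∷ R)
    uR = Permₛ.Unique-resp-↭ (setoid ℕ) (Perm.↭⇒↭ₛ perm) u
    ih : Arranged l (suc r) k R (arrange l (suc r) k R)
    ih = arrange-arranged l (suc r) k R (tail-unique uR)
           (suc-injective (trans (sym (↭-length perm)) eq))
      where
      tail-unique : ∀ {m R} → Unique {A = ℕ} (m ∷ R) → Unique R
      tail-unique (_ ∷ u) = u
    g : ℕ → ℕ
    g = arrange l r (suc k) (x ∷ S)
    bound : ∀ {s} → s ≤ r + suc k → s ≤ suc r + k
    bound {s} = subst (s ≤_) (+-suc r k)
    g-here : g (suc r) ≡ m
    g-here = arrange-here l r k x S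
    g-there : ∀ {s} → suc r < s → g s ≡ arrange l (suc r) k R s
    g-there = arrange-there l r k x S
    in-rest : ∀ s → suc r < s → s ≤ r + suc k → g s ∈ R
    in-rest s lt le = subst (_∈ R) (sym (g-there lt)) (Arranged.member ih s lt (bound le))
    member′ : ∀ s → r < s → s ≤ r + suc k → g s ∈ x ∷ S
    member′ s lt le with m≤n⇒m<n∨m≡n lt
    ... | inj₂ refl = ∈-resp-↭ (Perm.↭-sym perm) (here g-here)
    ... | inj₁ lt′  = ∈-resp-↭ (Perm.↭-sym perm) (there (in-rest s lt′ le))
    sorted′ : ∀ s s′ → r < s → s < s′ → s′ ≤ r + suc k → O (l s) (g s) (g s′)
    sorted′ s s′ lt lt′ le with m≤n⇒m<n∨m≡n lt
    ... | inj₂ refl = subst (λ t → O (l (suc r)) t (g s′)) (sym g-here)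
        (All.lookup (select-first (l (suc r)) x S u) (in-rest s′ lt′ le))
    ... | inj₁ lt″  = subst₂ (O (l s)) (sym (g-there lt″)) (sym (g-there (<-trans lt″ lt′)))
        (Arranged.sorted ih s s′ lt″ lt′ (bound le))
    onto′ : ∀ {v} → v ∈ x ∷ S → ∃[ s ] (r < s × s ≤ r + suc k × g s ≡ v)
    onto′ v∈ with ∈-resp-↭ perm v∈
    ... | here refl = suc r , ≤-refl , ≤-trans (s≤s (m≤m+n r k)) (≤-reflexive (sym (+-suc r k))) , g-here
    ... | there p with Arranged.onto ih p
    ... | s , lt , le , eq′ = s , <-trans ≤-refl lt , subst (s ≤_) (sym (+-suc r k)) le
        , trans (g-there lt) eq′

  -- Strong induction on the row. Let `g s` occur in `g′` at row u, and `g′ s` in `g` at row u′. An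
  -- occurrence before s would repeat an entry, by the induction hypothesis. If both occur after s,
  -- the common order of row s puts `g s` both before and after `g′ s`.
  arranged-unique : (l l′ : ℕ → Maybe ℕ) (r t : ℕ) (g g′ : ℕ → ℕ) →
    (∀ s → r < s → s ≤ t → l s ≡ l′ s) →
    (∀ s s′ → r < s → s < s′ → s′ ≤ t → O (l s) (g s) (g s′)) →
    (∀ s s′ → r < s → s < s′ → s′ ≤ t → O (l′ s) (g′ s) (g′ s′)) →
    (∀ s → r < s → s ≤ t → ∃[ s′ ] (r < s′ × s′ ≤ t × g′ s′ ≡ g s)) →
    (∀ s → r < s → s ≤ t → ∃[ s′ ] (r < s′ × s′ ≤ t × g s′ ≡ g′ s)) →
    ∀ s → r < s → s ≤ t → g s ≡ g′ s
  arranged-unique l l′ r t g g′ l≡l′ srt srt′ hit hit′ s = go (suc s) s ≤-refl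
    where
    go : ∀ k s → s < k → r < s → s ≤ t → g s ≡ g′ s
    go (suc k) s (s≤s s≤k) lt le with hit s lt le | hit′ s lt le
    ... | u , r<u , u≤t , eq | u′ , r<u′ , u′≤t , eq′ with <-cmp u s | <-cmp u′ s
    ... | tri≈ _ refl _ | _ = sym eq
    ... | _ | tri≈ _ refl _ = eq′
    ... | tri< u<s _ _ | _ = contradiction
        (subst (λ x → O (l u) x (g s)) (trans (go k u (<-≤-trans u<s s≤k) r<u u≤t) eq)
          (srt u s r<u u<s le)) (irrefl (l u))
    ... | tri> _ _ _ | tri< u′<s _ _ = contradiction
        (subst (λ x → O (l′ u′) x (g′ s)) (trans (sym (go k u′ (<-≤-trans u′<s s≤k) r<u′ u′≤t)) eq′)
          (srt′ u′ s r<u′ u′<s le)) (irrefl (l′ u′))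
    ... | tri> _ _ s<u | tri> _ _ s<u′ = contradiction
        (subst (λ a → O a (g′ s) (g s)) (sym (l≡l′ s lt le)) (subst (O (l′ s) (g′ s)) eq (srt′ s u lt s<u u≤t)))
        (asym (l s) (subst (O (l s) (g s)) eq′ (srt s u′ lt s<u′ u′≤t)))

-- Fillings of a diagram and 0/1-matrices

range : ℕ → ℕ → List ℕ
range lo hi = applyUpTo (λ k → lo + suc k) (hi ∸ lo)

∈-range⁺ : ∀ {lo hi r} → lo < r → r ≤ hi → r ∈ range lo hi
∈-range⁺ {lo} {hi} {suc r} (s≤s lo≤r) r<hi = subst (_∈ range lo hi)
  (trans (+-suc lo (r ∸ lo)) (cong suc (m+[n∸m]≡n lo≤r)))
  (∈-applyUpTo⁺ (λ k → lo + suc k) (∸-monoˡ-< r<hi lo≤r))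

∈-range⁻ : ∀ {lo hi r} → r ∈ range lo hi → lo < r × r ≤ hi
∈-range⁻ {lo} {hi} r∈ with ∈-applyUpTo⁻ (λ k → lo + suc k) r∈
... | k , k< , refl = subst (lo <_) (sym (+-suc lo k)) (s≤s (m≤m+n lo k))
  , subst (lo + suc k ≤_) (m+[n∸m]≡n (<⇒≤ lo<hi)) (+-monoʳ-≤ lo k<)
  where
  lo<hi : lo < hi
  lo<hi = m∸n≢0⇒n<m (λ eq → <⇒≱ k< (subst (_≤ k) (sym eq) z≤n))

range-unique : ∀ lo hi → Unique (range lo hi)
range-unique lo hi = Uniqueₚ.applyUpTo⁺₁ (λ k → lo + suc k) (hi ∸ lo)
  (λ i<j _ eq → <⇒≢ i<j (suc-injective (+-cancelˡ-≡ lo _ _ eq)))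

∑-const-1 : (f : ℕ → A) (k : ℕ) → ∑[ x ∈ applyUpTo f k ] 1 ≡ k
∑-const-1 f zero    = refl
∑-const-1 f (suc k) = cong suc (∑-const-1 (f ∘ suc) k)

∑-allFin-suc : ∀ n (f : Fin (suc n) → ℕ) → ∑ (allFin (suc n)) f ≡ f zero + ∑ (allFin n) (f ∘ suc)
∑-allFin-suc n f = cong (λ t → f zero + t)
  (trans (cong (λ xs → ∑ xs f) (sym (Listₚ.map-tabulate id suc))) (∑-map suc (allFin n) f))

∑-allFin-δ : ∀ {n} (i : Fin n) (f : Fin n → ℕ) → (∀ {j} → j ≢ i → f j ≡ 0) → ∑ (allFin n) f ≡ f i
∑-allFin-δ {n} i f h = ∑-δ f (Uniqueₚ.allFin⁺ n) (∈-allFin i) (λ _ → h)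

bit-does : (p : Dec P) → bit (does p) ≡ ⟦ p ⟧
bit-does (yes _) = refl
bit-does (no _)  = refl

♯-∑ : ∀ {N} (A : Vec Bool N) → ♯ A ≡ ∑[ i ∈ allFin N ] bit (lookup A i)
♯-∑ []      = refl
♯-∑ {suc N} (b ∷ A) = trans (cong (λ t → bit b + t) (♯-∑ A)) (sym (∑-allFin-suc N (λ i → bit (lookup (b ∷ A) i))))

lookup-injective : {v w : Vec A n} → (∀ i → lookup v i ≡ lookup w i) → v ≡ w
lookup-injective {v = v} {w} h =
  trans (sym (Vecₚ.tabulate∘lookup v)) (trans (Vecₚ.tabulate-cong h) (Vecₚ.tabulate∘lookup w))

rows-∑ : ∀ {N} (cs : Vec (Vec Bool N) n) i → lookup (rows cs) i ≡ ∑[ j ∈ allFin n ] bit (lookup (lookup cs j) i)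
rows-∑         []       i = Vecₚ.lookup-replicate i 0
rows-∑ {suc n} (A ∷ cs) i = trans (Vecₚ.lookup-zipWith (λ b m → bit b + m) i A (rows cs))
  (trans (cong (λ t → bit (lookup A i) + t) (rows-∑ cs i))
    (sym (∑-allFin-suc n (λ j → bit (lookup (lookup (A ∷ cs) j) i)))))

count-∑ : {P : A → Set} (P? : ∀ x → Dec (P x)) (w : Vec A n) →
  Vec.count P? w ≡ ∑[ b ∈ allFin n ] ⟦ P? (lookup w b) ⟧
count-∑         P? []      = refl
count-∑ {n = suc n} P? (x ∷ w) = trans (head-count (P? x)) (trans (cong (λ t → ⟦ P? x ⟧ + t) (count-∑ P? w))
  (sym (∑-allFin-suc n (λ b → ⟦ P? (lookup (x ∷ w) b) ⟧))))
  where
  head-count : (d : Dec _) → (if does d then suc else id) (Vec.count P? w) ≡ ⟦ d ⟧ + Vec.count P? w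
  head-count (yes _) = refl
  head-count (no _)  = refl

endpoints-yes : ∀ {N} (ds es : Vec ℕ n) (cs : Vec (Vec Bool N) n) →
  (∀ j → ♯ (lookup cs j) + lookup ds j ≡ lookup es j) → endpoints ds es cs ≡ 1
endpoints-yes []       []       []       h = refl
endpoints-yes (d ∷ ds) (e ∷ es) (A ∷ cs) h =
  cong₂ _*_ (⟦⟧-yes (♯ A + d ≟ e) (h zero)) (endpoints-yes ds es cs (h ∘ suc))

endpoints-≢0 : ∀ {N} (ds es : Vec ℕ n) (cs : Vec (Vec Bool N) n) → endpoints ds es cs ≢ 0 →
  ∀ j → ♯ (lookup cs j) + lookup ds j ≡ lookup es j
endpoints-≢0 (d ∷ ds) (e ∷ es) (A ∷ cs) h zero    = ⟦⟧-≢0 (♯ A + d ≟ e) (*-≢0ˡ (fin d e A) h)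
endpoints-≢0 (d ∷ ds) (e ∷ es) (A ∷ cs) h (suc j) = endpoints-≢0 ds es cs (*-≢0ʳ (fin d e A) h) j

nth : A → Vec A n → ℕ → A
nth d []      _       = d
nth d (x ∷ v) zero    = x
nth d (x ∷ v) (suc j) = nth d v j

nth-toℕ : (d : A) (v : Vec A n) (i : Fin n) → nth d v (toℕ i) ≡ lookup v i
nth-toℕ d (x ∷ v) zero    = refl
nth-toℕ d (x ∷ v) (suc i) = nth-toℕ d v i

decide-yes : (p : Dec P) {a b : A} → P → decide p a b ≡ a
decide-yes (yes _) _ = refl
decide-yes (no ¬p) p = contradiction p ¬p

decide-no : (p : Dec P) {a b : A} → ¬ P → decide p a b ≡ b
decide-no (yes p) ¬p = contradiction p ¬p
decide-no (no _)  _  = refl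

-- (column , row); columns are numbered from 0 and rows from 1.
In : ℕ → (ℕ → ℕ) → (ℕ → ℕ) → ℕ × ℕ → Set
In n lo hi (j , r) = j < n × lo j < r × r ≤ hi j

-- The conjugate shape lists these boxes row by row, the tuple of strips column by column; the
-- record hides the order of enumeration.
record Diagram (n : ℕ) (lo hi : ℕ → ℕ) : Set where
  field
    size          : ℕ
    pos           : Fin size → ℕ × ℕ
    pos-in        : ∀ b → In n lo hi (pos b)
    index         : ∀ {u} → In n lo hi u → Fin size
    pos-index     : ∀ {u} (i : In n lo hi u) → pos (index i) ≡ u
    pos-injective : ∀ {b c} → pos b ≡ pos c → b ≡ c

module Values {n lo hi} (D : Diagram n lo hi) where
  open Diagram D

  rowsOf : ℕ → List ℕ
  rowsOf j = range (lo j) (hi j)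

  in? : ∀ u → Dec (In n lo hi u)
  in? (j , r) = (j <? n) ×-dec (lo j <? r) ×-dec (r ≤? hi j)

  val : Vec ℕ size → ℕ → ℕ → ℕ
  val w j r with in? (j , r)
  ... | yes i = lookup w (index i)
  ... | no _  = 0

  val-pos : ∀ w {j r} b → pos b ≡ (j , r) → val w j r ≡ lookup w b
  val-pos w {j} {r} b eq with in? (j , r)
  ... | yes i = cong (lookup w) (pos-injective (trans (pos-index i) (sym eq)))
  ... | no ¬i = contradiction (subst (In n lo hi) eq (pos-in b)) ¬i

  ∑-boxes : (h : ℕ → ℕ → ℕ) → ∑[ b ∈ allFin size ] h (proj₁ (pos b)) (proj₂ (pos b))
    ≡ ∑[ j ∈ allFin n ] ∑[ r ∈ rowsOf (toℕ j) ] h (toℕ j) r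
  ∑-boxes h = begin
    ∑[ b ∈ allFin size ] h (proj₁ (pos b)) (proj₂ (pos b))
      ≡⟨ ∑-cong (allFin size) (λ b → sym (expand b)) ⟩
    ∑[ b ∈ allFin size ] ∑[ j ∈ allFin n ] ∑[ r ∈ rowsOf (toℕ j) ] at b j r
      ≡⟨ ∑-swap (allFin size) (allFin n) (λ b j → ∑[ r ∈ rowsOf (toℕ j) ] at b j r) ⟩
    ∑[ j ∈ allFin n ] ∑[ b ∈ allFin size ] ∑[ r ∈ rowsOf (toℕ j) ] at b j r
      ≡⟨ ∑-cong (allFin n) (λ j → ∑-swap (allFin size) (rowsOf (toℕ j)) (λ b r → at b j r)) ⟩
    ∑[ j ∈ allFin n ] ∑[ r ∈ rowsOf (toℕ j) ] ∑[ b ∈ allFin size ] at b j r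
      ≡⟨ ∑-cong (allFin n) (λ j → ∑-cong∈ (rowsOf (toℕ j)) (λ {r} r∈ → collapse j r r∈)) ⟩
    ∑[ j ∈ allFin n ] ∑[ r ∈ rowsOf (toℕ j) ] h (toℕ j) r ∎
    where
    open ≡-Reasoning
    at? : ∀ b j r → Dec (pos b ≡ (toℕ j , r))
    at? b j r = Productₚ.≡-dec _≟_ _≟_ (pos b) (toℕ j , r)
    at : Fin size → Fin n → ℕ → ℕ
    at b j r = ⟦ at? b j r ⟧ * h (toℕ j) r
    off : ∀ b j r → pos b ≢ (toℕ j , r) → at b j r ≡ 0
    off b j r ne = cong (_* h (toℕ j) r) (⟦⟧-no (at? b j r) ne)
    on : ∀ b j r → pos b ≡ (toℕ j , r) → at b j r ≡ h (toℕ j) r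
    on b j r eq = trans (cong (_* h (toℕ j) r) (⟦⟧-yes (at? b j r) eq)) (+-identityʳ _)
    expand : ∀ b → ∑[ j ∈ allFin n ] ∑[ r ∈ rowsOf (toℕ j) ] at b j r ≡ h (proj₁ (pos b)) (proj₂ (pos b))
    expand b = begin
      ∑[ j ∈ allFin n ] ∑[ r ∈ rowsOf (toℕ j) ] at b j r
        ≡⟨ ∑-allFin-δ j₀ (λ j → ∑[ r ∈ rowsOf (toℕ j) ] at b j r)
             (λ {j} ne → ∑-zero (rowsOf (toℕ j)) (λ {r} _ → off b j r (λ eq →
               ne (Finₚ.toℕ-injective (trans (sym (cong proj₁ eq)) (sym toℕ-j₀)))))) ⟩
      ∑[ r ∈ rowsOf (toℕ j₀) ] at b j₀ r
        ≡⟨ ∑-δ (λ r → at b j₀ r) (range-unique _ _)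
             (∈-range⁺ (subst (λ j → lo j < r₀) (sym toℕ-j₀) (proj₁ (proj₂ (pos-in b))))
                       (subst (λ j → r₀ ≤ hi j) (sym toℕ-j₀) (proj₂ (proj₂ (pos-in b)))))
             (λ {r} _ ne → off b j₀ r (λ eq → ne (sym (cong proj₂ eq)))) ⟩
      at b j₀ r₀
        ≡⟨ on b j₀ r₀ (cong (λ j → (j , r₀)) (sym toℕ-j₀)) ⟩
      h (toℕ j₀) r₀
        ≡⟨ cong (λ j → h j r₀) toℕ-j₀ ⟩
      h (proj₁ (pos b)) r₀ ∎
      where
      r₀ : ℕ
      r₀ = proj₂ (pos b)
      j₀ : Fin n
      j₀ = Fin.fromℕ< (proj₁ (pos-in b))
      toℕ-j₀ : toℕ j₀ ≡ proj₁ (pos b)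
      toℕ-j₀ = Finₚ.toℕ-fromℕ< (proj₁ (pos-in b))
    collapse : ∀ j r → r ∈ rowsOf (toℕ j) → ∑[ b ∈ allFin size ] at b j r ≡ h (toℕ j) r
    collapse j r r∈ = trans
      (∑-allFin-δ (index i) (λ b → at b j r)
        (λ {b} ne → off b j r (λ eq → ne (pos-injective (trans eq (sym (pos-index i)))))))
      (on (index i) j r (pos-index i))
      where
      i : In n lo hi (toℕ j , r)
      i = Finₚ.toℕ<n j , ∈-range⁻ r∈

does-true : (p : Dec P) → does p ≡ true → P
does-true (yes p) _ = p

does-⇔ : (p : Dec P) (q : Dec Q) → (P → Q) → (Q → P) → does p ≡ does q
does-⇔ (yes p) (yes q) f g = refl
does-⇔ (no ¬p) (no ¬q) f g = refl
does-⇔ (yes p) (no ¬q) f g = contradiction (f p) ¬q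
does-⇔ (no ¬p) (yes q) f g = contradiction (g q) ¬p

-- `l` is the inner height of the previous column. Its outer height needs no test: it is at least
-- that of the present column, so a left neighbour is missing exactly when `r ≤ l`.
leftOf : ℕ → (ℕ → ℕ) → ℕ → Maybe ℕ
leftOf l prev r = decide (l <? r) (just (prev r)) nothing

leftOf-cong : ∀ l {f g : ℕ → ℕ} r → (l < r → f r ≡ g r) → leftOf l f r ≡ leftOf l g r
leftOf-cong l r h with l <? r
... | yes lt = cong just (h lt)
... | no _   = refl

module Fillings {n lo hi} (D : Diagram n lo hi) (lo≤hi : ∀ j → lo j ≤ hi j) (hi-desc : ∀ j → hi (suc j) ≤ hi j)
                (Ord : Orders) {N} (σ : Fin N → Fin N) (σσ : ∀ i → σ (σ i) ≡ i) where
  open Diagram D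
  open Values D
  open Orders Ord
  open Arrangement Ord

  left : (ℕ → ℕ → ℕ) → ℕ → ℕ → Maybe ℕ
  left F zero    r = nothing
  left F (suc j) r = leftOf (lo j) (F j) r

  -- With `cyclic` this is the condition on Macdonald fillings, with `ascending` the one on tuples
  -- of vertical strips.
  Valid : (ℕ → ℕ → ℕ) → Set
  Valid F = ∀ j → j < n → ∀ r r′ → lo j < r → r < r′ → r′ ≤ hi j → O (left F j r) (F j r) (F j r′)

  -- The letter scanned at position `i`. `σ` is `Fin.opposite` for descents and `id` for inversions.
  letter : Fin N → ℕ
  letter i = suc (toℕ (σ i))

  Lettered : (ℕ → ℕ → ℕ) → Set
  Lettered F = ∀ j → j < n → ∀ r → lo j < r → r ≤ hi j → ∃[ i ] F j r ≡ letter i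

  Agree : (F G : ℕ → ℕ → ℕ) → Set
  Agree F G = ∀ j r → In n lo hi (j , r) → F j r ≡ G j r

  letter-injective : ∀ {i i′} → letter i ≡ letter i′ → i ≡ i′
  letter-injective {i} {i′} eq =
    trans (sym (σσ i)) (trans (cong σ (Finₚ.toℕ-injective (suc-injective eq))) (σσ i′))

  occurs? : (F : ℕ → ℕ → ℕ) (j v : ℕ) → Dec (Any (λ r → F j r ≡ v) (rowsOf j))
  occurs? F j v = Any.any? (λ r → F j r ≟ v) (rowsOf j)

  columnOf : (ℕ → ℕ → ℕ) → ℕ → Vec Bool N
  columnOf F j = tabulate (λ i → does (occurs? F j (letter i)))

  matrix : (ℕ → ℕ → ℕ) → Vec (Vec Bool N) n
  matrix F = tabulate (λ j → columnOf F (toℕ j))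

  left-agree : ∀ {F G} → Agree F G → ∀ j → j < n → ∀ r → r ≤ hi j → left F j r ≡ left G j r
  left-agree         agr zero    j<n r r≤ = refl
  left-agree {F} {G} agr (suc j) j<n r r≤ = leftOf-cong (lo j) {F j} {G j} r
    (λ lo<r → agr j r (<-trans ≤-refl j<n , lo<r , ≤-trans r≤ (hi-desc j)))

  Valid-agree : ∀ {F G} → Agree F G → Valid F → Valid G
  Valid-agree {F} {G} agr val j j<n r r′ lo<r r<r′ r′≤ = subst (λ a → O a (G j r) (G j r′))
    (left-agree agr j j<n r (≤-trans (<⇒≤ r<r′) r′≤))
    (subst₂ (O (left F j r)) (agr j r (j<n , lo<r , ≤-trans (<⇒≤ r<r′) r′≤))
      (agr j r′ (j<n , <-trans lo<r r<r′ , r′≤)) (val j j<n r r′ lo<r r<r′ r′≤))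

  matrix-agree : ∀ {F G} → Agree F G → matrix F ≡ matrix G
  matrix-agree {F} {G} agr = Vecₚ.tabulate-cong (λ j → Vecₚ.tabulate-cong (λ i →
    does-⇔ (occurs? F (toℕ j) (letter i)) (occurs? G (toℕ j) (letter i)) (transfer agr j) (transfer (λ j r p → sym (agr j r p)) j)))
    where
    transfer : ∀ {F G v} → Agree F G → ∀ (j : Fin n) → Any (λ r → F (toℕ j) r ≡ v) (rowsOf (toℕ j)) →
      Any (λ r → G (toℕ j) r ≡ v) (rowsOf (toℕ j))
    transfer agr j a with find a
    ... | r , r∈ , eq = lose r∈ (trans (sym (agr (toℕ j) r (Finₚ.toℕ<n j , ∈-range⁻ r∈))) eq)

  column-injective : ∀ {F} → Valid F → ∀ {j r r′} → j < n → r ∈ rowsOf j → r′ ∈ rowsOf j →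
    F j r ≡ F j r′ → r ≡ r′
  column-injective {F} val {j} {r} {r′} j<n r∈ r′∈ eq with <-cmp r r′
  ... | tri≈ _ r≡r′ _ = r≡r′
  ... | tri< r<r′ _ _ = contradiction
      (subst (O (left F j r) (F j r)) (sym eq) (val j j<n r r′ (proj₁ (∈-range⁻ r∈)) r<r′ (proj₂ (∈-range⁻ r′∈))))
      (irrefl (left F j r))
  ... | tri> _ _ r′<r = contradiction
      (subst (O (left F j r′) (F j r′)) eq (val j j<n r′ r (proj₁ (∈-range⁻ r′∈)) r′<r (proj₂ (∈-range⁻ r∈))))
      (irrefl (left F j r′))

  occurs-∑ : ∀ {F} → Valid F → ∀ {j} → j < n → ∀ v →
    ⟦ occurs? F j v ⟧ ≡ ∑[ r ∈ rowsOf j ] ⟦ F j r ≟ v ⟧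
  occurs-∑ {F} val {j} j<n v with ⟦⟧-dec (occurs? F j v)
  ... | inj₂ (none , eq) = trans eq (sym (∑-zero (rowsOf j) (λ {r} r∈ → ⟦⟧-no (F j r ≟ v) (λ Fr≡v → none (lose r∈ Fr≡v)))))
  ... | inj₁ (some , eq) with find some
  ... | r₀ , r₀∈ , Fr₀≡v = trans eq (sym (trans
      (∑-δ (λ r → ⟦ F j r ≟ v ⟧) (range-unique _ _) r₀∈
        (λ {r} r∈ ne → ⟦⟧-no (F j r ≟ v) (λ Fr≡v → ne (column-injective val j<n r∈ r₀∈ (trans Fr≡v (sym Fr₀≡v))))))
      (⟦⟧-yes (F j r₀ ≟ v) Fr₀≡v)))

  lookup-column : ∀ F j i → bit (lookup (columnOf F j) i) ≡ ⟦ occurs? F j (letter i) ⟧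
  lookup-column F j i = trans (cong bit (Vecₚ.lookup∘tabulate (λ i → does (occurs? F j (letter i))) i))
    (bit-does (occurs? F j (letter i)))

  lookup-matrix : ∀ F j → lookup (matrix F) j ≡ columnOf F (toℕ j)
  lookup-matrix F = Vecₚ.lookup∘tabulate (λ j → columnOf F (toℕ j))

  -- The entries of a column are distinct, so its letters correspond to its boxes. This translates
  -- statistics of indicator words into statistics of fillings.
  ∑-letters : ∀ {F} → Valid F → Lettered F → ∀ {j} → j < n → (h : Fin N → ℕ) (h′ : ℕ → ℕ) →
    (∀ i r → r ∈ rowsOf j → F j r ≡ letter i → h i ≡ h′ r) →
    ∑[ i ∈ allFin N ] bit (lookup (columnOf F j) i) * h i ≡ ∑[ r ∈ rowsOf j ] h′ r
  ∑-letters {F} val let′ {j} j<n h h′ agr = begin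
    ∑[ i ∈ allFin N ] bit (lookup (columnOf F j) i) * h i
      ≡⟨ ∑-cong (allFin N) (λ i → trans (cong (_* h i) (trans (lookup-column F j i) (occurs-∑ val j<n (letter i))))
           (trans (*-comm _ (h i)) (sym (∑-*ˡ (rowsOf j) (h i) (λ r → ⟦ F j r ≟ letter i ⟧))))) ⟩
    ∑[ i ∈ allFin N ] ∑[ r ∈ rowsOf j ] h i * ⟦ F j r ≟ letter i ⟧
      ≡⟨ ∑-swap (allFin N) (rowsOf j) (λ i r → h i * ⟦ F j r ≟ letter i ⟧) ⟩
    ∑[ r ∈ rowsOf j ] ∑[ i ∈ allFin N ] h i * ⟦ F j r ≟ letter i ⟧
      ≡⟨ ∑-cong∈ (rowsOf j) (λ {r} r∈ → collapse r r∈) ⟩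
    ∑[ r ∈ rowsOf j ] h′ r ∎
    where
    open ≡-Reasoning
    collapse : ∀ r → r ∈ rowsOf j → ∑[ i ∈ allFin N ] h i * ⟦ F j r ≟ letter i ⟧ ≡ h′ r
    collapse r r∈ with let′ j j<n r (proj₁ (∈-range⁻ r∈)) (proj₂ (∈-range⁻ r∈))
    ... | i₀ , eq = trans
      (∑-allFin-δ i₀ (λ i → h i * ⟦ F j r ≟ letter i ⟧) (λ {i} ne →
        trans (cong (h i *_) (⟦⟧-no (F j r ≟ letter i) (λ eq′ → ne (letter-injective (trans (sym eq′) eq))))) (*-zeroʳ (h i))))
      (trans (cong (h i₀ *_) (⟦⟧-yes (F j r ≟ letter i₀) eq)) (trans (*-identityʳ (h i₀)) (agr i₀ r r∈ eq)))

  los his : Vec ℕ n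
  los = tabulate (λ j → lo (toℕ j))
  his = tabulate (λ j → hi (toℕ j))

  matrix-endpoints : ∀ {F} → Valid F → Lettered F → endpoints los his (matrix F) ≡ 1
  matrix-endpoints {F} val let′ = endpoints-yes los his (matrix F) height
    where
    height : ∀ j → ♯ (lookup (matrix F) j) + lookup los j ≡ lookup his j
    height j = begin
      ♯ (lookup (matrix F) j) + lookup los j
        ≡⟨ cong (λ t → ♯ (lookup (matrix F) j) + t) (Vecₚ.lookup∘tabulate (λ j → lo (toℕ j)) j) ⟩
      ♯ (lookup (matrix F) j) + lo (toℕ j)
        ≡⟨ cong (_+ lo (toℕ j)) (trans (cong ♯ (lookup-matrix F j)) (trans (♯-∑ (columnOf F (toℕ j)))
             (∑-cong (allFin N) (λ i → sym (*-identityʳ _))))) ⟩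
      (∑[ i ∈ allFin N ] bit (lookup (columnOf F (toℕ j)) i) * 1) + lo (toℕ j)
        ≡⟨ cong (_+ lo (toℕ j)) (∑-letters val let′ (Finₚ.toℕ<n j) (λ _ → 1) (λ _ → 1) (λ _ _ _ _ → refl)) ⟩
      (∑[ r ∈ rowsOf (toℕ j) ] 1) + lo (toℕ j)
        ≡⟨ cong (_+ lo (toℕ j)) (∑-const-1 (λ k → lo (toℕ j) + suc k) _) ⟩
      (hi (toℕ j) ∸ lo (toℕ j)) + lo (toℕ j)
        ≡⟨ m∸n+n≡m (lo≤hi (toℕ j)) ⟩
      hi (toℕ j)
        ≡⟨ sym (Vecₚ.lookup∘tabulate (λ j → hi (toℕ j)) j) ⟩
      lookup his j ∎
      where open ≡-Reasoning

  weight-rows : ∀ w → Valid (val w) → ∀ i → lookup (rows (matrix (val w))) i ≡ lookup (weight N w) (σ i)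
  weight-rows w valid i = begin
    lookup (rows (matrix (val w))) i
      ≡⟨ rows-∑ (matrix (val w)) i ⟩
    ∑[ j ∈ allFin n ] bit (lookup (lookup (matrix (val w)) j) i)
      ≡⟨ ∑-cong (allFin n) (λ j → trans (cong (λ v → bit (lookup v i)) (lookup-matrix (val w) j))
           (trans (lookup-column (val w) (toℕ j) i) (occurs-∑ valid (Finₚ.toℕ<n j) (letter i)))) ⟩
    ∑[ j ∈ allFin n ] ∑[ r ∈ rowsOf (toℕ j) ] ⟦ val w (toℕ j) r ≟ letter i ⟧
      ≡⟨ sym (∑-boxes (λ j r → ⟦ val w j r ≟ letter i ⟧)) ⟩
    ∑[ b ∈ allFin size ] ⟦ val w (proj₁ (pos b)) (proj₂ (pos b)) ≟ letter i ⟧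
      ≡⟨ ∑-cong (allFin size) (λ b → cong (λ t → ⟦ t ≟ letter i ⟧) (val-pos w b refl)) ⟩
    ∑[ b ∈ allFin size ] ⟦ lookup w b ≟ letter i ⟧
      ≡⟨ sym (count-∑ (_≟ letter i) w) ⟩
    Vec.count (_≟ letter i) w
      ≡⟨ sym (Vecₚ.lookup∘tabulate (λ k → Vec.count (_≟ suc (toℕ k)) w) (σ i)) ⟩
    lookup (weight N w) (σ i) ∎
    where open ≡-Reasoning

  Shares : (F G : ℕ → ℕ → ℕ) → Set
  Shares F G = ∀ j → j < n → ∀ s → lo j < s → s ≤ hi j → ∃[ s′ ] (lo j < s′ × s′ ≤ hi j × G j s′ ≡ F j s)

  matrix-shares : ∀ {F G} → Lettered F → matrix F ≡ matrix G → Shares F G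
  matrix-shares {F} {G} let′ eq j j<n s lo<s s≤ with let′ j j<n s lo<s s≤
  ... | i , Fs≡i with find (does-true (occurs? G j (letter i)) (trans (sym same)
                        (dec-true (occurs? F j (letter i)) (lose (∈-range⁺ lo<s s≤) Fs≡i))))
    where
    j′ : Fin n
    j′ = Fin.fromℕ< j<n
    entry : ∀ H → does (occurs? H j (letter i)) ≡ lookup (lookup (matrix H) j′) i
    entry H = sym (trans (cong (λ v → lookup v i) (trans (lookup-matrix H j′)
        (cong (columnOf H) (Finₚ.toℕ-fromℕ< j<n))))
      (Vecₚ.lookup∘tabulate (λ i → does (occurs? H j (letter i))) i))
    same : does (occurs? F j (letter i)) ≡ does (occurs? G j (letter i))
    same = trans (entry F) (trans (cong (λ m → lookup (lookup m j′) i) eq) (sym (entry G)))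
  ... | s′ , s′∈ , Gs′≡i = s′ , proj₁ (∈-range⁻ s′∈) , proj₂ (∈-range⁻ s′∈) , trans Gs′≡i (sym Fs≡i)

  -- Columns are compared from left to right: once column `j` agrees, so do the orders attached to
  -- the rows of column `suc j`.
  shares-agree : ∀ {F G} → Valid F → Valid G → Shares F G → Shares G F → ∀ j r → In n lo hi (j , r) → F j r ≡ G j r
  shares-agree {F} {G} vF vG fg gf zero r (j<n , lo<r , r≤) = arranged-unique
    (left F zero) (left G zero) (lo zero) (hi zero) (F zero) (G zero) (λ _ _ _ → refl)
    (vF zero j<n) (vG zero j<n) (fg zero j<n) (gf zero j<n) r lo<r r≤
  shares-agree {F} {G} vF vG fg gf (suc j) r (j<n , lo<r , r≤) = arranged-unique
    (left F (suc j)) (left G (suc j)) (lo (suc j)) (hi (suc j)) (F (suc j)) (G (suc j))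
    (λ s _ s≤ → leftOf-cong (lo j) {F j} {G j} s (λ lt →
      shares-agree vF vG fg gf j s (<-trans ≤-refl j<n , lt , ≤-trans s≤ (hi-desc j))))
    (vF (suc j) j<n) (vG (suc j) j<n) (fg (suc j) j<n) (gf (suc j) j<n) r lo<r r≤

  letters : Vec Bool N → List ℕ
  letters A = map letter (filter (λ i → lookup A i Boolₚ.≟ true) (allFin N))

  letters-unique : ∀ A → Unique (letters A)
  letters-unique A = Uniqueₚ.map⁺ letter-injective (Uniqueₚ.filter⁺ (λ i → lookup A i Boolₚ.≟ true) (Uniqueₚ.allFin⁺ N))

  letters-length : ∀ A → length (letters A) ≡ ♯ A
  letters-length A = trans (Listₚ.length-map letter (filter (λ i → lookup A i Boolₚ.≟ true) (allFin N)))
    (trans (length-filter-∑ (λ i → lookup A i Boolₚ.≟ true) (allFin N))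
      (trans (∑-cong (allFin N) (λ i → bit-true (lookup A i))) (sym (♯-∑ A))))
    where
    bit-true : ∀ b → ⟦ b Boolₚ.≟ true ⟧ ≡ bit b
    bit-true false = refl
    bit-true true  = refl

  ∈-letters⁺ : ∀ A i → lookup A i ≡ true → letter i ∈ letters A
  ∈-letters⁺ A i eq = ∈-map⁺ letter (∈-filter⁺ (λ i → lookup A i Boolₚ.≟ true) (∈-allFin i) eq)

  ∈-letters⁻ : ∀ A {v} → v ∈ letters A → ∃[ i ] (v ≡ letter i × lookup A i ≡ true)
  ∈-letters⁻ A v∈ with ∈-map⁻ letter v∈
  ... | i , i∈ , eq = i , eq , proj₂ (∈-filter⁻ (λ i → lookup A i Boolₚ.≟ true) {xs = allFin N} i∈)

  column : Vec (Vec Bool N) n → ℕ → Vec Bool N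
  column = nth (Vec.replicate N false)

  fill : Vec (Vec Bool N) n → ℕ → ℕ → ℕ
  fill cs zero    = arrange (λ _ → nothing) (lo zero) (hi zero ∸ lo zero) (letters (column cs zero))
  fill cs (suc j) = arrange (leftOf (lo j) (fill cs j)) (lo (suc j)) (hi (suc j) ∸ lo (suc j)) (letters (column cs (suc j)))

  module _ (cs : Vec (Vec Bool N) n) (ends : endpoints los his cs ≢ 0) where

    column-height : ∀ j → j < n → length (letters (column cs j)) ≡ hi j ∸ lo j
    column-height j j<n = trans (letters-length (column cs j)) (begin
      ♯ (column cs j)
        ≡⟨ cong (λ j → ♯ (column cs j)) (sym (Finₚ.toℕ-fromℕ< j<n)) ⟩
      ♯ (column cs (toℕ j′))
        ≡⟨ cong ♯ (nth-toℕ _ cs j′) ⟩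
      ♯ (lookup cs j′)
        ≡⟨ sym (m+n∸n≡m _ (lookup los j′)) ⟩
      (♯ (lookup cs j′) + lookup los j′) ∸ lookup los j′
        ≡⟨ cong (λ t → t ∸ lookup los j′) (endpoints-≢0 los his cs ends j′) ⟩
      lookup his j′ ∸ lookup los j′
        ≡⟨ cong₂ _∸_ (Vecₚ.lookup∘tabulate (λ j → hi (toℕ j)) j′) (Vecₚ.lookup∘tabulate (λ j → lo (toℕ j)) j′) ⟩
      hi (toℕ j′) ∸ lo (toℕ j′)
        ≡⟨ cong (λ j → hi j ∸ lo j) (Finₚ.toℕ-fromℕ< j<n) ⟩
      hi j ∸ lo j ∎)
      where
      open ≡-Reasoning
      j′ : Fin n
      j′ = Fin.fromℕ< j<n

    fill-arranged : ∀ j → j < n →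
      Arranged (left (fill cs) j) (lo j) (hi j ∸ lo j) (letters (column cs j)) (fill cs j)
    fill-arranged zero    j<n = arrange-arranged _ _ _ _ (letters-unique (column cs zero)) (column-height zero j<n)
    fill-arranged (suc j) j<n = arrange-arranged _ _ _ _ (letters-unique (column cs (suc j))) (column-height (suc j) j<n)

    within : ∀ j {r} → r ≤ hi j → r ≤ lo j + (hi j ∸ lo j)
    within j {r} = subst (r ≤_) (sym (m+[n∸m]≡n (lo≤hi j)))

    fill-valid : Valid (fill cs)
    fill-valid j j<n r r′ lo<r r<r′ r′≤ = Arranged.sorted (fill-arranged j j<n) r r′ lo<r r<r′ (within j r′≤)

    fill-lettered : Lettered (fill cs)
    fill-lettered j j<n r lo<r r≤ with ∈-letters⁻ (column cs j) (Arranged.member (fill-arranged j j<n) r lo<r (within j r≤))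
    ... | i , eq , _ = i , eq

    matrix-fill : matrix (fill cs) ≡ cs
    matrix-fill = lookup-injective (λ j → lookup-injective (λ i → trans
      (cong (λ v → lookup v i) (lookup-matrix (fill cs) j))
      (trans (Vecₚ.lookup∘tabulate (λ i → does (occurs? (fill cs) (toℕ j) (letter i))) i)
        (trans (entry (toℕ j) (Finₚ.toℕ<n j) i) (cong (λ v → lookup v i) (nth-toℕ _ cs j))))))
      where
      entry : ∀ j → j < n → ∀ i → does (occurs? (fill cs) j (letter i)) ≡ lookup (column cs j) i
      entry j j<n i = trans (does-⇔ (occurs? (fill cs) j (letter i)) (lookup (column cs j) i Boolₚ.≟ true) to from)
                            (does-≟true (lookup (column cs j) i))
        where
        does-≟true : ∀ b → does (b Boolₚ.≟ true) ≡ b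
        does-≟true false = refl
        does-≟true true  = refl
        to : Any (λ r → fill cs j r ≡ letter i) (rowsOf j) → lookup (column cs j) i ≡ true
        to a with find a
        ... | r , r∈ , eq with ∈-letters⁻ (column cs j) (Arranged.member (fill-arranged j j<n) r (proj₁ (∈-range⁻ r∈)) (within j (proj₂ (∈-range⁻ r∈))))
        ... | i′ , eq′ , t = subst (λ i → lookup (column cs j) i ≡ true) (letter-injective (trans (sym eq′) eq)) t
        from : lookup (column cs j) i ≡ true → Any (λ r → fill cs j r ≡ letter i) (rowsOf j)
        from t with Arranged.onto (fill-arranged j j<n) (∈-letters⁺ (column cs j) i t)
        ... | s , lo<s , s≤ , eq = lose (∈-range⁺ lo<s (subst (s ≤_) (m+[n∸m]≡n (lo≤hi j)) s≤)) eq

  filling : (ℕ → ℕ → ℕ) → Vec ℕ size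
  filling F = tabulate (λ b → F (proj₁ (pos b)) (proj₂ (pos b)))

  val-filling : ∀ F → Agree F (val (filling F))
  val-filling F j r i = sym (trans (val-pos (filling F) (index i) (pos-index i))
    (trans (Vecₚ.lookup∘tabulate (λ b → F (proj₁ (pos b)) (proj₂ (pos b))) (index i))
           (cong (λ u → F (proj₁ u) (proj₂ u)) (pos-index i))))

  val-injective : ∀ {v w} → Agree (val v) (val w) → v ≡ w
  val-injective {v} {w} agr = lookup-injective (λ b → trans (sym (val-pos v b refl))
    (trans (agr _ _ (pos-in b)) (val-pos w b refl)))

  letter-∈ : ∀ i → letter i ∈ [1⋯ N ]
  letter-∈ i = ∈-applyUpTo⁺ suc (Finₚ.toℕ<n (σ i))

  ∈-letter : ∀ {v} → v ∈ [1⋯ N ] → ∃[ i ] v ≡ letter i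
  ∈-letter v∈ with ∈-applyUpTo⁻ suc v∈
  ... | k , k<N , refl = σ (Fin.fromℕ< k<N) , cong suc (sym (trans (cong toℕ (σσ _)) (Finₚ.toℕ-fromℕ< k<N)))

  val-lettered : ∀ {w} → (∀ b → lookup w b ∈ [1⋯ N ]) → Lettered (val w)
  val-lettered {w} w∈ j j<n r lo<r r≤ with ∈-letter (w∈ (index (j<n , lo<r , r≤)))
  ... | i , eq = i , trans (val-pos w (index (j<n , lo<r , r≤)) (pos-index _)) eq

  filling-∈ : ∀ {F} → Lettered F → ∀ b → lookup (filling F) b ∈ [1⋯ N ]
  filling-∈ {F} let′ b with pos-in b
  ... | j<n , lo<r , r≤ with let′ _ j<n _ lo<r r≤
  ... | i , eq = subst (_∈ [1⋯ N ]) (sym (trans (Vecₚ.lookup∘tabulate _ b) eq)) (letter-∈ i)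

  module _ {V : Vec ℕ size → Set} (V? : ∀ w → Dec (V w))
           (V⇒Valid : ∀ {w} → (∀ b → lookup w b ∈ [1⋯ N ]) → V w → Valid (val w))
           (Valid⇒V : ∀ {w} → (∀ b → lookup w b ∈ [1⋯ N ]) → Valid (val w) → V w)
           (α : Vec ℕ N) (ψ : Vec ℕ size → ℕ) (φ : Vec (Vec Bool N) n → ℕ)
           (ψ≡φ : ∀ {w} → (∀ b → lookup w b ∈ [1⋯ N ]) → Valid (val w) → ψ w ≡ φ (matrix (val w))) where

    private
      F : Vec ℕ size → ℕ
      F w = ⟦ V? w ⟧ * (⟦ weight N w ≟ᵛ α ⟧ * ψ w)

      -- Row `i` of the matrix belongs to the letter `letter i`, hence the permuted exponents.
      G : Vec (Vec Bool N) n → ℕ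
      G cs = endpoints los his cs * (⟦ rows cs ≟ᵛ tabulate (λ i → lookup α (σ i)) ⟧ * φ cs)

      same-weight : ∀ {w} → Valid (val w) → ⟦ weight N w ≟ᵛ α ⟧ ≡ ⟦ rows (matrix (val w)) ≟ᵛ tabulate (λ i → lookup α (σ i)) ⟧
      same-weight {w} valid = ⟦⟧-⇔ (weight N w ≟ᵛ α) (rows (matrix (val w)) ≟ᵛ tabulate (λ i → lookup α (σ i))) to from
        where
        to : weight N w ≡ α → rows (matrix (val w)) ≡ tabulate (λ i → lookup α (σ i))
        to eq = lookup-injective (λ i → trans (weight-rows w valid i)
          (trans (cong (λ v → lookup v (σ i)) eq) (sym (Vecₚ.lookup∘tabulate (λ i → lookup α (σ i)) i))))
        from : rows (matrix (val w)) ≡ tabulate (λ i → lookup α (σ i)) → weight N w ≡ α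
        from eq = lookup-injective (λ k → begin
          lookup (weight N w) k                      ≡⟨ cong (lookup (weight N w)) (sym (σσ k)) ⟩
          lookup (weight N w) (σ (σ k))              ≡⟨ sym (weight-rows w valid (σ k)) ⟩
          lookup (rows (matrix (val w))) (σ k)       ≡⟨ cong (λ v → lookup v (σ k)) eq ⟩
          lookup (tabulate (λ i → lookup α (σ i))) (σ k) ≡⟨ Vecₚ.lookup∘tabulate (λ i → lookup α (σ i)) (σ k) ⟩
          lookup α (σ (σ k))                         ≡⟨ cong (lookup α) (σσ k) ⟩
          lookup α k ∎)
          where open ≡-Reasoning

      F≡G : ∀ {w} → (∀ b → lookup w b ∈ [1⋯ N ]) → V w → F w ≡ G (matrix (val w))
      F≡G {w} w∈ v = cong₂ _*_
        (trans (⟦⟧-yes (V? w) v) (sym (matrix-endpoints valid (val-lettered w∈))))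
        (cong₂ _*_ (same-weight valid) (ψ≡φ w∈ valid))
        where
        valid : Valid (val w)
        valid = V⇒Valid w∈ v

      1⋯N-unique : Unique [1⋯ N ]
      1⋯N-unique = Uniqueₚ.applyUpTo⁺₁ suc N (λ i<j _ eq → <⇒≢ i<j (suc-injective eq))

    fillings-matrices : ∑ (vecs [1⋯ N ] size) F ≡ ∑ (vecs (bools N) n) G
    fillings-matrices = ∑-bijection F G (λ w → matrix (val w)) (λ cs → filling (fill cs))
      (vecs-unique size 1⋯N-unique) (vecs-unique n (vecs-unique N 𝔹-unique))
      (λ {w} w∈ F≢0 → let v = ⟦⟧-≢0 (V? w) (*-≢0ˡ ⟦ V? w ⟧ F≢0) in
        ∈-matrices (matrix (val w)) , ≤-reflexive (F≡G (∈-vecs⁻ w∈) v) , fill-matrix (∈-vecs⁻ w∈) v)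
      (λ {cs} _ G≢0 → let ends = *-≢0ˡ (endpoints los his cs) G≢0 in
        ∈-vecs⁺ (filling (fill cs)) (filling-∈ (fill-lettered cs ends))
        , ≤-reflexive (sym (trans (F≡G (filling-∈ (fill-lettered cs ends)) (V-fill cs ends)) (cong G (matrix-val-fill cs ends))))
        , matrix-val-fill cs ends)
      where
      ∈-matrices : ∀ cs → cs ∈ vecs (bools N) n
      ∈-matrices cs = ∈-vecs⁺ cs (λ j → ∈-vecs⁺ (lookup cs j) (λ i → ∈𝔹 _))
      matrix-val-fill : ∀ cs → endpoints los his cs ≢ 0 → matrix (val (filling (fill cs))) ≡ cs
      matrix-val-fill cs ends = trans (sym (matrix-agree (val-filling (fill cs)))) (matrix-fill cs ends)
      V-fill : ∀ cs → endpoints los his cs ≢ 0 → V (filling (fill cs))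
      V-fill cs ends = Valid⇒V (filling-∈ (fill-lettered cs ends)) (Valid-agree (val-filling (fill cs)) (fill-valid cs ends))
      fill-matrix : ∀ {w} → (∀ b → lookup w b ∈ [1⋯ N ]) → V w → filling (fill (matrix (val w))) ≡ w
      fill-matrix {w} w∈ v = val-injective (λ j r i → trans (sym (val-filling (fill cs) j r i))
        (shares-agree (fill-valid cs ends) valid
          (matrix-shares (fill-lettered cs ends) (matrix-fill cs ends))
          (matrix-shares (val-lettered w∈) (sym (matrix-fill cs ends))) j r i))
        where
        cs : Vec (Vec Bool N) n
        cs = matrix (val w)
        valid : Valid (val w)
        valid = V⇒Valid w∈ v
        ends : endpoints los his cs ≢ 0
        ends eq = contradiction (trans (sym (matrix-endpoints valid (val-lettered w∈))) eq) (λ ())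

-- Descents

⟦⟧-∪ : (p : Dec P) (q : Dec Q) {S : Set} (s : Dec S) → (S → P ⊎ Q) → ⟦ s ⟧ ≤ ⟦ p ⟧ + ⟦ q ⟧
⟦⟧-∪ p q s f with ⟦⟧-dec s
... | inj₂ (_ , eq) = subst (_≤ ⟦ p ⟧ + ⟦ q ⟧) (sym eq) z≤n
... | inj₁ (x , eq) with f x
... | inj₁ y = ≤-trans (≤-reflexive (trans eq (sym (⟦⟧-yes p y)))) (m≤m+n ⟦ p ⟧ ⟦ q ⟧)
... | inj₂ y = ≤-trans (≤-reflexive (trans eq (sym (⟦⟧-yes q y)))) (m≤n+m ⟦ q ⟧ ⟦ p ⟧)

⟦⟧-⊎ : (p : Dec P) (q : Dec Q) {S : Set} (s : Dec S) → (P → S) → (Q → S) → (P → ¬ Q) → ⟦ p ⟧ + ⟦ q ⟧ ≤ ⟦ s ⟧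
⟦⟧-⊎ p q s f g ex with ⟦⟧-dec p | ⟦⟧-dec q
... | inj₁ (x , eq) | inj₁ (y , _)   = contradiction y (ex x)
... | inj₁ (x , eq) | inj₂ (_ , eq′) = ≤-reflexive (trans (cong₂ _+_ eq eq′) (sym (⟦⟧-yes s (f x))))
... | inj₂ (_ , eq) | inj₁ (y , eq′) = ≤-reflexive (trans (cong₂ _+_ eq eq′) (sym (⟦⟧-yes s (g y))))
... | inj₂ (_ , eq) | inj₂ (_ , eq′) = subst (_≤ ⟦ s ⟧) (sym (cong₂ _+_ eq eq′)) z≤n

-- Extends the sum over one column to a common range of rows, on which different columns can be
-- compared row by row.
∑-restrict : ∀ {lo hi H} → hi ≤ H → (f : ℕ → ℕ) →
  ∑ (range lo hi) f ≡ ∑[ r ∈ range 0 H ] ⟦ (lo <? r) ×-dec (r ≤? hi) ⟧ * f r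
∑-restrict {lo} {hi} {H} hi≤H f = ∑-bijection f (λ r → ⟦ (lo <? r) ×-dec (r ≤? hi) ⟧ * f r) id id
  (range-unique lo hi) (range-unique 0 H)
  (λ {r} r∈ _ → ∈-range⁺ (≤-<-trans z≤n (proj₁ (∈-range⁻ r∈))) (≤-trans (proj₂ (∈-range⁻ r∈)) hi≤H)
    , ≤-reflexive (sym (on r (∈-range⁻ r∈))) , refl)
  (λ {r} _ G≢0 → let i = ⟦⟧-≢0 ((lo <? r) ×-dec (r ≤? hi)) (*-≢0ˡ ⟦ (lo <? r) ×-dec (r ≤? hi) ⟧ G≢0) in
    ∈-range⁺ (proj₁ i) (proj₂ i) , ≤-reflexive (on r i) , refl)
  where
  on : ∀ r → lo < r × r ≤ hi → ⟦ (lo <? r) ×-dec (r ≤? hi) ⟧ * f r ≡ f r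
  on r i = trans (cong (_* f r) (⟦⟧-yes ((lo <? r) ×-dec (r ≤? hi)) i)) (+-identityʳ (f r))

∑-initial : ∀ {l H} → l ≤ H → ∑[ r ∈ range 0 H ] ⟦ r ≤? l ⟧ ≡ l
∑-initial {l} {H} l≤H = begin
  ∑[ r ∈ range 0 H ] ⟦ r ≤? l ⟧
    ≡⟨ ∑-cong∈ (range 0 H) (λ {r} r∈ → trans (⟦⟧-⇔ (r ≤? l) ((0 <? r) ×-dec (r ≤? l)) (λ le → proj₁ (∈-range⁻ r∈) , le) proj₂)
         (sym (*-identityʳ _))) ⟩
  ∑[ r ∈ range 0 H ] ⟦ (0 <? r) ×-dec (r ≤? l) ⟧ * 1
    ≡⟨ sym (∑-restrict l≤H (λ _ → 1)) ⟩
  ∑[ r ∈ range 0 l ] 1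
    ≡⟨ ∑-const-1 (λ k → suc k) l ⟩
  l ∎
  where open ≡-Reasoning

pre : ∀ {N} → ℕ → Vec Bool N → ℕ
pre zero    A       = 0
pre (suc t) []      = 0
pre (suc t) (b ∷ A) = bit b + pre t A

pre-∑ : ∀ {N} t (A : Vec Bool N) → pre t A ≡ ∑[ i ∈ allFin N ] bit (lookup A i) * ⟦ toℕ i <? t ⟧
pre-∑ {N} zero A = sym (∑-zero (allFin N) (λ {i} _ → *-zeroʳ (bit (lookup A i))))
pre-∑ (suc t) [] = refl
pre-∑ {suc N} (suc t) (b ∷ A) = trans
  (cong₂ _+_ (sym (*-identityʳ (bit b))) (trans (pre-∑ t A) (∑-cong (allFin N) (λ i →
    cong (λ s → bit (lookup A i) * s) (⟦⟧-⇔ (toℕ i <? t) (suc (toℕ i) <? suc t) s≤s (λ { (s≤s h) → h }))))))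
  (sym (∑-allFin-suc N (λ i → bit (lookup (b ∷ A) i) * ⟦ toℕ i <? suc t ⟧)))

pre-step : ∀ {N} b (B : Vec Bool N) y t → pre (suc t) (b ∷ B) + y ≡ pre t B + (bit b + y)
pre-step b B y t = trans (cong (_+ y) (+-comm (bit b) (pre t B))) (+-assoc (pre t B) (bit b) y)

-- Together with `e-at` this describes `e` as a maximum over prefixes, with the excess expressed by
-- addition so that the heights can be replaced by sums over rows.
e-lub : ∀ {N} x y (A B : Vec Bool N) M → (∀ t → t ≤ N → pre t B + y ≤ M + (pre t A + x)) → e x y A B ≤ M
e-lub x y []      []      M h = m≤n+o⇒m∸n≤o y x (subst (y ≤_) (+-comm M x) (h 0 z≤n))
e-lub x y (a ∷ A) (b ∷ B) M h = ⊔-lub (m≤n+o⇒m∸n≤o y x (subst (y ≤_) (+-comm M x) (h 0 z≤n)))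
  (e-lub (bit a + x) (bit b + y) A B M (λ t t≤ → subst₂ _≤_ (pre-step b B y t)
    (cong (λ u → M + u) (pre-step a A x t)) (h (suc t) (s≤s t≤))))

e-at : ∀ {N} x y (A B : Vec Bool N) t M → M + (pre t A + x) ≤ pre t B + y → M ≤ e x y A B
e-at x y A       B       zero    M h = ≤-trans (m+n≤o⇒m≤o∸n M h) (e-start x y A B)
e-at x y []      []      (suc t) M h = m+n≤o⇒m≤o∸n M h
e-at x y (a ∷ A) (b ∷ B) (suc t) M h = ≤-trans
  (e-at (bit a + x) (bit b + y) A B t M (subst₂ _≤_ (cong (λ u → M + u) (pre-step a A x t)) (pre-step b B y t) h))
  (m≤n⊔m (y ∸ x) _)

edgeAt : ∀ {N} → Family N → (ℕ → ℕ) → (ℕ → Vec Bool N) → ℕ → ℕ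
edgeAt f d c zero    = 0
edgeAt f d c (suc j) = f (d j) (d (suc j)) (c j) (c (suc j))

stat-∑ : ∀ {N} n (f : Family N) (d : ℕ → ℕ) (c : ℕ → Vec Bool N) →
  stat f (tabulate {n = n} (λ j → d (toℕ j))) (tabulate (λ j → c (toℕ j))) ≡ ∑[ j ∈ allFin n ] edgeAt f d c (toℕ j)
stat-∑ zero          f d c = refl
stat-∑ (suc zero)    f d c = refl
stat-∑ (suc (suc n)) f d c = begin
  f (d 0) (d 1) (c 0) (c 1) + stat f (tabulate {n = suc n} (λ j → d (suc (toℕ j)))) (tabulate (λ j → c (suc (toℕ j))))
    ≡⟨ cong (λ t → f (d 0) (d 1) (c 0) (c 1) + t) (stat-∑ (suc n) f (d ∘ suc) (c ∘ suc)) ⟩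
  f (d 0) (d 1) (c 0) (c 1) + (∑[ j ∈ allFin (suc n) ] edgeAt f (d ∘ suc) (c ∘ suc) (toℕ j))
    ≡⟨ cong (λ t → f (d 0) (d 1) (c 0) (c 1) + t) (∑-allFin-suc n (λ j → edgeAt f (d ∘ suc) (c ∘ suc) (toℕ j))) ⟩
  f (d 0) (d 1) (c 0) (c 1) + (∑[ j ∈ allFin n ] edgeAt f d c (2 + toℕ j))
    ≡⟨ sym (∑-allFin-suc n (λ j → edgeAt f d c (suc (toℕ j)))) ⟩
  ∑[ j ∈ allFin (suc n) ] edgeAt f d c (suc (toℕ j))
    ≡⟨ sym (∑-allFin-suc (suc n) (λ j → edgeAt f d c (toℕ j))) ⟩
  ∑[ j ∈ allFin (2 + n) ] edgeAt f d c (toℕ j) ∎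
  where open ≡-Reasoning

argmin : {P : ℕ → Set} → (∀ r → Dec (P r)) → (f : ℕ → ℕ) (xs : List ℕ) →
  (∀ {r} → r ∈ xs → ¬ P r) ⊎ (∃[ s ] (P s × (∀ {r} → r ∈ xs → P r → f s ≤ f r)))
argmin P? f [] = inj₁ (λ ())
argmin P? f (x ∷ xs) with P? x | argmin P? f xs
... | no ¬p | inj₁ none = inj₁ (λ { (here refl) → ¬p ; (there r∈) → none r∈ })
... | no ¬p | inj₂ (s , Ps , min) = inj₂ (s , Ps , λ { (here refl) p → contradiction p ¬p ; (there r∈) → min r∈ })
... | yes p | inj₁ none = inj₂ (x , p , λ { (here refl) _ → ≤-refl ; (there r∈) q → contradiction q (none r∈) })
... | yes p | inj₂ (s , Ps , min) with ≤-total (f s) (f x)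
... | inj₁ s≤x = inj₂ (s , Ps , λ { (here refl) _ → s≤x ; (there r∈) → min r∈ })
... | inj₂ x≤s = inj₂ (x , p , λ { (here refl) _ → ≤-refl ; (there r∈) q → ≤-trans x≤s (min r∈ q) })

-- Cyclically decreasing from a; a missing left neighbour carries ∞.
Cyclic : Maybe ℕ → ℕ → ℕ → Set
Cyclic nothing  x y = y < x
Cyclic (just a) x y = (x ≤ a × a < y) ⊎ (a < y × y < x) ⊎ (y < x × x ≤ a)

cyclic : Orders
cyclic = record { O = Cyclic ; O? = cyclic? ; asym = c-asym ; conn = c-conn ; O-trans = c-trans }
  where
  cyclic? : ∀ a x y → Dec (Cyclic a x y)
  cyclic? nothing  x y = y <? x
  cyclic? (just a) x y = ((x ≤? a) ×-dec (a <? y)) ⊎-dec ((a <? y) ×-dec (y <? x)) ⊎-dec ((y <? x) ×-dec (x ≤? a))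
  c-asym : ∀ a {x y} → Cyclic a x y → ¬ Cyclic a y x
  c-asym nothing p q = <-asym p q
  c-asym (just a) (inj₁ (x≤a , a<y)) (inj₁ (y≤a , _)) = <⇒≱ a<y y≤a
  c-asym (just a) (inj₁ (x≤a , a<y)) (inj₂ (inj₁ (a<x , _))) = <⇒≱ a<x x≤a
  c-asym (just a) (inj₁ (x≤a , a<y)) (inj₂ (inj₂ (_ , y≤a))) = <⇒≱ a<y y≤a
  c-asym (just a) (inj₂ (inj₁ (a<y , y<x))) (inj₁ (y≤a , _)) = <⇒≱ a<y y≤a
  c-asym (just a) (inj₂ (inj₁ (a<y , y<x))) (inj₂ (inj₁ (_ , x<y))) = <-asym y<x x<y
  c-asym (just a) (inj₂ (inj₁ (a<y , y<x))) (inj₂ (inj₂ (_ , y≤a))) = <⇒≱ a<y y≤a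
  c-asym (just a) (inj₂ (inj₂ (y<x , x≤a))) (inj₁ (_ , a<x)) = <⇒≱ a<x x≤a
  c-asym (just a) (inj₂ (inj₂ (y<x , x≤a))) (inj₂ (inj₁ (a<x , _))) = <⇒≱ a<x x≤a
  c-asym (just a) (inj₂ (inj₂ (y<x , x≤a))) (inj₂ (inj₂ (x<y , _))) = <-asym y<x x<y
  c-conn : ∀ a {x y} → x ≢ y → Cyclic a x y ⊎ Cyclic a y x
  c-conn nothing {x} {y} ne with <-cmp x y
  ... | tri< x<y _ _ = inj₂ x<y
  ... | tri≈ _ eq _  = contradiction eq ne
  ... | tri> _ _ y<x = inj₁ y<x
  c-conn (just a) {x} {y} ne with x ≤? a | y ≤? a | <-cmp x y
  ... | _ | _ | tri≈ _ eq _ = contradiction eq ne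
  ... | yes x≤a | no y≰a | _ = inj₁ (inj₁ (x≤a , ≰⇒> y≰a))
  ... | no x≰a | yes y≤a | _ = inj₂ (inj₁ (y≤a , ≰⇒> x≰a))
  ... | yes x≤a | yes y≤a | tri< x<y _ _ = inj₂ (inj₂ (inj₂ (x<y , y≤a)))
  ... | yes x≤a | yes y≤a | tri> _ _ y<x = inj₁ (inj₂ (inj₂ (y<x , x≤a)))
  ... | no x≰a | no y≰a | tri< x<y _ _ = inj₂ (inj₂ (inj₁ (≰⇒> x≰a , x<y)))
  ... | no x≰a | no y≰a | tri> _ _ y<x = inj₁ (inj₂ (inj₁ (≰⇒> y≰a , y<x)))
  c-trans : ∀ a {x y z} → Cyclic a x y → Cyclic a y z → Cyclic a x z
  c-trans nothing p q = <-trans q p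
  c-trans (just a) (inj₁ (x≤a , a<y)) (inj₁ (y≤a , _)) = contradiction y≤a (<⇒≱ a<y)
  c-trans (just a) (inj₁ (x≤a , a<y)) (inj₂ (inj₁ (a<z , _))) = inj₁ (x≤a , a<z)
  c-trans (just a) (inj₁ (x≤a , a<y)) (inj₂ (inj₂ (_ , y≤a))) = contradiction y≤a (<⇒≱ a<y)
  c-trans (just a) (inj₂ (inj₁ (a<y , y<x))) (inj₁ (y≤a , _)) = contradiction y≤a (<⇒≱ a<y)
  c-trans (just a) (inj₂ (inj₁ (a<y , y<x))) (inj₂ (inj₁ (a<z , z<y))) = inj₂ (inj₁ (a<z , <-trans z<y y<x))
  c-trans (just a) (inj₂ (inj₁ (a<y , y<x))) (inj₂ (inj₂ (_ , y≤a))) = contradiction y≤a (<⇒≱ a<y)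
  c-trans (just a) (inj₂ (inj₂ (y<x , x≤a))) (inj₁ (_ , a<z)) = inj₁ (x≤a , a<z)
  c-trans (just a) (inj₂ (inj₂ (y<x , x≤a))) (inj₂ (inj₁ (a<z , z<y))) = contradiction (<-trans z<y y<x) (<⇒≱ (s≤s (≤-trans x≤a (<⇒≤ a<z))))
  c-trans (just a) (inj₂ (inj₂ (y<x , x≤a))) (inj₂ (inj₂ (z<y , _))) = inj₂ (inj₂ (<-trans z<y y<x , x≤a))

ascending : Orders
ascending = record { O = λ _ → _<_ ; O? = λ _ → _<?_ ; asym = λ _ → <-asym ; conn = λ _ → a-conn ; O-trans = λ _ → <-trans }
  where
  a-conn : ∀ {x y} → x ≢ y → x < y ⊎ y < x
  a-conn {x} {y} ne with <-cmp x y
  ... | tri< x<y _ _ = inj₁ x<y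
  ... | tri≈ _ eq _  = contradiction eq ne
  ... | tri> _ _ y<x = inj₂ y<x

module Descents {n lo hi} (D : Diagram n lo hi) (lo≤hi : ∀ j → lo j ≤ hi j)
                (lo-desc : ∀ j → lo (suc j) ≤ lo j) (hi-desc : ∀ j → hi (suc j) ≤ hi j)
                (gap : ∀ j → hi (2 + j) ≤ lo j) (N : ℕ) where
  open Values D
  open Fillings D lo≤hi hi-desc cyclic {N} Fin.opposite Finₚ.opposite-involutive public

  descent? : (F : ℕ → ℕ → ℕ) (j r : ℕ) → Dec (lo j < r × r ≤ hi (suc j) × F j r < F (suc j) r)
  descent? F j r = (lo j <? r) ×-dec (r ≤? hi (suc j)) ×-dec (F j r <? F (suc j) r)

  descentsAt : (ℕ → ℕ → ℕ) → ℕ → ℕ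
  descentsAt F zero    = 0
  descentsAt F (suc j) = ∑[ r ∈ rowsOf (suc j) ] ⟦ descent? F j r ⟧

  Above : (ℕ → ℕ → ℕ) → ℕ → ℕ → ℕ → Set
  Above F j v r = r ≤ lo j ⊎ ((lo j < r × r ≤ hi j) × v < F j r)

  above? : ∀ F j v r → Dec (Above F j v r)
  above? F j v r = (r ≤? lo j) ⊎-dec (((lo j <? r) ×-dec (r ≤? hi j)) ×-dec (v <? F j r))

  module _ {F} (valid : Valid F) (let′ : Lettered F) where

    -- Position `i` carries the letter N - i, so the first N - v positions are the letters greater
    -- than `v`.
    pre-column : ∀ {j} → j < n → ∀ {v} → v ≤ N →
      pre (N ∸ v) (columnOf F j) ≡ ∑[ r ∈ rowsOf j ] ⟦ v <? F j r ⟧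
    pre-column {j} j<n {v} v≤N = begin
      pre (N ∸ v) (columnOf F j)
        ≡⟨ pre-∑ (N ∸ v) (columnOf F j) ⟩
      ∑[ i ∈ allFin N ] bit (lookup (columnOf F j) i) * ⟦ toℕ i <? N ∸ v ⟧
        ≡⟨ ∑-letters valid let′ j<n (λ i → ⟦ toℕ i <? N ∸ v ⟧) (λ r → ⟦ v <? F j r ⟧) (λ i r _ eq → same i r eq) ⟩
      ∑[ r ∈ rowsOf j ] ⟦ v <? F j r ⟧ ∎
      where
      open ≡-Reasoning
      letter-∸ : ∀ i → letter i ≡ N ∸ toℕ i
      letter-∸ i = trans (cong suc (Finₚ.opposite-prop i)) (suc-∸ (Finₚ.toℕ<n i))
        where
        suc-∸ : ∀ {m n} → m < n → suc (n ∸ suc m) ≡ n ∸ m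
        suc-∸ {m} {suc n} (s≤s m≤n) = sym (+-∸-assoc 1 m≤n)
      same : ∀ i r → F j r ≡ letter i → ⟦ toℕ i <? N ∸ v ⟧ ≡ ⟦ v <? F j r ⟧
      same i r eq rewrite eq | letter-∸ i = ⟦⟧-⇔ (toℕ i <? N ∸ v) (v <? N ∸ toℕ i) to from
        where
        to : toℕ i < N ∸ v → v < N ∸ toℕ i
        to lt = m+n≤o⇒m≤o∸n (suc v) (subst (_≤ N) (trans (+-comm (suc (toℕ i)) v) (+-suc v (toℕ i)))
          (≤-trans (+-monoˡ-≤ v lt) (≤-reflexive (m∸n+n≡m v≤N))))
        from : v < N ∸ toℕ i → toℕ i < N ∸ v
        from lt = m+n≤o⇒m≤o∸n (suc (toℕ i)) (subst (_≤ N) (trans (+-comm (suc v) (toℕ i)) (+-suc (toℕ i) v))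
          (≤-trans (+-monoˡ-≤ (toℕ i) lt) (≤-reflexive (m∸n+n≡m (<⇒≤ (Finₚ.toℕ<n i))))))

    -- The rows up to lo j are thought to hold ∞.
    height : ∀ {j} → j < n → ∀ {H} → hi j ≤ H → ∀ {v} → v ≤ N →
      pre (N ∸ v) (columnOf F j) + lo j ≡ ∑[ r ∈ range 0 H ] ⟦ above? F j v r ⟧
    height {j} j<n {H} hi≤H {v} v≤N = begin
      pre (N ∸ v) (columnOf F j) + lo j
        ≡⟨ cong₂ _+_ (trans (pre-column j<n v≤N) (∑-restrict hi≤H (λ r → ⟦ v <? F j r ⟧)))
             (sym (∑-initial (≤-trans (lo≤hi j) hi≤H))) ⟩
      (∑[ r ∈ range 0 H ] ⟦ inside r ⟧ * ⟦ v <? F j r ⟧) + (∑[ r ∈ range 0 H ] ⟦ r ≤? lo j ⟧)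
        ≡⟨ sym (∑-+ (range 0 H) (λ r → ⟦ inside r ⟧ * ⟦ v <? F j r ⟧) (λ r → ⟦ r ≤? lo j ⟧)) ⟩
      ∑[ r ∈ range 0 H ] (⟦ inside r ⟧ * ⟦ v <? F j r ⟧ + ⟦ r ≤? lo j ⟧)
        ≡⟨ ∑-cong (range 0 H) pointwise ⟩
      ∑[ r ∈ range 0 H ] ⟦ above? F j v r ⟧ ∎
      where
      open ≡-Reasoning
      inside : ∀ r → Dec (lo j < r × r ≤ hi j)
      inside r = (lo j <? r) ×-dec (r ≤? hi j)
      pointwise : ∀ r → ⟦ inside r ⟧ * ⟦ v <? F j r ⟧ + ⟦ r ≤? lo j ⟧ ≡ ⟦ above? F j v r ⟧
      pointwise r = trans (cong (_+ ⟦ r ≤? lo j ⟧) (sym (⟦⟧-× (inside r) (v <? F j r)))) (≤-antisym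
        (⟦⟧-⊎ (inside r ×-dec (v <? F j r)) (r ≤? lo j) (above? F j v r) inj₂ inj₁ (λ i le → <⇒≱ (proj₁ (proj₁ i)) le))
        (⟦⟧-∪ (inside r ×-dec (v <? F j r)) (r ≤? lo j) (above? F j v r) (λ { (inj₁ a) → inj₂ a ; (inj₂ b) → inj₁ b })))

    -- A row `r` that reaches column `j + 1` has no box in column `j - 1`, by the gap. So the left
    -- neighbour of its box in column `j` carries ∞, and every later entry of that column is
    -- smaller.
    descending : ∀ {j r r′} → j < n → lo j < r → r < r′ → r′ ≤ hi j → r ≤ hi (suc j) → F j r′ < F j r
    descending {zero}  {r} {r′} j<n lo<r r<r′ r′≤ _  = valid zero j<n r r′ lo<r r<r′ r′≤
    descending {suc j} {r} {r′} j<n lo<r r<r′ r′≤ r≤ = subst (λ a → Cyclic a (F (suc j) r) (F (suc j) r′))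
      (decide-no (lo j <? r) (≤⇒≯ (≤-trans r≤ (gap j)))) (valid (suc j) j<n r r′ lo<r r<r′ r′≤)

    outer-descending : ∀ {j r r′} → suc j < n → lo (suc j) < r → r ≤ lo j → r < r′ → r′ ≤ hi (suc j) → F (suc j) r′ < F (suc j) r
    outer-descending {j} {r} {r′} j<n lo<r r≤ r<r′ r′≤ = subst (λ a → Cyclic a (F (suc j) r) (F (suc j) r′))
      (decide-no (lo j <? r) (≤⇒≯ r≤)) (valid (suc j) j<n r r′ lo<r r<r′ r′≤)

    triple : ∀ {j r r′} → suc j < n → lo j < r → r < r′ → r′ ≤ hi (suc j) → Cyclic (just (F j r)) (F (suc j) r) (F (suc j) r′)
    triple {j} {r} {r′} j<n lo<r r<r′ r′≤ = subst (λ a → Cyclic a (F (suc j) r) (F (suc j) r′))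
      (decide-yes (lo j <? r) lo<r) (valid (suc j) j<n r r′ (≤-<-trans (lo-desc j) lo<r) r<r′ r′≤)

    module _ {j} (j<n : suc j < n) where

      private
        H : ℕ
        H = hi j
        j′<n : j < n
        j′<n = <-trans ≤-refl j<n
        Desc : ℕ → Set
        Desc r = lo j < r × r ≤ hi (suc j) × F j r < F (suc j) r

      descents-universal : descentsAt F (suc j) ≡ ∑[ r ∈ range 0 H ] ⟦ descent? F j r ⟧
      descents-universal = trans (∑-restrict (hi-desc j) (λ r → ⟦ descent? F j r ⟧)) (∑-cong (range 0 H) (λ r →
        trans (sym (⟦⟧-× ((lo (suc j) <? r) ×-dec (r ≤? hi (suc j))) (descent? F j r)))
          (⟦⟧-⇔ (((lo (suc j) <? r) ×-dec (r ≤? hi (suc j))) ×-dec descent? F j r) (descent? F j r) proj₂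
            (λ d → (≤-<-trans (lo-desc j) (proj₁ d) , proj₁ (proj₂ d)) , d))))

      above-∪ : ∀ {v r} → Above F (suc j) v r → Desc r ⊎ Above F j v r
      above-∪ (inj₁ r≤) = inj₂ (inj₁ (≤-trans r≤ (lo-desc j)))
      above-∪ {v} {r} (inj₂ ((_ , r≤) , v<)) with r ≤? lo j | F j r <? F (suc j) r
      ... | yes r≤lo | _     = inj₂ (inj₁ r≤lo)
      ... | no r≰lo | yes d  = inj₁ (≰⇒> r≰lo , r≤ , d)
      ... | no r≰lo | no ¬d  = inj₂ (inj₂ ((≰⇒> r≰lo , ≤-trans r≤ (hi-desc j)) , <-≤-trans v< (≮⇒≥ ¬d)))

      -- For each `v`, a row counted in the height of column `suc j` is either a descent or counted
      -- in the height of column `j`, because a left neighbour that gives no descent is at least as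
      -- large.
      e-≤-descents : e (lo j) (lo (suc j)) (columnOf F j) (columnOf F (suc j)) ≤ descentsAt F (suc j)
      e-≤-descents = e-lub (lo j) (lo (suc j)) (columnOf F j) (columnOf F (suc j)) _ (λ t t≤N →
        subst (λ t → pre t (columnOf F (suc j)) + lo (suc j) ≤ descentsAt F (suc j) + (pre t (columnOf F j) + lo j))
          (m∸[m∸n]≡n t≤N) (bound (m∸n≤m N t)))
        where
        open ≤-Reasoning
        bound : ∀ {v} → v ≤ N → pre (N ∸ v) (columnOf F (suc j)) + lo (suc j)
                              ≤ descentsAt F (suc j) + (pre (N ∸ v) (columnOf F j) + lo j)
        bound {v} v≤N = begin
          pre (N ∸ v) (columnOf F (suc j)) + lo (suc j)
            ≡⟨ height j<n (hi-desc j) v≤N ⟩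
          ∑[ r ∈ range 0 H ] ⟦ above? F (suc j) v r ⟧
            ≤⟨ ∑-mono (range 0 H) (λ {r} _ → ⟦⟧-∪ (descent? F j r) (above? F j v r) (above? F (suc j) v r) above-∪) ⟩
          ∑[ r ∈ range 0 H ] (⟦ descent? F j r ⟧ + ⟦ above? F j v r ⟧)
            ≡⟨ ∑-+ (range 0 H) (λ r → ⟦ descent? F j r ⟧) (λ r → ⟦ above? F j v r ⟧) ⟩
          (∑[ r ∈ range 0 H ] ⟦ descent? F j r ⟧) + (∑[ r ∈ range 0 H ] ⟦ above? F j v r ⟧)
            ≡⟨ sym (cong₂ _+_ descents-universal (height j′<n ≤-refl v≤N)) ⟩
          descentsAt F (suc j) + (pre (N ∸ v) (columnOf F j) + lo j) ∎

      -- The maximum is attained just below the smallest entry v + 1 at a descent.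
      descents-≤-e : descentsAt F (suc j) ≤ e (lo j) (lo (suc j)) (columnOf F j) (columnOf F (suc j))
      descents-≤-e with argmin (descent? F j) (F (suc j)) (range 0 H)
      ... | inj₁ none = ≤-trans (≤-reflexive (trans descents-universal
              (∑-zero (range 0 H) (λ {r} r∈ → ⟦⟧-no (descent? F j r) (none r∈))))) z≤n
      ... | inj₂ (s , ds@(lo<s , s≤ , as<bs) , min) with let′ (suc j) j<n s (≤-<-trans (lo-desc j) lo<s) s≤
      ... | i , bs≡i = e-at (lo j) (lo (suc j)) (columnOf F j) (columnOf F (suc j)) (N ∸ v) _ (begin
          descentsAt F (suc j) + (pre (N ∸ v) (columnOf F j) + lo j)
            ≡⟨ cong₂ _+_ descents-universal (height j′<n ≤-refl v≤N) ⟩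
          (∑[ r ∈ range 0 H ] ⟦ descent? F j r ⟧) + (∑[ r ∈ range 0 H ] ⟦ above? F j v r ⟧)
            ≡⟨ sym (∑-+ (range 0 H) (λ r → ⟦ descent? F j r ⟧) (λ r → ⟦ above? F j v r ⟧)) ⟩
          ∑[ r ∈ range 0 H ] (⟦ descent? F j r ⟧ + ⟦ above? F j v r ⟧)
            ≤⟨ ∑-mono (range 0 H) (λ {r} _ → ⟦⟧-⊎ (descent? F j r) (above? F j v r) (above? F (suc j) v r)
                 (λ d → inj₂ ((≤-<-trans (lo-desc j) (proj₁ d) , proj₁ (proj₂ d)) , above-min d)) (above-above r) (disjoint r)) ⟩
          ∑[ r ∈ range 0 H ] ⟦ above? F (suc j) v r ⟧
            ≡⟨ sym (height j<n (hi-desc j) v≤N) ⟩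
          pre (N ∸ v) (columnOf F (suc j)) + lo (suc j) ∎)
        where
        open ≤-Reasoning
        v : ℕ
        v = toℕ (Fin.opposite i)
        v≤N : v ≤ N
        v≤N = <⇒≤ (Finₚ.toℕ<n (Fin.opposite i))
        as≤v : F j s ≤ v
        as≤v = m<1+n⇒m≤n (subst (F j s <_) bs≡i as<bs)
        above-min : ∀ {r} → Desc r → v < F (suc j) r
        above-min {r} d@(lo<r , r≤ , _) = subst (_≤ F (suc j) r) bs≡i
          (min (∈-range⁺ (≤-<-trans z≤n lo<r) (≤-trans r≤ (hi-desc j))) d)
        after : ∀ {r} → s < r → r ≤ hi j → F j r < F j s
        after s<r r≤ = descending j′<n lo<s s<r r≤ s≤
        -- A descent in row `r` has `F j r ≤ v`. For rows after `s` this holds because column `j`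
        -- decreases from `s` on. For rows before `s` the descent leaves only the triple in which
        -- `F j r` is less than the entry `v + 1` in row `s` of column `suc j`.
        disjoint : ∀ r → Desc r → ¬ Above F j v r
        disjoint r (lo<r , _) (inj₁ r≤) = <⇒≱ lo<r r≤
        disjoint r (lo<r , r≤ , d) (inj₂ (_ , v<ar)) with <-cmp r s
        ... | tri≈ _ refl _ = <⇒≱ v<ar as≤v
        ... | tri> _ _ s<r  = <⇒≱ v<ar (≤-trans (<⇒≤ (after s<r (≤-trans r≤ (hi-desc j)))) as≤v)
        ... | tri< r<s _ _ with triple j<n lo<r r<s s≤
        ... | inj₁ (b≤a , _)        = <⇒≱ d b≤a
        ... | inj₂ (inj₁ (a<bs , _)) = <⇒≱ v<ar (m<1+n⇒m≤n (subst (F j r <_) bs≡i a<bs))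
        ... | inj₂ (inj₂ (_ , b≤a)) = <⇒≱ d b≤a
        -- The case of substance is a row `r` before `s` without descent. As `F j r` is at least
        -- `v + 1`, the triple forces the entry of column `suc j` in row `r` to exceed that in row
        -- `s`, which is `v + 1`.
        above-above : ∀ r → Above F j v r → Above F (suc j) v r
        above-above r (inj₁ r≤lo) with r ≤? lo (suc j)
        ... | yes r≤ = inj₁ r≤
        ... | no r≰  = inj₂ ((≰⇒> r≰ , ≤-trans (≤-trans r≤lo (<⇒≤ lo<s)) s≤)
            , <-trans ≤-refl (subst (_< F (suc j) r) bs≡i (outer-descending j<n (≰⇒> r≰) r≤lo (≤-<-trans r≤lo lo<s) s≤)))
        above-above r (inj₂ ((lo<r , r≤) , v<ar)) with r ≤? hi (suc j)
        ... | no r≰ = contradiction v<ar (≤⇒≯ (≤-trans (<⇒≤ (after (≤-<-trans s≤ (≰⇒> r≰)) r≤)) as≤v))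
        ... | yes r≤hi with F j r <? F (suc j) r
        ... | yes d = inj₂ ((≤-<-trans (lo-desc j) lo<r , r≤hi) , above-min (lo<r , r≤hi , d))
        ... | no ¬d with <-cmp r s
        ... | tri≈ _ refl _ = contradiction as<bs ¬d
        ... | tri> _ _ s<r = contradiction v<ar (≤⇒≯ (≤-trans (<⇒≤ (after s<r r≤)) as≤v))
        ... | tri< r<s _ _ with triple j<n lo<r r<s s≤
        ... | inj₁ (_ , a<bs)          = contradiction (subst (F j r <_) bs≡i a<bs) (≤⇒≯ v<ar)
        ... | inj₂ (inj₁ (a<bs , _))   = contradiction (subst (F j r <_) bs≡i a<bs) (≤⇒≯ v<ar)
        ... | inj₂ (inj₂ (bs<br , _))  = inj₂ ((≤-<-trans (lo-desc j) lo<r , r≤hi) , <-trans ≤-refl (subst (_< F (suc j) r) bs≡i bs<br))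

    descents-stat : ∑[ j ∈ allFin n ] descentsAt F (toℕ j) ≡ stat e los (matrix F)
    descents-stat = trans (∑-cong (allFin n) (λ j → edgewise (toℕ j) (Finₚ.toℕ<n j)))
      (sym (stat-∑ n e lo (columnOf F)))
      where
      edgewise : ∀ j → j < n → descentsAt F j ≡ edgeAt e lo (columnOf F) j
      edgewise zero    _   = refl
      edgewise (suc j) j<n = ≤-antisym (descents-≤-e j<n) (e-≤-descents j<n)

-- Inversions

ℓ-∑ : ∀ {N} x y (A B : Vec Bool N) →
  ℓ x y A B ≡ ∑[ i ∈ allFin N ] bit (lookup A i) * tr (pre (toℕ i) A + x) (pre (toℕ i) B + y) true (lookup B i)
ℓ-∑ x y []      []      = refl
ℓ-∑ {suc N} x y (a ∷ A) (b ∷ B) = trans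
  (cong₂ _+_ (tr-bit x y a b) (trans (ℓ-∑ (bit a + x) (bit b + y) A B) (∑-cong (allFin N) (λ i →
    cong₂ (λ u v → bit (lookup A i) * tr u v true (lookup B i)) (sym (pre-step a A x (toℕ i))) (sym (pre-step b B y (toℕ i)))))))
  (sym (∑-allFin-suc N (λ i → bit (lookup (a ∷ A) i) *
    tr (pre (toℕ i) (a ∷ A) + x) (pre (toℕ i) (b ∷ B) + y) true (lookup (b ∷ B) i))))
  where
  tr-bit : ∀ x y a b → tr x y a b ≡ bit a * tr x y true b
  tr-bit x y true  b = sym (+-identityʳ _)
  tr-bit x y false b = refl

∑-allFin-last : ∀ n (g : ℕ → ℕ) → ∑[ j ∈ allFin (suc n) ] g (toℕ j) ≡ (∑[ j ∈ allFin n ] g (toℕ j)) + g n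
∑-allFin-last zero    g = +-identityʳ _
∑-allFin-last (suc n) g = trans (∑-allFin-suc (suc n) (λ j → g (toℕ j)))
  (trans (cong (λ t → g 0 + t) (∑-allFin-last n (g ∘ suc)))
    (trans (sym (+-assoc (g 0) _ (g (suc n)))) (cong (_+ g (suc n)) (sym (∑-allFin-suc n (λ j → g (toℕ j)))))))

module _ {P : ℕ → Set} (P? : ∀ r → Dec (P r)) (H : ℕ) (P⇒≤ : ∀ {r} → P r → r ≤ H)
         (down : ∀ {r r′} → 0 < r′ → r′ < r → P r → P r′) where

  private
    y : ℕ
    y = ∑[ r ∈ range 0 H ] ⟦ P? r ⟧

  -- A downward closed set of positive rows is the interval from 1 to its cardinality `y`. With
  -- `initial⁻` this turns heights, which are counts, into comparisons of entries.
  initial⁺ : ∀ {r} → P r → r ≤ y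
  initial⁺ {r} p = subst (_≤ y) (∑-initial (P⇒≤ p)) (∑-mono (range 0 H) (λ {r′} r′∈ → below r′ r′∈))
    where
    below : ∀ r′ → r′ ∈ range 0 H → ⟦ r′ ≤? r ⟧ ≤ ⟦ P? r′ ⟧
    below r′ r′∈ with ⟦⟧-dec (r′ ≤? r)
    ... | inj₂ (_ , eq) = subst (_≤ ⟦ P? r′ ⟧) (sym eq) z≤n
    ... | inj₁ (r′≤r , eq) = ≤-reflexive (trans eq (sym (⟦⟧-yes (P? r′) holds)))
      where
      holds : P r′
      holds with m≤n⇒m<n∨m≡n r′≤r
      ... | inj₁ lt   = down (proj₁ (∈-range⁻ r′∈)) lt p
      ... | inj₂ refl = p

  initial⁻ : ∀ {r} → 0 < r → r ≤ y → P r
  initial⁻ {suc r} _ r<y with P? (suc r)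
  ... | yes p = p
  ... | no ¬p with r ≤? H
  ... | no r≰H = contradiction (≤-trans r<y y≤H) (λ h → r≰H (<⇒≤ h))
    where
    y≤H : y ≤ H
    y≤H = subst (y ≤_) (∑-const-1 suc H) (∑-mono (range 0 H) (λ {r} _ → ⟦⟧≤1 (P? r)))
  ... | yes r≤H = contradiction r<y (≤⇒≯ (subst (y ≤_) (∑-initial r≤H) (∑-mono (range 0 H) (λ {r′} r′∈ → above r′ r′∈))))
    where
    above : ∀ r′ → r′ ∈ range 0 H → ⟦ P? r′ ⟧ ≤ ⟦ r′ ≤? r ⟧
    above r′ r′∈ with ⟦⟧-dec (P? r′)
    ... | inj₂ (_ , eq) = subst (_≤ ⟦ r′ ≤? r ⟧) (sym eq) z≤n
    ... | inj₁ (p , eq) = ≤-reflexive (trans eq (sym (⟦⟧-yes (r′ ≤? r) bounded)))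
      where
      bounded : r′ ≤ r
      bounded with <-cmp r′ (suc r)
      ... | tri< lt _ _  = m<1+n⇒m≤n lt
      ... | tri≈ _ refl _ = contradiction p ¬p
      ... | tri> _ _ gt  = contradiction (down (s≤s z≤n) gt p) ¬p

module Passages {n lo hi} (D : Diagram n lo hi) (lo≤hi : ∀ j → lo j ≤ hi j)
                (lo-desc : ∀ j → lo (suc j) ≤ lo j) (hi-desc : ∀ j → hi (suc j) ≤ hi j)
                (gap : ∀ j → hi (2 + j) ≤ lo j) (hi-end : ∀ j → n ≤ j → hi j ≡ 0) (N : ℕ) where
  open Diagram D
  open Values D
  open Fillings D lo≤hi hi-desc ascending {N} id (λ _ → refl) public

  -- When the letter `F j r` is scanned, column `j` rises from r - 1 to r. The inequalities say that
  -- column `suc j` has then reached row `r` exactly and does not take the letter, so the excess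
  -- falls from 1 to 0.
  Passage : (ℕ → ℕ → ℕ) → ℕ → ℕ → Set
  Passage F j r = (r ≤ hi (suc j) × F (suc j) r < F j r) × (suc r ≤ hi (suc j) → F j r < F (suc j) (suc r))

  passage? : ∀ F j r → Dec (Passage F j r)
  passage? F j r = ((r ≤? hi (suc j)) ×-dec (F (suc j) r <? F j r)) ×-dec
    ((suc r ≤? hi (suc j)) →-dec (F j r <? F (suc j) (suc r)))

  passagesAt : (ℕ → ℕ → ℕ) → ℕ → ℕ
  passagesAt F j = ∑[ r ∈ rowsOf j ] ⟦ passage? F j r ⟧

  Below : (ℕ → ℕ → ℕ) → ℕ → ℕ → ℕ → Set
  Below F j v r = r ≤ lo j ⊎ (r ≤ hi j × F j r < v)

  below? : ∀ F j v r → Dec (Below F j v r)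
  below? F j v r = (r ≤? lo j) ⊎-dec ((r ≤? hi j) ×-dec (F j r <? v))

  module _ {F} (valid : Valid F) (let′ : Lettered F) where

    below-down : ∀ {j} → j < n → ∀ {v r r′} → 0 < r′ → r′ < r → Below F j v r → Below F j v r′
    below-down j<n _ r′<r (inj₁ r≤) = inj₁ (≤-trans (<⇒≤ r′<r) r≤)
    below-down {j} j<n {r = r} {r′} _ r′<r (inj₂ (r≤ , Fr<v)) with r′ ≤? lo j
    ... | yes r′≤ = inj₁ r′≤
    ... | no r′≰  = inj₂ (≤-trans (<⇒≤ r′<r) r≤ , <-trans (valid j j<n r′ r (≰⇒> r′≰) r′<r r≤) Fr<v)

    below-≤ : ∀ {j v r} → Below F j v r → r ≤ hi j
    below-≤ {j} (inj₁ r≤)      = ≤-trans r≤ (lo≤hi j)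
    below-≤     (inj₂ (r≤ , _)) = r≤

    depth : ∀ {j} → j < n → ∀ i → pre (toℕ i) (columnOf F j) + lo j ≡ ∑[ r ∈ range 0 (hi j) ] ⟦ below? F j (letter i) r ⟧
    depth {j} j<n i = begin
      pre (toℕ i) (columnOf F j) + lo j
        ≡⟨ cong₂ _+_ (pre-∑ (toℕ i) (columnOf F j)) (sym (∑-initial (lo≤hi j))) ⟩
      (∑[ k ∈ allFin N ] bit (lookup (columnOf F j) k) * ⟦ toℕ k <? toℕ i ⟧) + (∑[ r ∈ range 0 (hi j) ] ⟦ r ≤? lo j ⟧)
        ≡⟨ cong (_+ (∑[ r ∈ range 0 (hi j) ] ⟦ r ≤? lo j ⟧)) 
           (trans (∑-letters valid let′ j<n (λ k → ⟦ toℕ k <? toℕ i ⟧) (λ r → ⟦ F j r <? letter i ⟧) same)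
                  (∑-restrict {lo j} {hi j} ≤-refl (λ r → ⟦ F j r <? letter i ⟧))) ⟩
      (∑[ r ∈ range 0 (hi j) ] ⟦ inside r ⟧ * ⟦ F j r <? letter i ⟧) + (∑[ r ∈ range 0 (hi j) ] ⟦ r ≤? lo j ⟧)
        ≡⟨ sym (∑-+ (range 0 (hi j)) (λ r → ⟦ inside r ⟧ * ⟦ F j r <? letter i ⟧) (λ r → ⟦ r ≤? lo j ⟧)) ⟩
      ∑[ r ∈ range 0 (hi j) ] (⟦ inside r ⟧ * ⟦ F j r <? letter i ⟧ + ⟦ r ≤? lo j ⟧)
        ≡⟨ ∑-cong (range 0 (hi j)) pointwise ⟩
      ∑[ r ∈ range 0 (hi j) ] ⟦ below? F j (letter i) r ⟧ ∎
      where
      open ≡-Reasoning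
      inside : ∀ r → Dec (lo j < r × r ≤ hi j)
      inside r = (lo j <? r) ×-dec (r ≤? hi j)
      same : ∀ k r → r ∈ rowsOf j → F j r ≡ letter k → ⟦ toℕ k <? toℕ i ⟧ ≡ ⟦ F j r <? letter i ⟧
      same k r _ eq rewrite eq = ⟦⟧-⇔ (toℕ k <? toℕ i) (letter k <? letter i) s≤s (λ { (s≤s h) → h })
      pointwise : ∀ r → ⟦ inside r ⟧ * ⟦ F j r <? letter i ⟧ + ⟦ r ≤? lo j ⟧ ≡ ⟦ below? F j (letter i) r ⟧
      pointwise r = trans (cong (_+ ⟦ r ≤? lo j ⟧) (sym (⟦⟧-× (inside r) (F j r <? letter i)))) (≤-antisym
        (⟦⟧-⊎ (inside r ×-dec (F j r <? letter i)) (r ≤? lo j) (below? F j (letter i) r)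
          (λ { ((_ , a) , b) → inj₂ (a , b) }) inj₁ (λ p le → <⇒≱ (proj₁ (proj₁ p)) le))
        (⟦⟧-∪ (inside r ×-dec (F j r <? letter i)) (r ≤? lo j) (below? F j (letter i) r) cover))
        where
        cover : Below F j (letter i) r → ((lo j < r × r ≤ hi j) × F j r < letter i) ⊎ r ≤ lo j
        cover (inj₁ a) = inj₂ a
        cover (inj₂ (a , b)) with r ≤? lo j
        ... | yes r≤ = inj₂ r≤
        ... | no r≰  = inj₁ ((≰⇒> r≰ , a) , b)

    module _ {j} (j<n : suc j < n) where
      private
        j′<n : j < n
        j′<n = <-trans ≤-refl j<n

      x-at y-at : Fin N → ℕ
      x-at i = pre (toℕ i) (columnOf F j) + lo j
      y-at i = pre (toℕ i) (columnOf F (suc j)) + lo (suc j)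

      module _ (i : Fin N) (r : ℕ) (lo<r : lo j < r) (r≤ : r ≤ hi j) (Fr≡i : F j r ≡ letter i) where

        private
          0<r : 0 < r
          0<r = ≤-<-trans z≤n lo<r

          not-below : ¬ Below F j (letter i) r
          not-below (inj₁ r≤lo)     = <⇒≱ lo<r r≤lo
          not-below (inj₂ (_ , lt)) = <-irrefl Fr≡i lt

          below-pred : ∀ {p} → suc p ≡ r → 0 < p → Below F j (letter i) p
          below-pred {p} refl _ with p ≤? lo j
          ... | yes p≤ = inj₁ p≤
          ... | no p≰  = inj₂ (<⇒≤ r≤ , subst (F j p <_) Fr≡i (valid j j′<n p (suc p) (≰⇒> p≰) ≤-refl r≤))

        x-eq : suc (x-at i) ≡ r
        x-eq = trans (cong suc (depth j′<n i)) (≤-antisym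
          (≰⇒> (λ r≤x → not-below (initial⁻ (below? F j (letter i)) (hi j) below-≤ (below-down j′<n) 0<r r≤x)))
          (reach r 0<r refl))
          where
          reach : ∀ p → 0 < p → p ≡ r → p ≤ suc (∑[ r ∈ range 0 (hi j) ] ⟦ below? F j (letter i) r ⟧)
          reach (suc zero)    _ _  = s≤s z≤n
          reach (suc (suc p)) _ eq = s≤s (initial⁺ (below? F j (letter i)) (hi j) below-≤ (below-down j′<n) (below-pred eq (s≤s z≤n)))

        y-≥ : ∀ {p} → 0 < p → (p ≤ y-at i → Below F (suc j) (letter i) p) × (Below F (suc j) (letter i) p → p ≤ y-at i)
        y-≥ {p} 0<p rewrite depth j<n i =
          initial⁻ (below? F (suc j) (letter i)) (hi (suc j)) below-≤ (below-down j<n) 0<p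
          , initial⁺ (below? F (suc j) (letter i)) (hi (suc j)) below-≤ (below-down j<n)

        -- If the letter also occurs in column `suc j`, there is no passage on either side: its row
        -- would have to lie strictly between `r` and `suc r` in an increasing column. If it does
        -- not occur, a height of exactly `r` means that row `r` holds a smaller entry and row
        -- `suc r`, if present, a larger one.
        tr-passage : tr (x-at i) (y-at i) true (lookup (columnOf F (suc j)) i) ≡ ⟦ passage? F j r ⟧
        tr-passage = trans (cong (tr (x-at i) (y-at i) true)
            (Vecₚ.lookup∘tabulate (λ i → does (occurs? F (suc j) (letter i))) i)) (by-occurrence (occurs? F (suc j) (letter i)))
          where
          b : ℕ → ℕ
          b = F (suc j)
          by-occurrence : (d : Dec (Any (λ r → b r ≡ letter i) (rowsOf (suc j)))) →
            tr (x-at i) (y-at i) true (does d) ≡ ⟦ passage? F j r ⟧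
          by-occurrence (yes a) with find a
          ... | s , s∈ , bs≡i = sym (⟦⟧-no (passage? F j r) none)
            where
            none : ¬ Passage F j r
            none ((r≤′ , br<) , next) with <-cmp s r
            ... | tri< s<r _ _ = <-asym (subst (b r <_) Fr≡i br<)
                  (subst (_< b r) bs≡i (valid (suc j) j<n s r (proj₁ (∈-range⁻ s∈)) s<r r≤′))
            ... | tri≈ _ refl _ = <-irrefl (trans bs≡i (sym Fr≡i)) br<
            ... | tri> _ _ r<s with m≤n⇒m<n∨m≡n r<s
            ... | inj₂ refl = <-irrefl (trans Fr≡i (sym bs≡i)) (next (proj₂ (∈-range⁻ s∈)))
            ... | inj₁ sr<s = <-asym (subst (_< b (suc r)) Fr≡i (next (≤-trans r<s (proj₂ (∈-range⁻ s∈)))))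
                  (subst (b (suc r) <_) bs≡i (valid (suc j) j<n (suc r) s (≤-<-trans (lo-desc j) (<-trans lo<r ≤-refl)) sr<s (proj₂ (∈-range⁻ s∈))))
          by-occurrence (no ¬a) = ⟦⟧-⇔ (y-at i ≟ suc (x-at i)) (passage? F j r) to from
            where
            to : y-at i ≡ suc (x-at i) → Passage F j r
            to eq with proj₁ (y-≥ 0<r) (≤-reflexive (sym (trans eq x-eq)))
            ... | inj₁ r≤lo = contradiction (≤-trans r≤lo (lo-desc j)) (<⇒≱ lo<r)
            ... | inj₂ (r≤′ , br<) = (r≤′ , subst (b r <_) (sym Fr≡i) br<) , next
              where
              next : suc r ≤ hi (suc j) → F j r < b (suc r)
              next sr≤ with <-cmp (letter i) (b (suc r))
              ... | tri< lt _ _ = subst (_< b (suc r)) (sym Fr≡i) lt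
              ... | tri≈ _ eq′ _ = contradiction (lose (∈-range⁺ (≤-<-trans (lo-desc j) (<-trans lo<r ≤-refl)) sr≤) (sym eq′)) ¬a
              ... | tri> _ _ gt = contradiction (proj₂ (y-≥ (s≤s z≤n)) (inj₂ (sr≤ , gt))) (<⇒≱ (s≤s (≤-reflexive (trans eq x-eq))))
            from : Passage F j r → y-at i ≡ suc (x-at i)
            from ((r≤′ , br<) , next) = trans (≤-antisym
              (m<1+n⇒m≤n (≰⇒> (λ sr≤y → not-next (proj₁ (y-≥ (s≤s z≤n)) sr≤y))))
              (proj₂ (y-≥ 0<r) (inj₂ (r≤′ , subst (b r <_) Fr≡i br<)))) (sym x-eq)
              where
              not-next : ¬ Below F (suc j) (letter i) (suc r)
              not-next (inj₁ sr≤lo) = <⇒≱ lo<r (≤-trans (<⇒≤ sr≤lo) (lo-desc j))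
              not-next (inj₂ (sr≤ , lt)) = <-asym lt (subst (_< b (suc r)) Fr≡i (next sr≤))

      ℓ-passages : ℓ (lo j) (lo (suc j)) (columnOf F j) (columnOf F (suc j)) ≡ passagesAt F j
      ℓ-passages = begin
        ℓ (lo j) (lo (suc j)) (columnOf F j) (columnOf F (suc j))
          ≡⟨ ℓ-∑ (lo j) (lo (suc j)) (columnOf F j) (columnOf F (suc j)) ⟩
        ∑[ i ∈ allFin N ] bit (lookup (columnOf F j) i) * h i
          ≡⟨ ∑-letters valid let′ j′<n h (λ r → ⟦ passage? F j r ⟧)
               (λ i r r∈ eq → tr-passage i r (proj₁ (∈-range⁻ r∈)) (proj₂ (∈-range⁻ r∈)) eq) ⟩
        passagesAt F j ∎
        where
        open ≡-Reasoning
        h : Fin N → ℕ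
        h i = tr (x-at i) (y-at i) true (lookup (columnOf F (suc j)) i)

    passages-stat : ∑[ j ∈ allFin n ] passagesAt F (toℕ j) ≡ stat ℓ los (matrix F)
    -- `edgeAt` names a pair by its right column, `passagesAt` by its left one. The shift loses
    -- nothing, since the last column has no right neighbour.
    passages-stat = sym (trans (stat-∑ n ℓ lo (columnOf F)) (shift n (edgeAt ℓ lo (columnOf F)) (passagesAt F)
      refl (λ j lt → ℓ-passages lt) last))
      where
      last : ∀ j → suc j ≡ n → passagesAt F j ≡ 0
      last j eq = ∑-zero (rowsOf j) (λ {r} r∈ → ⟦⟧-no (passage? F j r) (λ { ((r≤ , _) , _) →
        <⇒≱ (≤-<-trans z≤n (proj₁ (∈-range⁻ r∈))) (subst (r ≤_) (hi-end (suc j) (≤-reflexive (sym eq))) r≤) }))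
      shift : ∀ n (f g : ℕ → ℕ) → f 0 ≡ 0 → (∀ j → suc j < n → f (suc j) ≡ g j) → (∀ j → suc j ≡ n → g j ≡ 0) →
        ∑[ j ∈ allFin n ] f (toℕ j) ≡ ∑[ j ∈ allFin n ] g (toℕ j)
      shift zero    f g z s l = refl
      shift (suc n) f g z s l = begin
        ∑[ j ∈ allFin (suc n) ] f (toℕ j)
          ≡⟨ ∑-allFin-suc n (λ j → f (toℕ j)) ⟩
        f 0 + (∑[ j ∈ allFin n ] f (suc (toℕ j)))
          ≡⟨ cong₂ _+_ z (∑-cong (allFin n) (λ j → s (toℕ j) (s≤s (Finₚ.toℕ<n j)))) ⟩
        ∑[ j ∈ allFin n ] g (toℕ j)
          ≡⟨ sym (trans (cong (λ t → (∑[ j ∈ allFin n ] g (toℕ j)) + t) (l n refl)) (+-identityʳ _)) ⟩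
        (∑[ j ∈ allFin n ] g (toℕ j)) + g n
          ≡⟨ sym (∑-allFin-last n g) ⟩
        ∑[ j ∈ allFin (suc n) ] g (toℕ j) ∎
        where open ≡-Reasoning

  -- Every pair of boxes (j , r), (suc j , suc r) forces an inversion: if it is not one itself,
  -- then (j , r), (suc j , r) is.
  forced : ℕ
  forced = ∑[ j ∈ allFin n ] ∑[ r ∈ rowsOf (toℕ j) ] ⟦ suc r ≤? hi (suc (toℕ j)) ⟧

  -- The two kinds of LLT inversions. In a vertical strip the content is 1 - row, so equal contents
  -- are equal rows, and a content smaller by 1 is the next row.
  Horizontal Diagonal Inverted : (ℕ → ℕ → ℕ) → ℕ × ℕ → ℕ × ℕ → Set
  Horizontal F (j , r) (j′ , r′) = F j′ r′ < F j r × j < j′ × r ≡ r′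
  Diagonal   F (j , r) (j′ , r′) = F j′ r′ < F j r × j′ < j × r ≡ suc r′
  Inverted   F u v = Horizontal F u v ⊎ Diagonal F u v

  horizontal? : ∀ F u v → Dec (Horizontal F u v)
  horizontal? F (j , r) (j′ , r′) = (F j′ r′ <? F j r) ×-dec (j <? j′) ×-dec (r ≟ r′)

  diagonal? : ∀ F u v → Dec (Diagonal F u v)
  diagonal? F (j , r) (j′ , r′) = (F j′ r′ <? F j r) ×-dec (j′ <? j) ×-dec (r ≟ suc r′)

  hi-antitone : ∀ {j k} → j ≤ k → hi k ≤ hi j
  hi-antitone {j} {k} j≤k = subst (λ k → hi k ≤ hi j) (m∸n+n≡m j≤k) (go (k ∸ j))
    where
    go : ∀ d → hi (d + j) ≤ hi j
    go zero    = ≤-refl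
    go (suc d) = ≤-trans (hi-desc (d + j)) (go d)

  -- By the gap, columns from `j + 2` on end above the first row of column `j`.
  adjacent : ∀ {j k r} → j < k → lo j < r → r ≤ hi k → k ≡ suc j
  adjacent {j} {k} j<k lo<r r≤ with m≤n⇒m<n∨m≡n j<k
  ... | inj₂ eq  = sym eq
  ... | inj₁ far = contradiction (≤-trans r≤ (≤-trans (hi-antitone far) (gap j))) (<⇒≱ lo<r)

  inside : ∀ {j r} → lo j < r → r ≤ hi j → In n lo hi (j , r)
  inside {j} {r} lo<r r≤ with j <? n
  ... | yes j<n = j<n , lo<r , r≤
  ... | no j≮n = contradiction (subst (r ≤_) (hi-end j (≮⇒≥ j≮n)) r≤) (<⇒≱ (≤-<-trans z≤n lo<r))

  ∑-at : {Q : ℕ × ℕ → Set} (Q? : ∀ u → Dec (Q u)) {S : Set} (s : Dec S) (u₀ : ℕ × ℕ) →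
    (∀ b → Q (pos b) → pos b ≡ u₀) → (S → In n lo hi u₀ × Q u₀) → (In n lo hi u₀ → Q u₀ → S) →
    ∑[ b ∈ allFin size ] ⟦ Q? (pos b) ⟧ ≡ ⟦ s ⟧
  ∑-at {Q} Q? s u₀ uniq f g with ⟦⟧-dec s
  ... | inj₁ (p , eq) = trans (∑-allFin-δ (index (proj₁ (f p))) (λ b → ⟦ Q? (pos b) ⟧)
        (λ {b} ne → ⟦⟧-no (Q? (pos b)) (λ q → ne (pos-injective (trans (uniq b q) (sym (pos-index (proj₁ (f p)))))))))
      (trans (⟦⟧-yes (Q? (pos (index (proj₁ (f p))))) (subst Q (sym (pos-index (proj₁ (f p)))) (proj₂ (f p)))) (sym eq))
  ... | inj₂ (¬p , eq) = trans (∑-zero (allFin size) (λ {b} _ → ⟦⟧-no (Q? (pos b))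
        (λ q → ¬p (g (subst (In n lo hi) (uniq b q) (pos-in b)) (subst Q (uniq b q) q))))) (sym eq)

  -- Every inversion is attributed to the left one of its two boxes: the larger entry for a
  -- horizontal one, the smaller entry for a diagonal one. The identity then holds box by box.
  inversions : ∀ F → Valid F →
    ∑[ u ∈ allFin size ] ∑[ v ∈ allFin size ] ⟦ horizontal? F (pos u) (pos v) ⊎-dec diagonal? F (pos u) (pos v) ⟧
    ≡ forced + (∑[ j ∈ allFin n ] passagesAt F (toℕ j))
  inversions F valid = begin
    ∑[ u ∈ boxes ] ∑ boxes (I u)
      ≡⟨ ∑-cong boxes (λ u → trans (∑-cong boxes (λ v → split (pos u) (pos v)))
           (∑-+ boxes (H u) (Δ u))) ⟩
    ∑[ u ∈ boxes ] ((∑ boxes (H u)) + (∑ boxes (Δ u)))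
      ≡⟨ ∑-+ boxes (λ u → ∑ boxes (H u)) (λ u → ∑ boxes (Δ u)) ⟩
    (∑[ u ∈ boxes ] ∑ boxes (H u)) + (∑[ u ∈ boxes ] ∑ boxes (Δ u))
      ≡⟨ cong (λ t → (∑[ u ∈ boxes ] ∑ boxes (H u)) + t)
           (∑-swap boxes boxes Δ) ⟩
    (∑[ u ∈ boxes ] ∑ boxes (H u)) + (∑[ v ∈ boxes ] ∑[ u ∈ boxes ] Δ u v)
      ≡⟨ cong₂ _+_ (∑-cong boxes row-sum) (∑-cong boxes diagonal-sum) ⟩
    ∑ boxes right + ∑ boxes below
      ≡⟨ sym (∑-+ boxes right below) ⟩
    ∑[ b ∈ boxes ] (right b + below b)
      ≡⟨ ∑-cong boxes (λ b → balance (pos-in b)) ⟩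
    ∑[ b ∈ boxes ] (constant b + passage b)
      ≡⟨ ∑-+ boxes constant passage ⟩
    ∑ boxes constant + ∑ boxes passage
      ≡⟨ cong₂ _+_ (∑-boxes (λ j r → ⟦ suc r ≤? hi (suc j) ⟧)) (∑-boxes (λ j r → ⟦ passage? F j r ⟧)) ⟩
    forced + (∑[ j ∈ allFin n ] passagesAt F (toℕ j)) ∎
    where
    open ≡-Reasoning
    boxes : List (Fin size)
    boxes = allFin size
    col′ row′ : Fin size → ℕ
    col′ b = proj₁ (pos b)
    row′ b = proj₂ (pos b)
    right? : ∀ j r → Dec (r ≤ hi (suc j) × F (suc j) r < F j r)
    right? j r = (r ≤? hi (suc j)) ×-dec (F (suc j) r <? F j r)
    below-right? : ∀ j r → Dec (suc r ≤ hi (suc j) × F j r < F (suc j) (suc r))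
    below-right? j r = (suc r ≤? hi (suc j)) ×-dec (F j r <? F (suc j) (suc r))
    I H Δ : Fin size → Fin size → ℕ
    I u v = ⟦ horizontal? F (pos u) (pos v) ⊎-dec diagonal? F (pos u) (pos v) ⟧
    H u v = ⟦ horizontal? F (pos u) (pos v) ⟧
    Δ u v = ⟦ diagonal? F (pos u) (pos v) ⟧
    right below constant passage : Fin size → ℕ
    right    b = ⟦ right? (col′ b) (row′ b) ⟧
    below    b = ⟦ below-right? (col′ b) (row′ b) ⟧
    constant b = ⟦ suc (row′ b) ≤? hi (suc (col′ b)) ⟧
    passage  b = ⟦ passage? F (col′ b) (row′ b) ⟧
    split : ∀ u v → ⟦ horizontal? F u v ⊎-dec diagonal? F u v ⟧ ≡ ⟦ horizontal? F u v ⟧ + ⟦ diagonal? F u v ⟧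
    split u v = ≤-antisym (⟦⟧-∪ (horizontal? F u v) (diagonal? F u v) (horizontal? F u v ⊎-dec diagonal? F u v) id)
      (⟦⟧-⊎ (horizontal? F u v) (diagonal? F u v) (horizontal? F u v ⊎-dec diagonal? F u v) inj₁ inj₂
        (λ { (_ , j<j′ , _) (_ , j′<j , _) → <-asym j<j′ j′<j }))
    row-sum : ∀ u → ∑ boxes (H u) ≡ right u
    row-sum u = ∑-at (horizontal? F (pos u)) (right? (col′ u) (row′ u)) (suc (col′ u) , row′ u)
      (λ { v (_ , j<j′ , eq) → cong₂ _,_ (adjacent j<j′ (proj₁ (proj₂ (pos-in u))) (subst (_≤ hi (col′ v)) (sym eq) (proj₂ (proj₂ (pos-in v))))) (sym eq) })
      (λ { (r≤ , lt) → inside (≤-<-trans (lo-desc (col′ u)) (proj₁ (proj₂ (pos-in u)))) r≤ , lt , ≤-refl , refl })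
      (λ { (_ , _ , r≤) (lt , _) → r≤ , lt })
    diagonal-sum : ∀ v → ∑[ u ∈ boxes ] Δ u v ≡ below v
    diagonal-sum v = ∑-at (λ u → diagonal? F u (pos v)) (below-right? (col′ v) (row′ v)) (suc (col′ v) , suc (row′ v))
      (λ { u (_ , j<j′ , eq) → cong₂ _,_ (adjacent j<j′ (<-trans (proj₁ (proj₂ (pos-in v))) ≤-refl) (subst (_≤ hi (col′ u)) eq (proj₂ (proj₂ (pos-in u))))) eq })
      (λ { (r≤ , lt) → inside (≤-<-trans (lo-desc (col′ v)) (<-trans (proj₁ (proj₂ (pos-in v))) ≤-refl)) r≤ , lt , ≤-refl , refl })
      (λ { (_ , _ , r≤) (lt , _) → r≤ , lt })
    -- If the box (suc j , suc r) exists, at least one of the two inversions occurs, and both occur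
    -- exactly at a passage. If it does not, the horizontal inversion alone is the passage.
    balance : ∀ {j r} → In n lo hi (j , r) →
      ⟦ right? j r ⟧ + ⟦ below-right? j r ⟧ ≡ ⟦ suc r ≤? hi (suc j) ⟧ + ⟦ passage? F j r ⟧
    balance {j} {r} (j<n , lo<r , r≤) with suc r ≤? hi (suc j)
    ... | no sr≰ = trans (cong (λ t → ⟦ right? j r ⟧ + t) (⟦⟧-no (below-right? j r) (λ p → sr≰ (proj₁ p))))
        (trans (+-identityʳ _) (trans (⟦⟧-⇔ (right? j r) (passage? F j r) (λ p → p , λ sr≤ → contradiction sr≤ sr≰) proj₁)
          (cong (_+ ⟦ passage? F j r ⟧) (sym (⟦⟧-no (suc r ≤? hi (suc j)) sr≰)))))
    ... | yes sr≤ with F (suc j) r <? F j r | F j r <? F (suc j) (suc r)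
    -- Two failures would give `F j r ≤ F (suc j) r < F (suc j) (suc r) ≤ F j r`.
    ... | no ¬a | no ¬b = contradiction (<-≤-trans (valid (suc j) (proj₁ (inside {suc j} (≤-<-trans (lo-desc j) lo<r) (<⇒≤ sr≤))) r (suc r)
          (≤-<-trans (lo-desc j) lo<r) ≤-refl sr≤) (≮⇒≥ ¬b)) (≤⇒≯ (≮⇒≥ ¬a))
    ... | yes a | yes b = cong₂ _+_ (trans (⟦⟧-yes (right? j r) (<⇒≤ sr≤ , a)) (sym (⟦⟧-yes (suc r ≤? hi (suc j)) sr≤)))
        (trans (⟦⟧-yes (below-right? j r) (sr≤ , b)) (sym (⟦⟧-yes (passage? F j r) ((<⇒≤ sr≤ , a) , λ _ → b))))
    ... | yes a | no ¬b = trans (cong₂ _+_ (⟦⟧-yes (right? j r) (<⇒≤ sr≤ , a)) (⟦⟧-no (below-right? j r) (λ p → ¬b (proj₂ p))))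
        (sym (cong₂ _+_ (⟦⟧-yes (suc r ≤? hi (suc j)) sr≤) (⟦⟧-no (passage? F j r) (λ p → ¬b (proj₂ p sr≤)))))
    ... | no ¬a | yes b = trans (cong₂ _+_ (⟦⟧-no (right? j r) (λ p → ¬a (proj₂ p))) (⟦⟧-yes (below-right? j r) (sr≤ , b)))
        (sym (cong₂ _+_ (⟦⟧-yes (suc r ≤? hi (suc j)) sr≤) (⟦⟧-no (passage? F j r) (λ p → ¬a (proj₂ (proj₁ p))))))

  inversions-rows : ∀ F → (∀ j r → In n lo hi (j , r) → F j r ≡ r) →
    ∑[ j ∈ allFin n ] passagesAt F (toℕ j) ≡ 0
  inversions-rows F rows≡ = ∑-zero (allFin n) (λ {j} _ → ∑-zero (rowsOf (toℕ j)) (λ {r} r∈ →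
    ⟦⟧-no (passage? F (toℕ j) r) (λ { ((r≤ , lt) , _) → <-irrefl
      (trans (rows≡ (suc (toℕ j)) r (inside (≤-<-trans (lo-desc (toℕ j)) (proj₁ (∈-range⁻ r∈))) r≤))
             (sym (rows≡ (toℕ j) r (Finₚ.toℕ<n j , ∈-range⁻ r∈)))) lt })))

-- Conjugate shapes and vertical strips

part-desc : ∀ {p} → Linked _≥_ p → ∀ j → part p (2 + j) ≤ part p (suc j)
part-desc []            j       = z≤n
part-desc [-]           zero    = z≤n
part-desc [-]           (suc j) = z≤n
part-desc (x≥y ∷ l)     zero    = x≥y
part-desc (x≥y ∷ l)     (suc j) = part-desc l j

part-end : ∀ p {j} → length p ≤ j → part p (suc j) ≡ 0
part-end []       _         = refl
part-end (x ∷ ps) {suc j} (s≤s h) = part-end ps h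

part-≤-first : ∀ {p} → Linked _≥_ p → ∀ j → part p (suc j) ≤ part p 1
part-≤-first l zero    = ≤-refl
part-≤-first l (suc j) = ≤-trans (part-desc l j) (part-≤-first l j)

part-applyUpTo : ∀ (g : ℕ → ℕ) m {i} → i < m → part (applyUpTo g m) (suc i) ≡ g i
part-applyUpTo g (suc m) {zero}  _       = refl
part-applyUpTo g (suc m) {suc i} (s≤s h) = part-applyUpTo (g ∘ suc) m h

-- Since `p` descends, its parts greater than `i` form an initial segment, and the filter measures
-- the length of it.
column-count : ∀ {p} → Linked _≥_ p → ∀ i j →
  (suc j ≤ length (filter (suc i ≤?_) p) → suc i ≤ part p (suc j)) ×
  (suc i ≤ part p (suc j) → suc j ≤ length (filter (suc i ≤?_) p))
column-count {[]}     _ i j = (λ ()) , (λ ())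
column-count {x ∷ ps} l i j with suc i ≤? x
... | no x<i = (λ h → contradiction (trans (cong length (Listₚ.filter-reject (suc i ≤?_) {xs = ps} x<i)) (none ps l x<i))
                        (λ eq → <⇒≱ h (subst (_≤ j) (sym eq) z≤n)))
             , (λ h → contradiction (≤-trans h (part-≤-first l j)) x<i)
  where
  none : ∀ {x} ps → Linked _≥_ (x ∷ ps) → ¬ suc i ≤ x → length (filter (suc i ≤?_) ps) ≡ 0
  none []       _         _   = refl
  none (y ∷ ps) (x≥y ∷ l) x<i = trans (cong length (Listₚ.filter-reject (suc i ≤?_) {xs = ps} y<i)) (none ps l y<i)
    where
    y<i : ¬ suc i ≤ y
    y<i h = x<i (≤-trans h x≥y)
column-count {x ∷ ps} l i j | yes h = subst
  (λ t → (suc j ≤ t → suc i ≤ part (x ∷ ps) (suc j)) × (suc i ≤ part (x ∷ ps) (suc j) → suc j ≤ t))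
  (sym (cong length (Listₚ.filter-accept (suc i ≤?_) {xs = ps} h))) (counted j)
  where
  counted : ∀ j → (suc j ≤ suc (length (filter (suc i ≤?_) ps)) → suc i ≤ part (x ∷ ps) (suc j)) ×
    (suc i ≤ part (x ∷ ps) (suc j) → suc j ≤ suc (length (filter (suc i ≤?_) ps)))
  counted zero    = (λ _ → h) , (λ _ → s≤s z≤n)
  counted (suc j) = (λ { (s≤s p) → proj₁ (column-count (Linked.tail l) i j) p })
                  , (λ p → s≤s (proj₂ (column-count (Linked.tail l) i j) p))

conjugatePartition-applyUpTo : ∀ p →
  conjugatePartition p ≡ applyUpTo (λ i → length (filter (suc i ≤?_) p)) (part p 1)
conjugatePartition-applyUpTo p = Listₚ.map-applyUpTo suc (λ i → length (filter (i ≤?_) p)) (part p 1)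

length-conjugatePartition : ∀ p → length (conjugatePartition p) ≡ part p 1
length-conjugatePartition p = trans (cong length (conjugatePartition-applyUpTo p))
  (Listₚ.length-applyUpTo (λ i → length (filter (suc i ≤?_) p)) (part p 1))

part-conjugate : ∀ {p} → Linked _≥_ p → ∀ i j →
  (suc j ≤ part (conjugatePartition p) (suc i) → suc i ≤ part p (suc j)) ×
  (suc i ≤ part p (suc j) → suc j ≤ part (conjugatePartition p) (suc i))
part-conjugate {p} l i j with i <? part p 1
... | yes i<p₁ rewrite conjugatePartition-applyUpTo p
                     | part-applyUpTo (λ i → length (filter (suc i ≤?_) p)) (part p 1) i<p₁ = column-count l i j
... | no i≮p₁ = (λ h → contradiction h (λ h → <⇒≱ h (≤-trans (≤-reflexive
      (part-end (conjugatePartition p) (≤-trans (≤-reflexive (length-conjugatePartition p)) (≮⇒≥ i≮p₁)))) z≤n)))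
  , (λ h → contradiction (≤-trans h (part-≤-first l j)) i≮p₁)

rowCells : List ℕ → List ℕ → ℕ → List Cell
rowCells κ τ i = applyUpTo (λ k → i , part τ i + suc k) (part κ i ∸ part τ i)

∈-cells⁺ : ∀ κ τ {i c} → i < length κ → part τ (suc i) < c → c ≤ part κ (suc i) → (suc i , c) ∈ cells (κ / τ)
∈-cells⁺ κ τ {i} {suc c} i< (s≤s lo≤c) c≤ = ∈-concatMap⁺ (rowCells κ τ) (lose {P = λ r → (suc i , suc c) ∈ rowCells κ τ r} (∈-applyUpTo⁺ suc i<)
  (subst (λ c → (suc i , c) ∈ rowCells κ τ (suc i))
    (trans (+-suc _ (c ∸ part τ (suc i))) (cong suc (m+[n∸m]≡n lo≤c)))
    (∈-applyUpTo⁺ {A = Cell} (λ k → suc i , part τ (suc i) + suc k) (∸-monoˡ-< c≤ lo≤c))))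

∈-cells⁻ : ∀ κ τ {u} → u ∈ cells (κ / τ) →
  ∃[ i ] (row u ≡ suc i × i < length κ × part τ (suc i) < col u × col u ≤ part κ (suc i))
∈-cells⁻ κ τ {u} u∈ with find (∈-concatMap⁻ (rowCells κ τ) {xs = [1⋯ length κ ]} u∈)
... | i , i∈ , u∈′ with ∈-applyUpTo⁻ suc i∈ | ∈-applyUpTo⁻ (λ k → i , part τ i + suc k) u∈′
... | i′ , i′< , refl | k , k< , refl = i′ , refl , i′< , ∈-range⁻ (∈-applyUpTo⁺ (λ k → part τ (suc i′) + suc k) k<)

concatMap-unique : ∀ {A B : Set} (f : A → List B) {xs} → Unique xs → (∀ x → Unique (f x)) →
  (∀ {x x′ y} → y ∈ f x → y ∈ f x′ → x ≡ x′) → Unique (concatMap f xs)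
concatMap-unique f {[]}     _        _  _ = []
concatMap-unique f {x ∷ xs} (x∉ ∷ u) uf d = Uniqueₚ.++⁺ (uf x) (concatMap-unique f u uf d)
  (λ { (y∈ , y∈′) → case find (∈-concatMap⁻ f {xs = xs} y∈′) of λ { (x′ , x′∈ , y∈″) → All.lookup x∉ x′∈ (d y∈ y∈″) } })

cells-unique : ∀ s → Unique (cells s)
cells-unique (κ / τ) = concatMap-unique (rowCells κ τ)
  (Uniqueₚ.applyUpTo⁺₁ suc (length κ) (λ i<j _ eq → <⇒≢ i<j (suc-injective eq)))
  (λ i → Uniqueₚ.applyUpTo⁺₁ (cell i) (part κ i ∸ part τ i) (λ k<l _ eq → <⇒≢ k<l (suc-injective (+-cancelˡ-≡ (part τ i) _ _ (cong proj₂ eq)))))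
  (λ {i} {i′} y∈ y∈′ → case ∈-applyUpTo⁻ (cell i) y∈ of λ { (_ , _ , refl) →
    case ∈-applyUpTo⁻ (cell i′) y∈′ of λ { (_ , _ , eq) → cong proj₁ eq } })
  where
  cell : ℕ → ℕ → Cell
  cell i k = i , part τ i + suc k

unique-lookup : ∀ {A : Set} {xs : List A} → Unique xs → ∀ {i j} → List.lookup xs i ≡ List.lookup xs j → i ≡ j
unique-lookup (x∉ ∷ u) {zero}  {zero}  eq = refl
unique-lookup (x∉ ∷ u) {zero}  {suc j} eq = contradiction eq (All.lookup x∉ (∈-lookup j))
unique-lookup (x∉ ∷ u) {suc i} {zero}  eq = contradiction (sym eq) (All.lookup x∉ (∈-lookup i))
unique-lookup (x∉ ∷ u) {suc i} {suc j} eq = cong suc (unique-lookup u eq)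

listDiagram : ∀ {C : Set} {n lo hi} (xs : List C) (coordinate : C → ℕ × ℕ) → Unique xs →
  (∀ {x y} → x ∈ xs → y ∈ xs → coordinate x ≡ coordinate y → x ≡ y) →
  (∀ {x} → x ∈ xs → In n lo hi (coordinate x)) →
  (∀ {u} → In n lo hi u → ∃[ x ] (x ∈ xs × coordinate x ≡ u)) → Diagram n lo hi
listDiagram xs coordinate u inj sound complete = record
  { size = length xs
  ; pos = λ b → coordinate (List.lookup xs b)
  ; pos-in = λ b → sound (∈-lookup b)
  ; index = λ i → Any.index (proj₁ (proj₂ (complete i)))
  ; pos-index = λ i → trans (cong coordinate (sym (Anyₚ.lookup-index (proj₁ (proj₂ (complete i)))))) (proj₂ (proj₂ (complete i)))
  ; pos-injective = λ {b} {c} eq → unique-lookup u (inj (∈-lookup b) (∈-lookup c) eq)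
  }

tuple-unique : ∀ (ν : List SkewShape) → Unique (LLTPolynomial.tupleCells ν)
tuple-unique ν = concatMap-unique (λ i → map (i ,_) (cells (List.lookup ν i))) (Uniqueₚ.allFin⁺ (length ν))
  (λ i → Uniqueₚ.map⁺ (λ { refl → refl }) (cells-unique (List.lookup ν i)))
  (λ {i} {i′} y∈ y∈′ → case ∈-map⁻ (i ,_) y∈ of λ { (_ , _ , refl) → case ∈-map⁻ (i′ ,_) y∈′ of λ { (_ , _ , refl) → refl } })

part-replicate : ∀ a {i} → i < a → part (replicate a 1) (suc i) ≡ 1
part-replicate (suc a) {zero}  _       = refl
part-replicate (suc a) {suc i} (s≤s h) = part-replicate a h

part-replicate-end : ∀ a {i} → a ≤ i → part (replicate a 1) (suc i) ≡ 0
part-replicate-end a a≤i = part-end (replicate a 1) (≤-trans (≤-reflexive (Listₚ.length-replicate a)) a≤i)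

∈-verticalStrip⁺ : ∀ {a b r} → b < r → r ≤ a → (r , 1) ∈ cells (verticalStrip a b)
∈-verticalStrip⁺ {a} {b} {suc r} (s≤s b≤r) r<a = ∈-cells⁺ (replicate a 1) (replicate b 1)
  (≤-trans r<a (≤-reflexive (sym (Listₚ.length-replicate a))))
  (s≤s (≤-reflexive (part-replicate-end b b≤r)))
  (≤-reflexive (sym (part-replicate a r<a)))

∈-verticalStrip⁻ : ∀ {a b u} → u ∈ cells (verticalStrip a b) → (b < row u × row u ≤ a) × col u ≡ 1
∈-verticalStrip⁻ {a} {b} {u} u∈ with ∈-cells⁻ (replicate a 1) (replicate b 1) u∈
... | r , refl , r< , lo< , ≤hi = (b<r , r<a) , ≤-antisym (≤-trans ≤hi (≤-reflexive (part-replicate a r<a))) (≤-<-trans z≤n lo<)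
  where
  r<a : r < a
  r<a = subst (r <_) (Listₚ.length-replicate a) r<
  b<r : b < suc r
  b<r with b ≤? r
  ... | yes b≤r = s≤s b≤r
  ... | no b≰r = contradiction (<-≤-trans (subst (_< col u) (part-replicate b (≰⇒> b≰r)) lo<)
                   (≤-trans ≤hi (≤-reflexive (part-replicate a r<a)))) (<-irrefl refl)

lookup-map-applyUpTo : ∀ {A B : Set} (f : A → B) (g : ℕ → A) m (i : Fin (length (map f (applyUpTo g m)))) →
  List.lookup (map f (applyUpTo g m)) i ≡ f (g (toℕ i))
lookup-map-applyUpTo f g (suc m) zero    = refl
lookup-map-applyUpTo f g (suc m) (suc i) = lookup-map-applyUpTo f (g ∘ suc) m i

Descending-tabulate : ∀ n (d : ℕ → ℕ) → (∀ j → d (suc j) ≤ d j) → Descending (tabulate {n = n} (λ j → d (toℕ j)))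
Descending-tabulate zero          d h = tt
Descending-tabulate (suc zero)    d h = z≤n , tt
Descending-tabulate (suc (suc n)) d h = h 0 , Descending-tabulate (suc n) (d ∘ suc) (h ∘ suc)

Gap-tabulate : ∀ n (lo hi : ℕ → ℕ) → (∀ j → hi (2 + j) ≤ lo j) →
  Gap (tabulate {n = n} (λ j → lo (toℕ j))) (tabulate (λ j → hi (toℕ j)))
Gap-tabulate zero                lo hi h = tt
Gap-tabulate (suc zero)          lo hi h = z≤n , tt
Gap-tabulate (suc (suc zero))    lo hi h = z≤n , z≤n , tt
Gap-tabulate (suc (suc (suc n))) lo hi h = h 0 , Gap-tabulate (suc (suc n)) (lo ∘ suc) (hi ∘ suc) (h ∘ suc)

length-∑ : (xs : List A) → length xs ≡ ∑[ x ∈ xs ] 1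
length-∑ []       = refl
length-∑ (x ∷ xs) = cong suc (length-∑ xs)

sum-map-filter : {P : A → Set} (P? : ∀ x → Dec (P x)) (f : A → ℕ) (xs : List A) →
  sum (map f (filter P? xs)) ≡ ∑[ x ∈ xs ] ⟦ P? x ⟧ * f x
sum-map-filter P? f []       = refl
sum-map-filter P? f (x ∷ xs) with P? x
... | yes _ = cong₂ _+_ (sym (+-identityʳ (f x))) (sum-map-filter P? f xs)
... | no _  = sum-map-filter P? f xs

generatingSeries-∑ : {P : Vec ℕ n → Set} (P? : ∀ w → Dec (P w)) (f : Vec ℕ n → ℕ) (N : ℕ) (α : Vec ℕ N) (d : ℤ) →
  generatingSeries P? f N α d ≡ ∑[ w ∈ vecs [1⋯ N ] n ] ⟦ P? w ⟧ * (⟦ weight N w ≟ᵛ α ⟧ * ⟦ + f w ℤ.≟ d ⟧)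
generatingSeries-∑ {n} P? f N α d = trans
  (cong (λ ws → length (filter Q? ws)) (words≡vecs n [1⋯ N ]))
  (trans (length-filter-∑ Q? (vecs [1⋯ N ] n)) (∑-cong (vecs [1⋯ N ] n) (λ w →
    trans (⟦⟧-× (P? w) ((weight N w ≟ᵛ α) ×-dec (+ f w ℤ.≟ d)))
          (cong (⟦ P? w ⟧ *_) (⟦⟧-× (weight N w ≟ᵛ α) (+ f w ℤ.≟ d))))))
  where
  Q? : ∀ w → Dec _
  Q? w = P? w ×-dec (weight N w ≟ᵛ α) ×-dec (+ f w ℤ.≟ d)

[1⋯]-positive : ∀ {N} {w : Vec ℕ n} → (∀ b → lookup w b ∈ [1⋯ N ]) → Positive w
[1⋯]-positive w∈ b with ∈-applyUpTo⁻ suc (w∈ b)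
... | _ , _ , eq = subst (0 <_) (sym eq) (s≤s z≤n)

-- The two series of a narrow shape

module NarrowShape (κ τ : List ℕ) (κ-desc : Linked _≥_ κ) (τ-desc : Linked _≥_ τ)
                   (τ≤κ : ∀ i → part τ i ≤ part κ i) (narrow : ∀ j → columnLength (κ / τ) j ≤ 2) where

  width : ℕ
  width = length κ

  lo hi : ℕ → ℕ
  lo j = part τ (suc j)
  hi j = part κ (suc j)

  lo≤hi : ∀ j → lo j ≤ hi j
  lo≤hi j = τ≤κ (suc j)

  lo-desc : ∀ j → lo (suc j) ≤ lo j
  lo-desc = part-desc τ-desc

  hi-desc : ∀ j → hi (suc j) ≤ hi j
  hi-desc = part-desc κ-desc

  hi-end : ∀ j → width ≤ j → hi j ≡ 0
  hi-end j = part-end κ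

  inside : ∀ {j r} → lo j < r → r ≤ hi j → j < width
  inside {j} {r} lo<r r≤ with j <? width
  ... | yes j<n = j<n
  ... | no j≮n  = contradiction (subst (r ≤_) (hi-end j (≮⇒≥ j≮n)) r≤) (<⇒≱ (≤-<-trans z≤n lo<r))

  -- Otherwise the last box of row `3 + j` has a box in each of the two rows above it, which makes
  -- three boxes in one column.
  gap : ∀ j → hi (2 + j) ≤ lo j
  gap j = ≮⇒≥ (λ lo<c → <⇒≱ (s≤s (narrow c)) (three lo<c))
    where
    c : ℕ
    c = hi (2 + j)
    three : lo j < c → 3 ≤ columnLength (κ / τ) c
    three lo<c = subst (3 ≤_) (sym (length-∑ (filter (λ u → col u ≟ c) (cells (κ / τ)))))
      (∑-injection {xs = column₃} (λ _ → 1) (λ _ → 1) id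
        (((λ ()) ∷ (λ ()) ∷ []) ∷ ((λ ()) ∷ []) ∷ [] ∷ [])
        (λ u∈ _ → ∈-filter⁺ (λ u → col u ≟ c) (proj₁ (in-column u∈)) (proj₂ (in-column u∈)) , ≤-refl)
        (λ _ _ _ _ eq → eq))
      where
      column₃ : List Cell
      column₃ = (suc j , c) ∷ (2 + j , c) ∷ (3 + j , c) ∷ []
      cell : ∀ {i} → lo i < c → c ≤ hi i → (suc i , c) ∈ cells (κ / τ)
      cell lo<c c≤ = ∈-cells⁺ κ τ (inside lo<c c≤) lo<c c≤
      lo<c₁ : lo (suc j) < c
      lo<c₁ = ≤-<-trans (lo-desc j) lo<c
      in-column : ∀ {u} → u ∈ column₃ → u ∈ cells (κ / τ) × col u ≡ c
      in-column (here refl) = cell lo<c (≤-trans (hi-desc (suc j)) (hi-desc j)) , refl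
      in-column (there (here refl)) = cell lo<c₁ (hi-desc (suc j)) , refl
      in-column (there (there (here refl))) = cell (≤-<-trans (lo-desc (suc j)) lo<c₁) ≤-refl , refl

  s′ : SkewShape
  s′ = conjugate (κ / τ)

  transpose : Cell → ℕ × ℕ
  transpose u = pred (col u) , row u

  ∈-conjugate⁻ : ∀ {u} → u ∈ cells s′ → ∃[ j ] (col u ≡ suc j × In width lo hi (j , row u))
  ∈-conjugate⁻ {r , suc j} u∈ with ∈-cells⁻ (conjugatePartition κ) (conjugatePartition τ) u∈
  ... | i , refl , _ , lo< , ≤hi = j , refl , inside lo<r r≤ , lo<r , r≤
    where
    r≤ : suc i ≤ hi j
    r≤ = proj₁ (part-conjugate κ-desc i j) ≤hi
    lo<r : lo j < suc i
    lo<r = ≰⇒> (λ h → <⇒≱ lo< (proj₂ (part-conjugate τ-desc i j) h))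
  ∈-conjugate⁻ {r , zero} u∈ with ∈-cells⁻ (conjugatePartition κ) (conjugatePartition τ) u∈
  ... | _ , _ , _ , () , _

  ∈-conjugate⁺ : ∀ {j r} → In width lo hi (j , r) → (r , suc j) ∈ cells s′
  ∈-conjugate⁺ {j} {suc i} (_ , lo<r , r≤) = ∈-cells⁺ (conjugatePartition κ) (conjugatePartition τ)
    (≤-trans (≤-trans r≤ (part-≤-first κ-desc j)) (≤-reflexive (sym (length-conjugatePartition κ))))
    (≰⇒> (λ h → <⇒≱ lo<r (proj₁ (part-conjugate τ-desc i j) h)))
    (proj₂ (part-conjugate κ-desc i j) r≤)

  conjugateDiagram : Diagram width lo hi
  conjugateDiagram = listDiagram (cells s′) transpose (cells-unique s′)
    (λ x∈ y∈ eq → same (∈-conjugate⁻ x∈) (∈-conjugate⁻ y∈) eq)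
    (λ x∈ → sound (∈-conjugate⁻ x∈))
    (λ {u} i → (proj₂ u , suc (proj₁ u)) , ∈-conjugate⁺ i , refl)
    where
    same : ∀ {x y} → ∃[ j ] (col x ≡ suc j × In width lo hi (j , row x)) → ∃[ j ] (col y ≡ suc j × In width lo hi (j , row y)) →
      transpose x ≡ transpose y → x ≡ y
    same (j , refl , _) (j′ , refl , _) refl = refl
    sound : ∀ {x} → ∃[ j ] (col x ≡ suc j × In width lo hi (j , row x)) → In width lo hi (transpose x)
    sound (j , refl , i) = i

  ν : List SkewShape
  ν = rowStrips (κ / τ)

  open LLTPolynomial ν using (tupleCells)

  strip : ∀ i → List.lookup ν i ≡ verticalStrip (hi (toℕ i)) (lo (toℕ i))
  strip = lookup-map-applyUpTo (λ j → verticalStrip (part κ j) (part τ j)) suc width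

  length-ν : length ν ≡ width
  length-ν = trans (Listₚ.length-map (λ j → verticalStrip (part κ j) (part τ j)) [1⋯ width ]) (Listₚ.length-applyUpTo suc width)

  position : Fin (length ν) × Cell → ℕ × ℕ
  position (i , u) = toℕ i , row u

  ∈-tuple⁻ : ∀ {x} → x ∈ tupleCells → In width lo hi (position x) × col (proj₂ x) ≡ 1
  ∈-tuple⁻ {x} x∈ with find (∈-concatMap⁻ (λ i → map (i ,_) (cells (List.lookup ν i))) {xs = allFin (length ν)} x∈)
  ... | i , _ , x∈′ with ∈-map⁻ (i ,_) x∈′
  ... | u , u∈ , refl with ∈-verticalStrip⁻ (subst (λ s → u ∈ cells s) (strip i) u∈)
  ... | (lo<r , r≤) , col≡1 = (subst (toℕ i <_) length-ν (Finₚ.toℕ<n i) , lo<r , r≤) , col≡1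

  ∈-tuple⁺ : ∀ {j r} → In width lo hi (j , r) → ∃[ x ] (x ∈ tupleCells × position x ≡ (j , r))
  ∈-tuple⁺ {j} {r} (j<n , lo<r , r≤) = (i , r , 1)
    , ∈-concatMap⁺ (λ i → map (i ,_) (cells (List.lookup ν i))) (lose (∈-allFin i) (∈-map⁺ (i ,_)
        (subst (λ s → (r , 1) ∈ cells s) (sym (strip i))
          (∈-verticalStrip⁺ (subst (λ j → lo j < r) (sym toℕ-i) lo<r) (subst (λ j → r ≤ hi j) (sym toℕ-i) r≤)))))
    , cong (_, r) toℕ-i
    where
    i : Fin (length ν)
    i = Fin.fromℕ< (subst (j <_) (sym length-ν) j<n)
    toℕ-i : toℕ i ≡ j
    toℕ-i = Finₚ.toℕ-fromℕ< (subst (j <_) (sym length-ν) j<n)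

  tupleDiagram : Diagram width lo hi
  tupleDiagram = listDiagram tupleCells position (tuple-unique ν)
    (λ x∈ y∈ eq → same (proj₂ (∈-tuple⁻ x∈)) (proj₂ (∈-tuple⁻ y∈)) eq)
    (λ x∈ → proj₁ (∈-tuple⁻ x∈)) ∈-tuple⁺
    where
    same : ∀ {x y} → col (proj₂ x) ≡ 1 → col (proj₂ y) ≡ 1 → position x ≡ position y → x ≡ y
    same {i , r , c} {i′ , r′ , c′} refl refl eq with Finₚ.toℕ-injective (cong proj₁ eq) | cong proj₂ eq
    ... | refl | refl = refl

  module _ (N : ℕ) where
    private
      module M = Macdonald s′
      module 𝓔 = Descents conjugateDiagram lo≤hi lo-desc hi-desc gap N
      open Diagram conjugateDiagram
      open Values conjugateDiagram

      rowOf colOf : Fin size → ℕ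
      rowOf b = row (M.box b)
      colOf b = col (M.box b)

      colOf-suc : ∀ b → colOf b ≡ suc (proj₁ (pos b))
      colOf-suc b with ∈-conjugate⁻ (∈-lookup {xs = cells s′} b)
      ... | j , eq , _ = trans eq (cong (λ k → suc (pred k)) (sym eq))

      col-at : ∀ {j r} (i : In width lo hi (j , r)) → colOf (index i) ≡ suc j
      col-at i = trans (colOf-suc (index i)) (cong (λ u → suc (proj₁ u)) (pos-index i))

      row-at : ∀ {j r} (i : In width lo hi (j , r)) → rowOf (index i) ≡ r
      row-at i = cong proj₂ (pos-index i)

      val-at : ∀ w {j r} (i : In width lo hi (j , r)) → lookup w (index i) ≡ val w j r
      val-at w i = sym (val-pos w (index i) (pos-index i))

      leftOf-at : ∀ a b → M.LeftOf a b → pos b ≡ (suc (proj₁ (pos a)) , rowOf a)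
      leftOf-at a b (row≡ , col≡) = cong₂ _,_ (trans (cong pred (sym col≡)) (colOf-suc a)) (sym row≡)

    -- The order `Cyclic` of the left neighbour is the inversion-triple condition itself, with
    -- `nothing` for the value ∞. In column 0 the condition on the first column supplies it.
    cof⇒valid : ∀ {w} → M.COF w → 𝓔.Valid (val w)
    cof⇒valid {w} (_ , _ , firstColumn , innerTriples , outerTriples) j j<n r r′ lo<r r<r′ r′≤ =
      subst₂ (Cyclic (𝓔.left (val w) j r)) (val-at w i) (val-at w i′) (ordered j i i′ r<r′)
      where
      i : In width lo hi (j , r)
      i = j<n , lo<r , ≤-trans (<⇒≤ r<r′) r′≤
      i′ : In width lo hi (j , r′)
      i′ = j<n , <-trans lo<r r<r′ , r′≤
      above : ∀ {j r r′} (i : In width lo hi (j , r)) (i′ : In width lo hi (j , r′)) → r < r′ → M.Above (index i) (index i′)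
      above i i′ r<r′ = trans (col-at i) (sym (col-at i′)) , subst₂ _<_ (sym (row-at i)) (sym (row-at i′)) r<r′
      ordered : ∀ j {r r′} (i : In width lo hi (j , r)) (i′ : In width lo hi (j , r′)) → r < r′ →
        Cyclic (𝓔.left (val w) j r) (lookup w (index i)) (lookup w (index i′))
      ordered zero i i′ r<r′ = firstColumn (index i) (index i′) (above i i′ r<r′) (col-at i)
      ordered (suc j) {r} {r′} i@(j<n , lo<r , r≤) i′ r<r′ = byLeft (lo j <? r)
        where
        byLeft : Dec (lo j < r) → Cyclic (leftOf (lo j) (val w j) r) (lookup w (index i)) (lookup w (index i′))
        byLeft (yes lo′<r) = subst (λ a → Cyclic a (lookup w (index i)) (lookup w (index i′)))
          (sym (trans (decide-yes (lo j <? r) lo′<r) (cong just (sym (val-at w l)))))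
          (innerTriples (index l) (index i) (index i′)
            (trans (row-at l) (sym (row-at i)) , trans (cong suc (col-at l)) (sym (col-at i))) (above i i′ r<r′))
          where
          l : In width lo hi (j , r)
          l = <-trans ≤-refl j<n , lo′<r , ≤-trans r≤ (hi-desc j)
        byLeft (no ¬lo′<r) = subst (λ a → Cyclic a (lookup w (index i)) (lookup w (index i′)))
          (sym (decide-no (lo j <? r) ¬lo′<r)) (outerTriples (index i) (index i′) no-left (above i i′ r<r′))
          where
          no-left : ¬ (∃[ a ] M.LeftOf a (index i))
          no-left (a , leftOf) = ¬lo′<r (subst₂ (λ j r → lo j < r) (sym (suc-injective (cong proj₁ eq))) (sym (cong proj₂ eq)) (proj₁ (proj₂ (pos-in a))))
            where
            eq : (suc j , r) ≡ (suc (proj₁ (pos a)) , rowOf a)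
            eq = trans (sym (pos-index i)) (leftOf-at a (index i) leftOf)

    valid⇒cof : ∀ {w} → Positive w → 𝓔.Valid (val w) → M.COF w
    valid⇒cof {w} positive valid = positive
      , (λ b c above eq → Arrangement.irrefl cyclic (left b) (subst (Cyclic (left b) (lookup w b)) (sym eq) (ordered b c above)))
      , (λ b c above col≡1 → subst (λ k → Cyclic (𝓔.left (val w) (pred k) (rowOf b)) (lookup w b) (lookup w c)) col≡1 (ordered b c above))
      , (λ a b c leftOf above → subst (λ l → Cyclic l (lookup w b) (lookup w c)) (left-inner a b leftOf) (ordered b c above))
      , (λ b c none above → subst (λ l → Cyclic l (lookup w b) (lookup w c)) (left-outer b (proj₁ (pos b)) refl none) (ordered b c above))
      where
      left : Fin size → Maybe ℕ
      left b = 𝓔.left (val w) (proj₁ (pos b)) (rowOf b)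
      ordered : ∀ b c → M.Above b c → Cyclic (left b) (lookup w b) (lookup w c)
      ordered b c (col≡ , row<) = subst₂ (Cyclic (left b)) (val-pos w b refl) (val-pos w c (cong (λ k → _,_ {B = λ _ → ℕ} (pred k) (rowOf c)) (sym col≡)))
        (valid (proj₁ (pos b)) (proj₁ (pos-in b)) (rowOf b) (rowOf c) (proj₁ (proj₂ (pos-in b))) row<
          (subst (λ k → rowOf c ≤ hi (pred k)) (sym col≡) (proj₂ (proj₂ (pos-in c)))))
      left-inner : ∀ a b → M.LeftOf a b → left b ≡ just (lookup w a)
      left-inner a b leftOf = trans (cong (λ u → 𝓔.left (val w) (proj₁ u) (proj₂ u)) (leftOf-at a b leftOf))
        (trans (decide-yes (lo (proj₁ (pos a)) <? rowOf a) (proj₁ (proj₂ (pos-in a)))) (cong just (val-pos w a refl)))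
      left-outer : ∀ b j → proj₁ (pos b) ≡ j → ¬ (∃[ a ] M.LeftOf a b) → 𝓔.left (val w) j (rowOf b) ≡ nothing
      left-outer b zero    eq none = refl
      left-outer b (suc j) eq none = decide-no (lo j <? rowOf b) (λ lo<r → none (index (l lo<r)
        , row-at (l lo<r) , trans (cong suc (col-at (l lo<r))) (sym (trans (colOf-suc b) (cong suc eq)))))
        where
        l : lo j < rowOf b → In width lo hi (j , rowOf b)
        l lo<r = <-trans ≤-refl (subst (_< width) eq (proj₁ (pos-in b))) , lo<r
          , ≤-trans (subst (λ j → rowOf b ≤ hi j) eq (proj₂ (proj₂ (pos-in b)))) (hi-desc j)

    -- Descents lie in the last box of their row, so every leg is 0.
    maj-descents : ∀ w → M.maj w ≡ ∑[ j ∈ allFin width ] 𝓔.descentsAt (val w) (toℕ j)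
    maj-descents w = begin
      M.maj w
        ≡⟨ sum-map-filter (M.descent? w) (λ b → M.leg w b + 1) (allFin size) ⟩
      ∑[ b ∈ allFin size ] ⟦ M.descent? w b ⟧ * (M.leg w b + 1)
        ≡⟨ ∑-cong (allFin size) (λ b → pointwise b (proj₁ (pos b)) refl) ⟩
      ∑[ b ∈ allFin size ] h (proj₁ (pos b)) (rowOf b)
        ≡⟨ ∑-boxes h ⟩
      ∑[ j ∈ allFin width ] ∑[ r ∈ rowsOf (toℕ j) ] h (toℕ j) r
        ≡⟨ ∑-cong (allFin width) (λ j → columnwise (toℕ j)) ⟩
      ∑[ j ∈ allFin width ] 𝓔.descentsAt (val w) (toℕ j) ∎
      where
      open ≡-Reasoning
      h : ℕ → ℕ → ℕ
      h zero    r = 0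
      h (suc j) r = ⟦ 𝓔.descent? (val w) j r ⟧
      columnwise : ∀ j → ∑ (rowsOf j) (h j) ≡ 𝓔.descentsAt (val w) j
      columnwise zero    = ∑-zero (rowsOf 0) (λ _ → refl)
      columnwise (suc j) = refl
      pointwise : ∀ b j → proj₁ (pos b) ≡ j → ⟦ M.descent? w b ⟧ * (M.leg w b + 1) ≡ h j (rowOf b)
      pointwise b j eq with ⟦⟧-dec (M.descent? w b)
      pointwise b j eq | inj₁ ((a , leftOf , Fa<Fb) , one) = subst (λ j → ⟦ M.descent? w b ⟧ * (M.leg w b + 1) ≡ h j (rowOf b))
          (trans (sym (cong proj₁ at-b)) eq)
          (trans (cong₂ (λ u v → u * (v + 1)) one leg≡0) (sym (⟦⟧-yes (𝓔.descent? (val w) j′ (rowOf b)) (lo<r , r≤ , F<F))))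
        where
        j′ : ℕ
        j′ = proj₁ (pos a)
        at-b : pos b ≡ (suc j′ , rowOf a)
        at-b = leftOf-at a b leftOf
        rows≡ : rowOf b ≡ rowOf a
        rows≡ = cong proj₂ at-b
        lo<r : lo j′ < rowOf b
        lo<r = subst (lo j′ <_) (sym rows≡) (proj₁ (proj₂ (pos-in a)))
        r≤ : rowOf b ≤ hi (suc j′)
        r≤ = subst (λ j → rowOf b ≤ hi j) (cong proj₁ at-b) (proj₂ (proj₂ (pos-in b)))
        F<F : val w j′ (rowOf b) < val w (suc j′) (rowOf b)
        F<F = subst₂ _<_ (sym (val-pos w a (cong (λ k → _,_ {B = λ _ → ℕ} j′ k) (sym rows≡)))) (sym (val-pos w b (cong (λ k → _,_ {B = λ _ → ℕ} k (rowOf b)) (cong proj₁ at-b)))) Fa<Fb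
        leg≡0 : M.leg w b ≡ 0
        leg≡0 = m≤n⇒m∸n≡0 (≮⇒≥ (λ col<part → <⇒≱ lo<r (≤-trans (far (rowOf b) refl (≤-trans (s≤s (≤-reflexive (sym col≡))) col<part)) (gap j′))))
          where
          col≡ : colOf b ≡ 2 + j′
          col≡ = trans (colOf-suc b) (cong suc (cong proj₁ at-b))
          far : ∀ r → r ≡ rowOf b → 3 + j′ ≤ part (conjugatePartition κ) (rowOf b) → rowOf b ≤ hi (2 + j′)
          far zero    eq _ = subst (_≤ hi (2 + j′)) eq z≤n
          far (suc i) eq h = subst (_≤ hi (2 + j′)) eq (proj₁ (part-conjugate κ-desc i (2 + j′))
            (subst (λ r → 3 + j′ ≤ part (conjugatePartition κ) r) (sym eq) h))
      pointwise b zero    eq | inj₂ (_ , none) = cong (_* (M.leg w b + 1)) none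
      pointwise b (suc j) eq | inj₂ (¬d , none) = trans (cong (_* (M.leg w b + 1)) none)
        (sym (⟦⟧-no (𝓔.descent? (val w) j (rowOf b)) (λ { (lo<r , r≤ , F<F) → ¬d (descent lo<r r≤ F<F) })))
        where
        descent : lo j < rowOf b → rowOf b ≤ hi (suc j) → val w j (rowOf b) < val w (suc j) (rowOf b) → M.Descent w b
        descent lo<r r≤ F<F = index l
          , (row-at l , trans (cong suc (col-at l)) (sym (trans (colOf-suc b) (cong suc eq))))
          , subst₂ _<_ (sym (val-at w l)) (val-pos w b (cong (λ k → _,_ {B = λ _ → ℕ} k (rowOf b)) eq)) F<F
          where
          l : In width lo hi (j , rowOf b)
          l = <-trans ≤-refl (subst (_< width) eq (proj₁ (pos-in b))) , lo<r , ≤-trans r≤ (hi-desc j)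

    E-matrices : ∀ (α : Vec ℕ N) d → E s′ N α d ≡
      ∑[ cs ∈ vecs (bools N) width ] endpoints 𝓔.los 𝓔.his cs *
        (⟦ rows cs ≟ᵛ tabulate (λ i → lookup α (Fin.opposite i)) ⟧ * ⟦ + stat e 𝓔.los cs ℤ.≟ d ⟧)
    E-matrices α d = trans (generatingSeries-∑ M.cof? M.maj N α d)
      (𝓔.fillings-matrices M.cof? (λ {w} _ → cof⇒valid {w}) (λ {w} w∈ → valid⇒cof {w} ([1⋯]-positive {w = w} w∈)) α
        (λ w → ⟦ + M.maj w ℤ.≟ d ⟧) (λ cs → ⟦ + stat e 𝓔.los cs ℤ.≟ d ⟧)
        (λ {w} w∈ valid → cong (λ m → ⟦ + m ℤ.≟ d ⟧) (trans (maj-descents w) (𝓔.descents-stat valid (𝓔.val-lettered w∈)))))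

  module _ (N : ℕ) where
    private
      module 𝓛 = Passages tupleDiagram lo≤hi lo-desc hi-desc gap hi-end N
      module S = LLTPolynomial ν
      open Diagram tupleDiagram
      open Values tupleDiagram

      rowOf : Fin size → ℕ
      rowOf u = row (S.box u)

      colOf≡1 : ∀ u → col (S.box u) ≡ 1
      colOf≡1 u = proj₂ (∈-tuple⁻ (∈-lookup {xs = tupleCells} u))

      val-at : ∀ w {j r} (i : In width lo hi (j , r)) → lookup w (index i) ≡ val w j r
      val-at w i = sym (val-pos w (index i) (pos-index i))

    ssyt⇒valid : ∀ {w} → S.SSYT w → 𝓛.Valid (val w)
    ssyt⇒valid {w} (_ , _ , columns) j j<n r r′ lo<r r<r′ r′≤ = subst₂ _<_ (val-at w i) (val-at w i′)
      (columns (index i) (index i′)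
        (Finₚ.toℕ-injective (trans (cong proj₁ (pos-index i)) (sym (cong proj₁ (pos-index i′))))
        , trans (colOf≡1 (index i)) (sym (colOf≡1 (index i′))))
        (subst₂ _<_ (sym (cong proj₂ (pos-index i))) (sym (cong proj₂ (pos-index i′))) r<r′))
      where
      i : In width lo hi (j , r)
      i = j<n , lo<r , ≤-trans (<⇒≤ r<r′) r′≤
      i′ : In width lo hi (j , r′)
      i′ = j<n , <-trans lo<r r<r′ , r′≤

    valid⇒ssyt : ∀ {w} → Positive w → 𝓛.Valid (val w) → S.SSYT w
    valid⇒ssyt {w} positive valid = positive
      , (λ u v _ col< → contradiction (subst₂ _<_ (colOf≡1 u) (colOf≡1 v) col<) (<-irrefl refl))
      , λ { u v (same , _) row< → subst₂ _<_ (val-pos w u refl)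
              (val-pos w v (cong (λ c → _,_ {B = λ _ → ℕ} (toℕ c) (rowOf v)) (sym same)))
              (valid (proj₁ (pos u)) (proj₁ (pos-in u)) (rowOf u) (rowOf v) (proj₁ (proj₂ (pos-in u))) row<
                (subst (λ c → rowOf v ≤ hi (toℕ c)) (sym same) (proj₂ (proj₂ (pos-in v))))) }

    inv-passages : ∀ w → S.SSYT w → S.inv w ≡ 𝓛.forced + (∑[ j ∈ allFin width ] 𝓛.passagesAt (val w) (toℕ j))
    inv-passages w ssyt = begin
      S.inv w
        ≡⟨ length-filter-∑ (S.inversion? w) (cartesianProduct (allFin size) (allFin size)) ⟩
      ∑[ p ∈ cartesianProduct (allFin size) (allFin size) ] ⟦ S.inversion? w p ⟧
        ≡⟨ ∑-cartesianProductWith _,_ (allFin size) (allFin size) (λ p → ⟦ S.inversion? w p ⟧) ⟩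
      ∑[ u ∈ allFin size ] ∑[ v ∈ allFin size ] ⟦ S.inversion? w (u , v) ⟧
        ≡⟨ ∑-cong (allFin size) (λ u → ∑-cong (allFin size) (λ v → ⟦⟧-⇔ (S.inversion? w (u , v))
             (𝓛.horizontal? F (pos u) (pos v) ⊎-dec 𝓛.diagonal? F (pos u) (pos v)) (to u v) (from u v))) ⟩
      ∑[ u ∈ allFin size ] ∑[ v ∈ allFin size ] ⟦ 𝓛.horizontal? F (pos u) (pos v) ⊎-dec 𝓛.diagonal? F (pos u) (pos v) ⟧
        ≡⟨ 𝓛.inversions F (ssyt⇒valid {w} ssyt) ⟩
      𝓛.forced + (∑[ j ∈ allFin width ] 𝓛.passagesAt F (toℕ j)) ∎
      where
      open ≡-Reasoning
      F : ℕ → ℕ → ℕ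
      F = val w
      content-row : ∀ u → content (S.box u) ≡ + 1 ℤ.- + rowOf u
      content-row u = cong (λ c → + c ℤ.- + rowOf u) (colOf≡1 u)
      minus-injective : ∀ {m n} → + 1 ℤ.- + m ≡ + 1 ℤ.- + n → m ≡ n
      minus-injective {m} {n} eq = ℤₚ.+-injective (ℤₚ.neg-injective (∙-cancelˡ (+ 1) (- (+ m)) (- (+ n)) eq))
      minus-suc : ∀ m → (+ 1 ℤ.- + m) ℤ.- + 1 ≡ + 1 ℤ.- + suc m
      minus-suc m = trans (ℤₚ.+-assoc (+ 1) (- (+ m)) (- (+ 1)))
        (cong (λ t → + 1 ℤ.+ t) (trans (sym (ℤₚ.neg-distrib-+ (+ m) (+ 1))) (cong (λ t → - (+ t)) (+-comm m 1))))
      value : ∀ u → F (proj₁ (pos u)) (rowOf u) ≡ lookup w u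
      value u = val-pos w u refl
      to : ∀ u v → S.Inversion w (u , v) → 𝓛.Inverted F (pos u) (pos v)
      to u v (gt , inj₁ (c<c , eq)) = inj₁ (subst₂ _<_ (sym (value v)) (sym (value u)) gt , c<c
        , minus-injective (trans (sym (content-row u)) (trans eq (content-row v))))
      to u v (gt , inj₂ (c>c , eq)) = inj₂ (subst₂ _<_ (sym (value v)) (sym (value u)) gt , c>c
        , minus-injective (trans (sym (content-row u)) (trans eq (trans (cong (λ t → t ℤ.- + 1) (content-row v)) (minus-suc (rowOf v))))))
      from : ∀ u v → 𝓛.Inverted F (pos u) (pos v) → S.Inversion w (u , v)
      from u v (inj₁ (gt , c<c , eq)) = subst₂ _<_ (value v) (value u) gt , inj₁ (c<c
        , trans (content-row u) (trans (cong (λ t → + 1 ℤ.- + t) eq) (sym (content-row v))))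
      from u v (inj₂ (gt , c>c , eq)) = subst₂ _<_ (value v) (value u) gt , inj₂ (c>c
        , trans (content-row u) (trans (cong (λ t → + 1 ℤ.- + t) eq)
            (trans (sym (minus-suc (rowOf v))) (cong (λ t → t ℤ.- + 1) (sym (content-row v))))))

    LLT-matrices : ∀ (α : Vec ℕ N) d → LLT ν N α (d ℤ.- (- (+ 𝓛.forced))) ≡
      ∑[ cs ∈ vecs (bools N) width ] endpoints 𝓛.los 𝓛.his cs *
        (⟦ rows cs ≟ᵛ tabulate (λ i → lookup α i) ⟧ * ⟦ + stat ℓ 𝓛.los cs ℤ.≟ d ⟧)
    LLT-matrices α d = trans (generatingSeries-∑ S.ssyt? S.inv N α d′)
      (𝓛.fillings-matrices S.ssyt? (λ {w} _ → ssyt⇒valid {w}) (λ {w} w∈ → valid⇒ssyt {w} ([1⋯]-positive {w = w} w∈)) α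
        (λ w → ⟦ + S.inv w ℤ.≟ d′ ⟧) (λ cs → ⟦ + stat ℓ 𝓛.los cs ℤ.≟ d ⟧)
        (λ {w} w∈ valid → trans
          (cong (λ m → ⟦ + m ℤ.≟ d′ ⟧) (trans (inv-passages w (valid⇒ssyt {w} ([1⋯]-positive {w = w} w∈) valid))
            (cong (λ t → 𝓛.forced + t) (𝓛.passages-stat valid (𝓛.val-lettered w∈)))))
          (shifted (stat ℓ 𝓛.los (𝓛.matrix (val w))))))
      where
      d′ : ℤ
      d′ = d ℤ.- (- (+ 𝓛.forced))
      d′≡ : d′ ≡ + 𝓛.forced ℤ.+ d
      d′≡ = trans (cong (λ t → d ℤ.+ t) (ℤₚ.neg-involutive (+ 𝓛.forced))) (ℤₚ.+-comm d (+ 𝓛.forced))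
      shifted : ∀ m → ⟦ + (𝓛.forced + m) ℤ.≟ d′ ⟧ ≡ ⟦ + m ℤ.≟ d ⟧
      shifted m = ⟦⟧-⇔ (+ (𝓛.forced + m) ℤ.≟ d′) (+ m ℤ.≟ d)
        (λ eq → ∙-cancelˡ (+ 𝓛.forced) (+ m) d (trans eq d′≡))
        (λ eq → trans (cong (λ t → + 𝓛.forced ℤ.+ t) eq) (sym d′≡))

  private
    -- `forced` is computed from the heights of the columns, so the constant of this instance is
    -- definitionally the one in `LLT-matrices N` for each `N`.
    module 𝓛₀ = Passages tupleDiagram lo≤hi lo-desc hi-desc gap hi-end 0
    open Diagram tupleDiagram
    open Values tupleDiagram

  mininv : ℕ
  mininv = 𝓛₀.forced

  -- The filling of every box by its row number has only the forced inversions.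
  isMininv : IsMininv ν mininv
  isMininv = (rowFilling , ssyt , trans (inv-passages 0 rowFilling ssyt)
               (trans (cong (λ t → mininv + t) (𝓛₀.inversions-rows (val rowFilling) rows≡)) (+-identityʳ mininv)))
           , λ w s → subst (mininv ≤_) (sym (inv-passages 0 w s)) (m≤m+n mininv _)
    where
    rowFilling : Vec ℕ size
    rowFilling = 𝓛₀.filling (λ _ r → r)
    rows≡ : ∀ j r → In width lo hi (j , r) → val rowFilling j r ≡ r
    rows≡ j r i = sym (𝓛₀.val-filling (λ _ r → r) j r i)
    valid : 𝓛₀.Valid (val rowFilling)
    valid = 𝓛₀.Valid-agree (𝓛₀.val-filling (λ _ r → r)) (λ j _ r r′ _ r<r′ _ → r<r′)
    ssyt : LLTPolynomial.SSYT ν rowFilling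
    ssyt = valid⇒ssyt 0 {rowFilling} (λ u → subst (0 <_) (sym (Vecₚ.lookup∘tabulate (λ b → proj₂ (pos b)) u))
      (≤-<-trans z≤n (proj₁ (proj₂ (pos-in u))))) valid

  E≈LLT : E s′ ≈ q^ (- (+ mininv)) · LLT ν
  E≈LLT N α d = trans (E-matrices N α d) (trans
    (matrices-equinumerous N (tabulate (λ j → lo (toℕ j))) (tabulate (λ j → hi (toℕ j)))
      (Descending-tabulate width lo lo-desc) (Descending-tabulate width hi hi-desc) (Gap-tabulate width lo hi gap)
      (lookup α) (λ m → ⟦ + m ℤ.≟ d ⟧))
    (sym (LLT-matrices N α d)))

theorem45 : (s : SkewShape) → IsSkewShape s → (∀ j → columnLength s j ≤ 2) →
    ∃[ k ] (IsMininv (rowStrips s) k × E (conjugate s) ≈ q^ (- (+ k)) · LLT (rowStrips s))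
theorem45 (κ / τ) ((κ-desc , _) , (τ-desc , _) , τ≤κ) narrow = mininv , isMininv , E≈LLT
  where open NarrowShape κ τ κ-desc τ-desc τ≤κ narrow
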